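{- The map $W^J\times Q^\vee/Q_J^\vee\to\{w\in W_a: w\text{ lies in }\mathcal A_J\}$, $(u,\bar\alpha)\mapsto u\bullet t_{\bar\alpha}$, is a bijection.
   Context: Let $\Phi$ be a reduced irreducible finite crystallographic root system in an $n$-dimensional Euclidean space $V$ with inner product $(\cdot,\cdot)$, simple roots $\alpha_1,\dots,\alpha_n$, positive roots $\Phi^+$, highest root $\theta$; $\alpha^\vee=2\alpha/(\alpha,\alpha)$, $Q^\vee=\bigoplus\mathbb Z\alpha_i^\vee$. Affine maps act on the right: $(x)s_{\alpha,k}=x-((x,\alpha)-k)\alpha^\vee$, $(x)t_\lambda=x+\lambda$. $W=\langle s_i=s_{\alpha_i,0}:1\le i\le n\rangle$, $W_a=W\ltimes Q^\vee$ generated by $s_0=s_\theta t_{\theta^\vee},s_1,\dots,s_n$. $A_0=\{x:0<(x,\alpha)<1\ \forall\alpha\in\Phi^+\}$; $w\in W_a$ is identified with the alcove $A_0w$. Let $J\subseteq\{1,\dots,n\}$, $W_J=\langle s_j:j\in J\rangle$, $W^J$ the set of minimal length representatives of the cosets $xW_J$, $x\in W$. $\Phi_J^+$: positive roots in the span of $\{\alpha_j:j\in J\}$; $Q_J^\vee=\bigoplus_{j\in J}\mathbb Z\alpha_j^\vee$; $\bar\alpha$ the class of $\alpha$ modulo $Q_J^\vee$; $\widetilde W_J=W_J\ltimes Q_J^\vee$. $\mathcal A_J=\{x:0<(x,\alpha)<1\ \forall\alpha\in\Phi_J^+\}$; $w\in W_a$ lies in $\mathcal A_J$ if $A_0w\subseteq\mathcal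 A_J$. For $x\in W_a$ there is a unique $w\in\widetilde W_J$ with $xw$ lying in $\mathcal A_J$, set $p_J(x)=xw$; for $x\in W_a$ (in particular for $x$ lying in $\mathcal A_J$) and $\alpha\in Q^\vee$, $x\bullet t_{\bar\alpha}:=p_J(xt_\alpha)$, which depends only on $x$ and $\bar\alpha$. -}

module Defs where

open import Data.Nat using (ℕ; zero; suc)
open import Data.Fin using (Fin; zero; suc)
open import Data.Fin.Subset using (Subset; _∈_; _∉_; ⊥; ⊤)
open import Data.Integer as ℤ using (ℤ; +_)
open import Data.Rational as ℚ using (ℚ; 0ℚ; 1ℚ; _/_)
open import Data.List using (List; []; _∷_; length)
open import Data.List.Relation.Unary.All using (All)
open import Data.Product using (Σ; ∃; ∃-syntax; _×_; _,_)
open import Data.Sum using (_⊎_)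
open import Relation.Binary.PropositionalEquality using (_≡_; _≢_)
open import Relation.Nullary using (¬_)

-- Conventions.
-- The root system Φ (rank n) is encoded by its Cartan matrix
--   C i j = ⟨α_i^∨ , α_j⟩ = 2(α_i,α_j)/(α_i,α_i)   (an integer).
-- A point x ∈ V is encoded by its coordinates  c i = (x , α_i)  (rational
-- points; they are dense in V).  A root β is encoded by its coordinates
-- in the basis of simple roots (integers).  An element λ of Q^∨ is
-- encoded by its coordinates in the basis α_1^∨,…,α_n^∨ (integers).

CartanMatrix : ℕ → Set
CartanMatrix n = Fin n → Fin n → ℤ

ℤ→ℚ : ℤ → ℚ
ℤ→ℚ k = k / 1

sumℚ : ∀ {n} → (Fin n → ℚ) → ℚ
sumℚ {zero}  f = 0ℚ
sumℚ {suc n} f = f zero ℚ.+ sumℚ (λ i → f (suc i))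

sumℤ : ∀ {n} → (Fin n → ℤ) → ℤ
sumℤ {zero}  f = + 0
sumℤ {suc n} f = f zero ℤ.+ sumℤ (λ i → f (suc i))

-- C is the Cartan matrix of a reduced, irreducible, finite crystallographic
-- root system with simple roots α_1,…,α_n:
--   * C i i = 2, C i j ≤ 0 for i ≠ j;
--   * there are d i = (α_i,α_i)/2 > 0 with (α_i,α_j) = C i j * d i symmetric,
--     and the resulting Gram matrix is positive definite (Euclidean space);
--   * irreducible: no partition of the simple roots into two nonempty
--     mutually orthogonal parts.
record IsFiniteIrreducibleCartan {n : ℕ} (C : CartanMatrix n) : Set where
  field
    diag     : ∀ i → C i i ≡ + 2
    offdiag  : ∀ i j → i ≢ j → C i j ℤ.≤ + 0
    d        : Fin n → ℚ
    d-pos    : ∀ i → 0ℚ ℚ.< d i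
    d-sym    : ∀ i j → ℤ→ℚ (C i j) ℚ.* d i ≡ ℤ→ℚ (C j i) ℚ.* d j
    posdef   : ∀ (x : Fin n → ℚ) → (∃[ i ] x i ≢ 0ℚ) →
               0ℚ ℚ.< sumℚ (λ i → sumℚ (λ j → x i ℚ.* x j ℚ.* ℤ→ℚ (C i j) ℚ.* d i))
    irreducible : ∀ (S : Subset n) →
               (∀ i j → i ∈ S → j ∉ S → C i j ≡ + 0) →
               (∀ i → i ∈ S) ⊎ (∀ i → i ∉ S)

module _ {n : ℕ} (C : CartanMatrix n) where

  Pt : Set
  Pt = Fin n → ℚ

  _≐_ : Pt → Pt → Set
  x ≐ y = ∀ i → x i ≡ y i

  pair : Pt → (Fin n → ℤ) → ℚ
  pair x β = sumℚ (λ i → ℤ→ℚ (β i) ℚ.* x i)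

  simple : Fin n → (Fin n → ℤ)
  simple i k with i Data.Fin.≟ k
  ... | Relation.Nullary.yes _ = + 1
  ... | Relation.Nullary.no  _ = + 0

  -- β ↦ β s_j = β - (β, α_j^∨) α_j ;  (β , α_j^∨) = Σ_k β_k C j k
  reflRoot : Fin n → (Fin n → ℤ) → (Fin n → ℤ)
  reflRoot j β k with j Data.Fin.≟ k
  ... | Relation.Nullary.yes _ = β k ℤ.- sumℤ (λ l → β l ℤ.* C j l)
  ... | Relation.Nullary.no  _ = β k

  actRoot : List (Fin n) → (Fin n → ℤ) → (Fin n → ℤ)
  actRoot []      β = β
  actRoot (j ∷ w) β = actRoot w (reflRoot j β)

  IsRoot : (Fin n → ℤ) → Set
  IsRoot β = ∃[ w ] ∃[ i ] (∀ k → β k ≡ actRoot w (simple i) k)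

  IsPosRootJ : Subset n → (Fin n → ℤ) → Set
  IsPosRootJ J β = IsRoot β × (∀ k → + 0 ℤ.≤ β k) × (∀ k → β k ≢ + 0 → k ∈ J)

  -- Affine Weyl group W_a = W ⋉ Q^∨, elements given by words in
  -- s_i and t_{±α_i^∨}, acting on the right on points.
  data Gen : Set where
    refl-s : Fin n → Gen
    tr+    : Fin n → Gen
    tr-    : Fin n → Gen

  genIdx : Gen → Fin n
  genIdx (refl-s i) = i
  genIdx (tr+ i)    = i
  genIdx (tr- i)    = i

  -- (x s_j , α_i) = (x,α_i) - (x,α_j) ⟨α_j^∨,α_i⟩ ;
  -- (x + α_k^∨ , α_i) = (x,α_i) + ⟨α_k^∨,α_i⟩
  actGen : Gen → Pt → Pt
  actGen (refl-s j) x i = x i ℚ.- x j ℚ.* ℤ→ℚ (C j i)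
  actGen (tr+ k)    x i = x i ℚ.+ ℤ→ℚ (C k i)
  actGen (tr- k)    x i = x i ℚ.- ℤ→ℚ (C k i)

  Word : Set
  Word = List Gen

  act : Word → Pt → Pt
  act []      x = x
  act (g ∷ w) x = act w (actGen g x)

  actW : List (Fin n) → Pt → Pt
  actW []      x = x
  actW (j ∷ w) x = actW w (actGen (refl-s j) x)

  QV : Set
  QV = Fin n → ℤ

  translate : QV → Pt → Pt
  translate m x i = x i ℚ.+ sumℚ (λ k → ℤ→ℚ (m k) ℚ.* ℤ→ℚ (C k i))

  _≈W_ : List (Fin n) → List (Fin n) → Set
  u ≈W u' = ∀ x → actW u x ≐ actW u' x

  _≈_ : Word → Word → Set
  w ≈ w' = ∀ x → act w x ≐ act w' x

  -- W_J and W̃_J = W_J ⋉ Q_J^∨ as words with all indices in J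
  InWJ : Subset n → List (Fin n) → Set
  InWJ J v = All (λ j → j ∈ J) v

  InW̃J : Subset n → Word → Set
  InW̃J J v = All (λ g → genIdx g ∈ J) v

  InQJ : Subset n → QV → Set
  InQJ J m = ∀ k → m k ≢ + 0 → k ∈ J

  _≡[_]_ : QV → Subset n → QV → Set
  m ≡[ J ] m' = InQJ J (λ k → m k ℤ.- m' k)

  -- W^J : u ∈ W of minimal length in its coset u W_J; u is given by a
  -- word which realises this minimal length (so length u = ℓ(u)).
  IsMinRep : Subset n → List (Fin n) → Set
  IsMinRep J u = ∀ (u' v : List (Fin n)) → InWJ J v →
                 (∀ x → actW u' x ≐ actW v (actW u x)) →
                 length u Data.Nat.≤ length u'

  InRegionJ : Subset n → Pt → Set
  InRegionJ J x = ∀ β → IsPosRootJ J β → (0ℚ ℚ.< pair x β) × (pair x β ℚ.< 1ℚ)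

  InA0 : Pt → Set
  InA0 = InRegionJ ⊤

  LiesIn : Subset n → Word → Set
  LiesIn J w = ∀ x → InA0 x → InRegionJ J (act w x)

  -- The graph of (u , ᾱ) ↦ u • t_ᾱ = p_J(u t_α):
  -- w = u t_α v for some v ∈ W̃_J, and w lies in 𝒜_J.
  IsBullet : Subset n → List (Fin n) → QV → Word → Set
  IsBullet J u m w = LiesIn J w ×
    (∃[ v ] (InW̃J J v × (∀ x → act w x ≐ act v (translate m (actW u x)))))

{-# OPTIONS --safe #-}
-- Roots and coroots are handled as integer vectors.  A root β with coroot β^ satisfies ⟨β^,β⟩ = 2 and
-- D β^_k = D_k β_k, and these two facts alone force its coordinates to have one sign; exchange, and
-- generation of the reflections in Φ_J by W_J, follow from there.
--
-- Well-definedness and injectivity rest on W̃_J acting freely on the alcoves inside 𝒜_J.  An element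
-- carrying one of them to another has a translation part pairing to 0 or 1 with all positive roots of
-- Φ_J, and such a vector of Q_J^∨ vanishes: reflecting it in a simple root with which it has positive
-- product with its own coordinate shortens it while keeping the property.
--
-- Existence of u • t_ᾱ needs no termination argument.  If w lies in 𝒜_J and s is one of s_0,…,s_n, then
-- s w is either still in 𝒜_J or is carried back to w by the reflection w⁻¹ s w ∈ W̃_J.  The elements g for
-- which every g w can be brought back to 𝒜_J are closed under products and contain s_0,…,s_n, hence the
-- translation by θ^∨ and by its W-conjugates; these span Q^∨, because a dominant root γ ≠ θ has ⟨θ^∨,γ⟩ = 1,
-- whence γ^∨ = θ^∨ − (θ^∨) s_γ.
module Submission where

open import Defs
open import Defs using () renaming (ℤ→ℚ to ι)
open import Algebra.Structures using (IsCommutativeRing)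
open import Data.Empty using (⊥-elim)
open import Data.Fin using (Fin; zero; suc)
open import Data.Fin.Properties as Fin using (any?; all?)
open import Data.Fin.Subset using (Subset; _∈_; _∉_)
import Data.Fin.Subset as Subset
import Data.Fin.Subset.Properties as Subset
open import Data.Integer as ℤ using (ℤ; +_; +[1+_]; -[1+_]; _+_; _*_; _-_; -_; _≤_; _<_; ∣_∣; 0ℤ; 1ℤ; +≤+; +<+; _⊔_)
import Data.Integer.Properties as ℤ
open import Data.Integer.Tactic.RingSolver using (solve-∀)
open import Data.List using (List; []; _∷_; _++_; length; reverse; [_]; map)
import Data.List.Properties as List
open import Data.List.Relation.Unary.All using (All; []; _∷_)
import Data.List.Relation.Unary.All.Properties as All
open import Data.Nat as ℕ using (ℕ; zero; suc)
import Data.Nat.Properties as ℕ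
open import Data.Product using (∃-syntax; Σ-syntax; _×_; _,_; proj₁; proj₂)
open import Data.Rational as ℚ using (ℚ; 0ℚ; 1ℚ; ↥_; ↧_)
import Data.Rational.Properties as ℚ
open import Data.Rational.Unnormalised as ℚᵘ using (mkℚᵘ; *≡*; *<*)
import Data.Rational.Unnormalised.Properties as ℚᵘ
open import Data.Sum using (_⊎_; inj₁; inj₂)
open import Data.Unit using (⊤; tt)
import Data.Vec as Vec
import Data.Vec.Properties as Vec
open import Function using (_∘_)
open import Level using (0ℓ)
open import Relation.Binary.Definitions using (tri<; tri≈; tri>)
open import Relation.Binary.PropositionalEquality hiding ([_])
open import Relation.Nullary using (¬_; yes; no; does; ¬?; _×-dec_; _⊎-dec_)
open import Relation.Nullary.Decidable using (decidable-stable; dec-true; dec⇒maybe)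
open import Tactic.RingSolver using () renaming (solve-∀ to solve-∀-in)
open import Tactic.RingSolver.Core.AlmostCommutativeRing using (AlmostCommutativeRing; fromCommutativeRing)

-- Finiteness of the root system is not given: words in the reflections are unbounded, and only
-- positive definiteness limits the roots. Completing squares over ℤ bounds the integer vectors of
-- given norm, hence the heights; this bound makes the climb to a dominant root stop and supplies
-- the point `p₀` of A₀. Lying in 𝒜_J quantifies over all points of A₀, but its integral content can
-- be read off at `p₀` alone: for each β in Φ_J⁺ it fixes the pairing of the translation part with
-- β. Points occur only through their pairings: an element g of W_a is described by F and φ with (x
-- g , β) = (x , F β) + φ β. Moving a right action across the pairing reverses the order of letters,
-- hence the frequent `reverse`. The returning elements are not visibly closed under inverses.
-- Negative translations are obtained as conjugates instead, since reflecting η^∨ in η gives -η^∨.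
-- For s_0 everything rests on θ being long and highest: a positive root γ ≠ θ has ⟨θ^∨,γ⟩ equal to
-- 0 or 1, and in the second case γ - θ is negative. Such a θ is found by climbing from a simple
-- root of maximal length.

module Summation {A : Set} {_⊕_ _⊗_ : A → A → A} {⊖_ : A → A} {𝟘 𝟙 : A}
  (isCommutativeRing : IsCommutativeRing _≡_ _⊕_ _⊗_ ⊖_ 𝟘 𝟙)
  (∑ : ∀ {n} → (Fin n → A) → A)
  (∑-nil : (f : Fin 0 → A) → ∑ f ≡ 𝟘)
  (∑-cons : ∀ {n} (f : Fin (suc n) → A) → ∑ f ≡ (f zero ⊕ ∑ (λ i → f (suc i))))
  where

  private module R = IsCommutativeRing isCommutativeRing
  open ≡-Reasoning

  ∑-cong : ∀ {n} {f g : Fin n → A} → (∀ i → f i ≡ g i) → ∑ f ≡ ∑ g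
  ∑-cong {zero}  {f} {g} e = trans (∑-nil f) (sym (∑-nil g))
  ∑-cong {suc n} {f} {g} e = begin
    ∑ f                             ≡⟨ ∑-cons f ⟩
    f zero ⊕ ∑ (λ i → f (suc i))    ≡⟨ cong₂ _⊕_ (e zero) (∑-cong (e ∘ suc)) ⟩
    g zero ⊕ ∑ (λ i → g (suc i))    ≡⟨ sym (∑-cons g) ⟩
    ∑ g                             ∎

  ∑-zero : ∀ {n} {f : Fin n → A} → (∀ i → f i ≡ 𝟘) → ∑ f ≡ 𝟘
  ∑-zero {zero}  {f} e = ∑-nil f
  ∑-zero {suc n} {f} e = begin
    ∑ f                             ≡⟨ ∑-cons f ⟩
    f zero ⊕ ∑ (λ i → f (suc i))    ≡⟨ cong₂ _⊕_ (e zero) (∑-zero (e ∘ suc)) ⟩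
    𝟘 ⊕ 𝟘                           ≡⟨ R.+-identityˡ 𝟘 ⟩
    𝟘                               ∎

  ⊕-interchange : ∀ a b c d → ((a ⊕ b) ⊕ (c ⊕ d)) ≡ ((a ⊕ c) ⊕ (b ⊕ d))
  ⊕-interchange a b c d = begin
    (a ⊕ b) ⊕ (c ⊕ d)    ≡⟨ R.+-assoc a b (c ⊕ d) ⟩
    a ⊕ (b ⊕ (c ⊕ d))    ≡⟨ cong (a ⊕_) (sym (R.+-assoc b c d)) ⟩
    a ⊕ ((b ⊕ c) ⊕ d)    ≡⟨ cong (λ t → a ⊕ (t ⊕ d)) (R.+-comm b c) ⟩
    a ⊕ ((c ⊕ b) ⊕ d)    ≡⟨ cong (a ⊕_) (R.+-assoc c b d) ⟩
    a ⊕ (c ⊕ (b ⊕ d))    ≡⟨ sym (R.+-assoc a c (b ⊕ d)) ⟩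
    (a ⊕ c) ⊕ (b ⊕ d)    ∎

  ∑-distrib-+ : ∀ {n} (f g : Fin n → A) → ∑ (λ i → f i ⊕ g i) ≡ (∑ f ⊕ ∑ g)
  ∑-distrib-+ {zero}  f g = begin
    ∑ (λ i → f i ⊕ g i)   ≡⟨ ∑-nil _ ⟩
    𝟘                     ≡⟨ sym (R.+-identityˡ 𝟘) ⟩
    𝟘 ⊕ 𝟘                 ≡⟨ sym (cong₂ _⊕_ (∑-nil f) (∑-nil g)) ⟩
    ∑ f ⊕ ∑ g             ∎
  ∑-distrib-+ {suc n} f g = begin
    ∑ (λ i → f i ⊕ g i)
      ≡⟨ ∑-cons _ ⟩
    (f zero ⊕ g zero) ⊕ ∑ (λ i → f (suc i) ⊕ g (suc i))
      ≡⟨ cong ((f zero ⊕ g zero) ⊕_) (∑-distrib-+ (f ∘ suc) (g ∘ suc)) ⟩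
    (f zero ⊕ g zero) ⊕ (∑ (f ∘ suc) ⊕ ∑ (g ∘ suc))
      ≡⟨ ⊕-interchange _ _ _ _ ⟩
    (f zero ⊕ ∑ (f ∘ suc)) ⊕ (g zero ⊕ ∑ (g ∘ suc))
      ≡⟨ sym (cong₂ _⊕_ (∑-cons f) (∑-cons g)) ⟩
    ∑ f ⊕ ∑ g ∎

  ∑-distribˡ-* : ∀ {n} c (f : Fin n → A) → ∑ (λ i → c ⊗ f i) ≡ (c ⊗ ∑ f)
  ∑-distribˡ-* {zero}  c f = begin
    ∑ (λ i → c ⊗ f i)   ≡⟨ ∑-nil _ ⟩
    𝟘                   ≡⟨ sym (R.zeroʳ c) ⟩
    c ⊗ 𝟘               ≡⟨ cong (c ⊗_) (sym (∑-nil f)) ⟩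
    c ⊗ ∑ f             ∎
  ∑-distribˡ-* {suc n} c f = begin
    ∑ (λ i → c ⊗ f i)                        ≡⟨ ∑-cons _ ⟩
    (c ⊗ f zero) ⊕ ∑ (λ i → c ⊗ f (suc i))   ≡⟨ cong ((c ⊗ f zero) ⊕_) (∑-distribˡ-* c (f ∘ suc)) ⟩
    (c ⊗ f zero) ⊕ (c ⊗ ∑ (f ∘ suc))         ≡⟨ sym (R.distribˡ c _ _) ⟩
    c ⊗ (f zero ⊕ ∑ (f ∘ suc))               ≡⟨ cong (c ⊗_) (sym (∑-cons f)) ⟩
    c ⊗ ∑ f                                  ∎

  ∑-swap : ∀ {m n} (f : Fin m → Fin n → A) →
           ∑ (λ i → ∑ (λ j → f i j)) ≡ ∑ (λ j → ∑ (λ i → f i j))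
  ∑-swap {zero}  f = trans (∑-nil _) (sym (∑-zero (λ j → ∑-nil _)))
  ∑-swap {suc m} f = begin
    ∑ (λ i → ∑ (λ j → f i j))
      ≡⟨ ∑-cons _ ⟩
    ∑ (λ j → f zero j) ⊕ ∑ (λ i → ∑ (λ j → f (suc i) j))
      ≡⟨ cong (∑ (λ j → f zero j) ⊕_) (∑-swap (λ i → f (suc i))) ⟩
    ∑ (λ j → f zero j) ⊕ ∑ (λ j → ∑ (λ i → f (suc i) j))
      ≡⟨ sym (∑-distrib-+ _ _) ⟩
    ∑ (λ j → f zero j ⊕ ∑ (λ i → f (suc i) j))
      ≡⟨ ∑-cong (λ j → sym (∑-cons _)) ⟩
    ∑ (λ j → ∑ (λ i → f i j)) ∎

  ∑-single : ∀ {n} (k : Fin n) (f : Fin n → A) → (∀ i → k ≢ i → f i ≡ 𝟘) → ∑ f ≡ f k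
  ∑-single zero f e = begin
    ∑ f                    ≡⟨ ∑-cons f ⟩
    f zero ⊕ ∑ (f ∘ suc)   ≡⟨ cong (f zero ⊕_) (∑-zero (λ i → e (suc i) (λ ()))) ⟩
    f zero ⊕ 𝟘             ≡⟨ R.+-identityʳ _ ⟩
    f zero                 ∎
  ∑-single (suc k) f e = begin
    ∑ f                    ≡⟨ ∑-cons f ⟩
    f zero ⊕ ∑ (f ∘ suc)   ≡⟨ cong₂ _⊕_ (e zero (λ ()))
                                (∑-single k (f ∘ suc) (λ i k≢i → e (suc i) (k≢i ∘ Fin.suc-injective))) ⟩
    𝟘 ⊕ f (suc k)          ≡⟨ R.+-identityˡ _ ⟩
    f (suc k)              ∎

-- Integer sums and inequalities.

module Σℤ = Summation ℤ.+-*-isCommutativeRing sumℤ (λ _ → refl) (λ _ → refl)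

∑-nonneg : ∀ {n} (f : Fin n → ℤ) → (∀ i → 0ℤ ≤ f i) → 0ℤ ≤ sumℤ f
∑-nonneg {zero}  f p = ℤ.≤-refl
∑-nonneg {suc n} f p = ℤ.+-mono-≤ (p zero) (∑-nonneg (f ∘ suc) (p ∘ suc))

∑-term-≤ : ∀ {n} (f : Fin n → ℤ) → (∀ i → 0ℤ ≤ f i) → ∀ i → f i ≤ sumℤ f
∑-term-≤ {suc n} f p zero    =
  subst (_≤ sumℤ f) (ℤ.+-identityʳ (f zero)) (ℤ.+-monoʳ-≤ (f zero) (∑-nonneg (f ∘ suc) (p ∘ suc)))
∑-term-≤ {suc n} f p (suc i) =
  ℤ.≤-trans (∑-term-≤ (f ∘ suc) (p ∘ suc) i)
    (subst (_≤ sumℤ f) (ℤ.+-identityˡ _) (ℤ.+-monoˡ-≤ (sumℤ (f ∘ suc)) (p zero)))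

∑-pos⇒term-pos : ∀ {n} (f : Fin n → ℤ) → 0ℤ < sumℤ f → ∃[ i ] 0ℤ < f i
∑-pos⇒term-pos {zero} f p = ⊥-elim (ℤ.<-irrefl refl p)
∑-pos⇒term-pos {suc n} f p with 0ℤ ℤ.<? f zero
... | yes q = zero , q
... | no ¬q with ∑-pos⇒term-pos (f ∘ suc)
                   (ℤ.<-≤-trans p (subst (sumℤ f ≤_) (ℤ.+-identityˡ _)
                     (ℤ.+-monoˡ-≤ (sumℤ (f ∘ suc)) (ℤ.≮⇒≥ ¬q))))
...   | i , r = suc i , r

0≤i*i : ∀ i → 0ℤ ≤ i * i
0≤i*i (+ n)      = subst (0ℤ ≤_) (ℤ.pos-* n n) (+≤+ ℕ.z≤n)
0≤i*i (-[1+ n ]) = +≤+ ℕ.z≤n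

0≤⇒0≤* : ∀ {i j} → 0ℤ ≤ i → 0ℤ ≤ j → 0ℤ ≤ i * j
0≤⇒0≤* {+ m} {+ n} _ _ = subst (0ℤ ≤_) (ℤ.pos-* m n) (+≤+ ℕ.z≤n)

0<⇒0<* : ∀ {i j} → 0ℤ < i → 0ℤ < j → 0ℤ < i * j
0<⇒0<* {+[1+ m ]} {+[1+ n ]} _ _ = ℤ.+<+ (ℕ.s≤s ℕ.z≤n)
0<⇒0<* {+ zero} (ℤ.+<+ ())
0<⇒0<* {+[1+ m ]} {+ zero} _ (ℤ.+<+ ())

0<*⇒0< : ∀ {i j} → 0ℤ < i → 0ℤ < i * j → 0ℤ < j
0<*⇒0< {i} {j} p q = ℤ.*-cancelˡ-<-nonNeg i {{ℤ.nonNegative (ℤ.<⇒≤ p)}} (subst (_< i * j) (sym (ℤ.*-zeroʳ i)) q)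

0≤*⇒0≤ : ∀ {i j} → 0ℤ < i → 0ℤ ≤ i * j → 0ℤ ≤ j
0≤*⇒0≤ {i} {j} p q = ℤ.*-cancelˡ-≤-pos 0ℤ j i {{ℤ.positive p}} (subst (_≤ i * j) (sym (ℤ.*-zeroʳ i)) q)

*-cancelˡ-0< : ∀ {i j k} → 0ℤ < i → i * j ≡ i * k → j ≡ k
*-cancelˡ-0< {i} p = ℤ.*-cancelˡ-≡ i _ _ {{ℤ.>-nonZero p}}

∣∣-mono : ∀ {i j} → 0ℤ ≤ i → i ≤ j → ∣ i ∣ ℕ.≤ ∣ j ∣
∣∣-mono (+≤+ _) (+≤+ p) = p

i*i≤j⇒∣i∣≤∣j∣ : ∀ {i j} → i * i ≤ j → ∣ i ∣ ℕ.≤ ∣ j ∣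
i*i≤j⇒∣i∣≤∣j∣ {i} {j} p = ℕ.≤-trans (n≤n*n ∣ i ∣)
    (subst (ℕ._≤ ∣ j ∣) (ℤ.abs-* i i) (∣∣-mono (0≤i*i i) p))
  where
  n≤n*n : ∀ n → n ℕ.≤ n ℕ.* n
  n≤n*n zero    = ℕ.z≤n
  n≤n*n (suc n) = ℕ.m≤m*n (suc n) (suc n)

∣∑∣≤ : ∀ {n} (b x : Fin n → ℤ) K → (∀ i → ∣ x i ∣ ℕ.≤ K) →
       ∣ sumℤ (λ i → b i * x i) ∣ ℕ.≤ ∣ sumℤ (λ i → + ∣ b i ∣) ∣ ℕ.* K
∣∑∣≤ {zero}  b x K p = ℕ.z≤n
∣∑∣≤ {suc n} b x K p = begin
  ∣ b zero * x zero + sumℤ (λ i → b (suc i) * x (suc i)) ∣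
    ≤⟨ ℤ.∣i+j∣≤∣i∣+∣j∣ (b zero * x zero) _ ⟩
  ∣ b zero * x zero ∣ ℕ.+ ∣ sumℤ (λ i → b (suc i) * x (suc i)) ∣
    ≡⟨ cong (ℕ._+ ∣ T ∣) (ℤ.abs-* (b zero) (x zero)) ⟩
  ∣ b zero ∣ ℕ.* ∣ x zero ∣ ℕ.+ ∣ sumℤ (λ i → b (suc i) * x (suc i)) ∣
    ≤⟨ ℕ.+-mono-≤ (ℕ.*-monoʳ-≤ ∣ b zero ∣ (p zero)) (∣∑∣≤ (b ∘ suc) (x ∘ suc) K (p ∘ suc)) ⟩
  ∣ b zero ∣ ℕ.* K ℕ.+ ∣ S ∣ ℕ.* K
    ≡⟨ sym (ℕ.*-distribʳ-+ K ∣ b zero ∣ ∣ S ∣) ⟩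
  (∣ b zero ∣ ℕ.+ ∣ S ∣) ℕ.* K
    ≡⟨ cong (ℕ._* K) (sym (abs-+-pos (∑-nonneg (λ i → + ∣ b (suc i) ∣) (λ i → +≤+ ℕ.z≤n)))) ⟩
  ∣ + ∣ b zero ∣ + S ∣ ℕ.* K ∎
  where
  open ℕ.≤-Reasoning
  S T : ℤ
  T = sumℤ (λ i → b (suc i) * x (suc i))
  S = sumℤ (λ i → + ∣ b (suc i) ∣)
  abs-+-pos : ∀ {m s} → 0ℤ ≤ s → ∣ + m + s ∣ ≡ m ℕ.+ ∣ s ∣
  abs-+-pos {m} {+ s} _ = refl

-- Positive definite integral quadratic forms.

module QuadraticForm where

  quad : ∀ {n} → (Fin n → Fin n → ℤ) → (Fin n → ℤ) → ℤ
  quad B x = sumℤ λ i → sumℤ λ j → x i * x j * B i j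

  SymmetricMatrix : ∀ {n} → (Fin n → Fin n → ℤ) → Set
  SymmetricMatrix B = ∀ i j → B i j ≡ B j i

  PosDef : ∀ {n} → (Fin n → Fin n → ℤ) → Set
  PosDef B = ∀ x → (∃[ i ] x i ≢ 0ℤ) → 0ℤ < quad B x

  zero? : ∀ {n} (x : Fin n → ℤ) → (∃[ i ] x i ≢ 0ℤ) ⊎ (∀ i → x i ≡ 0ℤ)
  zero? x with any? (λ i → ¬? (x i ℤ.≟ 0ℤ))
  ... | yes p = inj₁ p
  ... | no ¬p = inj₂ λ i → decidable-stable (x i ℤ.≟ 0ℤ) (λ q → ¬p (i , q))

  quad-nonneg : ∀ {n} {B : Fin n → Fin n → ℤ} → PosDef B → ∀ x → 0ℤ ≤ quad B x
  quad-nonneg {B = B} pd x with zero? x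
  ... | inj₁ p = ℤ.<⇒≤ (pd x p)
  ... | inj₂ e = ℤ.≤-reflexive (sym (Σℤ.∑-zero λ i → Σℤ.∑-zero λ j →
          trans (cong (λ t → t * x j * B i j) (e i)) (cong (_* B i j) (ℤ.*-zeroˡ (x j)))))

  quad-scale : ∀ {n} (B : Fin n → Fin n → ℤ) c x → quad B (λ i → c * x i) ≡ c * c * quad B x
  quad-scale {n} B c x = begin
    quad B (λ i → c * x i)
      ≡⟨ Σℤ.∑-cong (λ i → trans (Σℤ.∑-cong (λ j → alg c (x i) (x j) (B i j))) (Σℤ.∑-distribˡ-* {n} (c * c) _)) ⟩
    sumℤ (λ i → c * c * sumℤ (λ j → x i * x j * B i j))
      ≡⟨ Σℤ.∑-distribˡ-* {n} (c * c) _ ⟩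
    c * c * quad B x ∎
    where
    open ≡-Reasoning
    alg : ∀ c x y b → c * x * (c * y) * b ≡ c * c * (x * y * b)
    alg = solve-∀

  module Elimination {n} (B : Fin (suc n) → Fin (suc n) → ℤ) (B-sym : SymmetricMatrix B) where
    a : ℤ
    a = B zero zero

    b : Fin n → ℤ
    b i = B zero (suc i)

    -- The Schur complement of the pivot `a`, multiplied by `a` so that its entries stay integral.
    reduced : Fin n → Fin n → ℤ
    reduced i j = a * B (suc i) (suc j) - b i * b j

    reduced-sym : SymmetricMatrix reduced
    reduced-sym i j = cong₂ (λ s t → a * s - t) (B-sym (suc i) (suc j)) (ℤ.*-comm (b i) (b j))

    lin : (Fin n → ℤ) → ℤ
    lin x = sumℤ λ i → b i * x i

    rest : (Fin n → ℤ) → ℤ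
    rest x = sumℤ λ i → sumℤ λ j → x i * x j * B (suc i) (suc j)

    open ≡-Reasoning

    -- The vector `y` is tied to its head and tail only pointwise, so that vectors defined by cases
    -- fit without function extensionality.
    quad-split : ∀ x₀ x (y : Fin (suc n) → ℤ) → y zero ≡ x₀ → (∀ i → y (suc i) ≡ x i) →
                 quad B y ≡ x₀ * x₀ * a + x₀ * lin x + (x₀ * lin x + rest x)
    quad-split x₀ x y refl e = cong₂ (λ s t → x₀ * x₀ * a + s + t) row col
      where
      row : sumℤ (λ j → x₀ * y (suc j) * B zero (suc j)) ≡ x₀ * lin x
      row = trans (Σℤ.∑-cong (λ j → trans (cong (λ t → x₀ * t * b j) (e j)) (alg x₀ (x j) (b j))))
          (Σℤ.∑-distribˡ-* {n} x₀ _)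
        where
        alg : ∀ p q r → p * q * r ≡ p * (r * q)
        alg = solve-∀
      col : sumℤ (λ i → y (suc i) * x₀ * B (suc i) zero + sumℤ (λ j → y (suc i) * y (suc j) * B (suc i) (suc j)))
            ≡ x₀ * lin x + rest x
      col = trans (Σℤ.∑-distrib-+ {n} _ _) (cong₂ _+_
        (trans (Σℤ.∑-cong (λ i → trans (cong₂ (λ s t → s * x₀ * t) (e i) (B-sym (suc i) zero)) (alg x₀ (x i)
        (b i)))) (Σℤ.∑-distribˡ-* {n} x₀ _))
        (Σℤ.∑-cong (λ i → Σℤ.∑-cong (λ j → cong₂ (λ s t → s * t * B (suc i) (suc j)) (e i) (e j)))))
        where
        alg : ∀ p q r → q * p * r ≡ p * (r * q)
        alg = solve-∀

    quad-reduced : ∀ x → quad reduced x ≡ a * rest x - lin x * lin x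
    quad-reduced x = begin
      quad reduced x
        ≡⟨ Σℤ.∑-cong inner ⟩
      sumℤ (λ i → a * sumℤ (λ j → x i * x j * B (suc i) (suc j)) + (- lin x) * (b i * x i))
        ≡⟨ Σℤ.∑-distrib-+ {n} _ _ ⟩
      _
        ≡⟨ cong₂ _+_ (Σℤ.∑-distribˡ-* {n} a _) (Σℤ.∑-distribˡ-* {n} (- lin x) _) ⟩
      a * rest x + (- lin x) * lin x
        ≡⟨ cong (λ t → a * rest x + t) (sym (ℤ.neg-distribˡ-* (lin x) (lin x))) ⟩
      a * rest x - lin x * lin x ∎
      where
      alg : ∀ p q r s t u → p * q * (r * s - t * u) ≡ r * (p * q * s) + (- (t * p)) * (u * q)
      alg = solve-∀
      alg₂ : ∀ p q → - p * q ≡ - q * p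
      alg₂ = solve-∀
      inner : ∀ i → sumℤ (λ j → x i * x j * reduced i j)
                  ≡ a * sumℤ (λ j → x i * x j * B (suc i) (suc j)) + (- lin x) * (b i * x i)
      inner i = begin
        sumℤ (λ j → x i * x j * reduced i j)
          ≡⟨ Σℤ.∑-cong (λ j → alg (x i) (x j) a (B (suc i) (suc j)) (b i) (b j)) ⟩
        sumℤ (λ j → a * (x i * x j * B (suc i) (suc j)) + (- (b i * x i)) * (b j * x j))
          ≡⟨ Σℤ.∑-distrib-+ {n} _ _ ⟩
        _
          ≡⟨ cong₂ _+_ (Σℤ.∑-distribˡ-* {n} a _) (trans (Σℤ.∑-distribˡ-* {n} (- (b i * x i)) _) (alg₂ (b i * x i)
              (lin x))) ⟩
        a * sumℤ (λ j → x i * x j * B (suc i) (suc j)) + (- lin x) * (b i * x i) ∎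

    complete-square : ∀ x₀ x y → y zero ≡ x₀ → (∀ i → y (suc i) ≡ x i) →
                      a * quad B y ≡ (a * x₀ + lin x) * (a * x₀ + lin x) + quad reduced x
    complete-square x₀ x y e₀ e = begin
      a * quad B y
        ≡⟨ cong (a *_) (quad-split x₀ x y e₀ e) ⟩
      a * (x₀ * x₀ * a + x₀ * lin x + (x₀ * lin x + rest x))
        ≡⟨ alg a x₀ (lin x) (rest x) ⟩
      (a * x₀ + lin x) * (a * x₀ + lin x) + (a * rest x - lin x * lin x)
        ≡⟨ cong (λ t → (a * x₀ + lin x) * (a * x₀ + lin x) + t) (sym (quad-reduced x)) ⟩
      (a * x₀ + lin x) * (a * x₀ + lin x) + quad reduced x ∎
      where
      alg : ∀ a x l r → a * (x * x * a + x * l + (x * l + r)) ≡ (a * x + l) * (a * x + l) + (a * r - l * l)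
      alg = solve-∀

    module _ (pd : PosDef B) where

      a-pos : 0ℤ < a
      a-pos = subst (0ℤ <_) (begin
        quad B e₀
          ≡⟨ quad-split 1ℤ (λ _ → 0ℤ) e₀ refl (λ _ → refl) ⟩
        1ℤ * 1ℤ * a + 1ℤ * lin (λ _ → 0ℤ) + (1ℤ * lin (λ _ → 0ℤ) + rest (λ _ → 0ℤ))
          ≡⟨ cong₂ (λ s t → 1ℤ * 1ℤ * a + 1ℤ * s + (1ℤ * s + t))
               (Σℤ.∑-zero (λ i → ℤ.*-zeroʳ (b i)))
               (Σℤ.∑-zero (λ i → Σℤ.∑-zero (λ j → ℤ.*-zeroˡ (B (suc i) (suc j))))) ⟩
        1ℤ * 1ℤ * a + 1ℤ * 0ℤ + (1ℤ * 0ℤ + 0ℤ)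
          ≡⟨ alg a ⟩
        a ∎) (pd e₀ (zero , λ ()))
        where
        e₀ : Fin (suc n) → ℤ
        e₀ zero    = 1ℤ
        e₀ (suc _) = 0ℤ
        alg : ∀ a → 1ℤ * 1ℤ * a + 1ℤ * 0ℤ + (1ℤ * 0ℤ + 0ℤ) ≡ a
        alg = solve-∀

      -- The square completed above vanishes at (- lin x , a x).
      reduced-posDef : PosDef reduced
      reduced-posDef x (i , xi≢0) = 0<*⇒0< a-pos (0<*⇒0< a-pos (subst (0ℤ <_) eq (0<⇒0<* a-pos (pd y (suc i , axi≢0)))))
        where
        y : Fin (suc n) → ℤ
        y zero    = - lin x
        y (suc i) = a * x i
        axi≢0 : a * x i ≢ 0ℤ
        axi≢0 e = xi≢0 (*-cancelˡ-0< a-pos (trans e (sym (ℤ.*-zeroʳ a))))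
        lin-scale : lin (λ i → a * x i) ≡ a * lin x
        lin-scale = trans (Σℤ.∑-cong (λ i → alg (b i) a (x i))) (Σℤ.∑-distribˡ-* {n} a _)
          where
          alg : ∀ p q r → p * (q * r) ≡ q * (p * r)
          alg = solve-∀
        alg : ∀ a l q → (a * - l + a * l) * (a * - l + a * l) + a * a * q ≡ a * (a * q)
        alg = solve-∀
        eq : a * quad B y ≡ a * (a * quad reduced x)
        eq = begin
          a * quad B y
            ≡⟨ complete-square (- lin x) (λ i → a * x i) y refl (λ _ → refl) ⟩
          _
            ≡⟨ cong₂ (λ s t → (a * - lin x + s) * (a * - lin x + s) + t) lin-scale (quad-scale reduced a x) ⟩
          (a * - lin x + a * lin x) * (a * - lin x + a * lin x) + a * a * quad reduced x
            ≡⟨ alg a (lin x) (quad reduced x) ⟩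
          a * (a * quad reduced x) ∎

  -- Induction on the dimension. In a·q(x) = s² + reduced(x′) both summands are nonnegative, so each
  -- is at most a·M: the second bounds x′, the first bounds s, and then a·x₀ = s - lin x′ bounds x₀.
  posDef⇒bounded : ∀ {n} (B : Fin n → Fin n → ℤ) → SymmetricMatrix B → PosDef B → ∀ M →
                   ∃[ K ] (∀ x → quad B x ≤ M → ∀ i → ∣ x i ∣ ℕ.≤ K)
  posDef⇒bounded {zero}  B B-sym pd M = 0 , λ _ _ ()
  posDef⇒bounded {suc n} B B-sym pd M = K , bound
    where
    open Elimination B B-sym
    IH = posDef⇒bounded reduced reduced-sym (reduced-posDef pd) (a * M)
    K′ = proj₁ IH
    L = ∣ sumℤ (λ i → + ∣ b i ∣) ∣ ℕ.* K′
    K = K′ ℕ.+ (∣ a * M ∣ ℕ.+ L)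
    module _ (x : Fin (suc n) → ℤ) (q≤M : quad B x ≤ M) where
      x₀ = x zero
      x′ = x ∘ suc
      s = a * x₀ + lin x′
      aq≤aM : s * s + quad reduced x′ ≤ a * M
      aq≤aM = subst (_≤ a * M) (complete-square x₀ x′ x refl (λ _ → refl))
                (ℤ.*-monoˡ-≤-nonNeg a {{ℤ.nonNegative (ℤ.<⇒≤ (a-pos pd))}} q≤M)
      x′-bound : ∀ i → ∣ x′ i ∣ ℕ.≤ K′
      x′-bound = proj₂ IH x′ (ℤ.≤-trans
        (subst (_≤ s * s + quad reduced x′) (ℤ.+-identityˡ _) (ℤ.+-monoˡ-≤ (quad reduced x′) (0≤i*i s))) aq≤aM)
      s-bound : ∣ s ∣ ℕ.≤ ∣ a * M ∣
      s-bound = i*i≤j⇒∣i∣≤∣j∣ {s} (ℤ.≤-trans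
        (subst (_≤ s * s + quad reduced x′) (ℤ.+-identityʳ _) (ℤ.+-monoʳ-≤ (s * s) (quad-nonneg
        (reduced-posDef pd) x′))) aq≤aM)
      x₀≤ax₀ : ∣ x₀ ∣ ℕ.≤ ∣ a * x₀ ∣
      x₀≤ax₀ = subst (∣ x₀ ∣ ℕ.≤_) (sym (ℤ.abs-* a x₀))
        (ℕ.m≤n*m ∣ x₀ ∣ ∣ a ∣ {{ℕ.≢-nonZero (λ e → ℤ.<-irrefl (sym (ℤ.∣i∣≡0⇒i≡0 e)) (a-pos pd))}})
      ax₀ : a * x₀ ≡ s - lin x′
      ax₀ = alg (a * x₀) (lin x′)
        where
        alg : ∀ p q → p ≡ p + q - q
        alg = solve-∀
      x₀-bound : ∣ x₀ ∣ ℕ.≤ ∣ a * M ∣ ℕ.+ L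
      x₀-bound = begin
        ∣ x₀ ∣                  ≤⟨ x₀≤ax₀ ⟩
        ∣ a * x₀ ∣              ≡⟨ cong ∣_∣ ax₀ ⟩
        ∣ s - lin x′ ∣          ≤⟨ ℤ.∣i-j∣≤∣i∣+∣j∣ s (lin x′) ⟩
        ∣ s ∣ ℕ.+ ∣ lin x′ ∣    ≤⟨ ℕ.+-mono-≤ s-bound (∣∑∣≤ b x′ K′ x′-bound) ⟩
        ∣ a * M ∣ ℕ.+ L         ∎
        where open ℕ.≤-Reasoning
      bound : ∀ i → ∣ x i ∣ ℕ.≤ K
      bound zero    = ℕ.≤-trans x₀-bound (ℕ.m≤n+m _ K′)
      bound (suc i) = ℕ.≤-trans (x′-bound i) (ℕ.m≤m+n K′ _)

-- Roots and coroots as integer vectors.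

open QuadraticForm

-- Off-diagonal entries come in equal pairs, so only the diagonal can affect the parity.
symmetric-sum-even : ∀ {n} (M : Fin n → Fin n → ℤ) → (∀ i j → M i j ≡ M j i) →
                     (∀ i → ∃[ e ] M i i ≡ + 2 * e) → ∃[ e ] sumℤ (λ i → sumℤ (λ j → M i j)) ≡ + 2 * e
symmetric-sum-even {zero}  M M-sym even = 0ℤ , refl
symmetric-sum-even {suc n} M M-sym even
  with even zero | symmetric-sum-even (λ i j → M (suc i) (suc j)) (λ i j → M-sym (suc i) (suc j)) (even ∘ suc)
... | e₀ , eq₀ | e , eq = e₀ + r + e , (begin
  M zero zero + r + sumℤ (λ i → M (suc i) zero + sumℤ (λ j → M (suc i) (suc j)))
    ≡⟨ cong (λ t → M zero zero + r + t) (Σℤ.∑-distrib-+ {n} _ _) ⟩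
  M zero zero + r + (sumℤ (λ i → M (suc i) zero) + sumℤ (λ i → sumℤ (λ j → M (suc i) (suc j))))
    ≡⟨ cong₂ (λ s t → M zero zero + r + (s + t)) (Σℤ.∑-cong (λ i → M-sym (suc i) zero)) eq ⟩
  M zero zero + r + (r + + 2 * e)
    ≡⟨ cong (λ t → t + r + (r + + 2 * e)) eq₀ ⟩
  + 2 * e₀ + r + (r + + 2 * e)
    ≡⟨ alg e₀ r e ⟩
  + 2 * (e₀ + r + e) ∎)
  where
  open ≡-Reasoning
  r = sumℤ (λ j → M zero (suc j))
  alg : ∀ x y z → + 2 * x + y + (y + + 2 * z) ≡ + 2 * (x + y + z)
  alg = solve-∀

-- The rational numbers d i are replaced by integral multiples with one common positive factor,
-- which keeps all sign and parity arguments about roots inside ℤ.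
record IntegralCartan {n : ℕ} (C : CartanMatrix n) : Set where
  field
    diag        : ∀ i → C i i ≡ + 2
    offdiag     : ∀ i j → i ≢ j → C i j ≤ 0ℤ
    D           : Fin n → ℤ
    D-pos       : ∀ i → 0ℤ < D i
    D-sym       : ∀ i j → D i * C i j ≡ D j * C j i
    posDef      : PosDef (λ i j → C i j * D i)
    irreducible : ∀ (S : Subset n) → (∀ i j → i ∈ S → j ∉ S → C i j ≡ + 0) →
                  (∀ i → i ∈ S) ⊎ (∀ i → i ∉ S)

module RootSystem {n : ℕ} (C : CartanMatrix n) (IC : IntegralCartan C) where

  open IntegralCartan IC
  open ≡-Reasoning

  private
    ∑-cong = Σℤ.∑-cong {n}
    ∑-distrib-+ = Σℤ.∑-distrib-+ {n}
    ∑-distribˡ-* = Σℤ.∑-distribˡ-* {n}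

  V : Set
  V = Fin n → ℤ

  α : Fin n → V
  α = simple C

  -- The single shape covering reflections, differences (c = 1), sums (c = -1) and negation (c = 2,
  -- η = β), so that bilinearity is proved once.
  shift : V → ℤ → V → V
  shift β c η k = β k - c * η k

  neg : V → V
  neg β k = - β k

  opaque
    -- Left arguments are coroot vectors and right arguments root vectors, each in its own simple
    -- basis; α^ stands for a simple coroot.
    ⟨α^_,_⟩ : Fin n → V → ℤ
    ⟨α^ k , β ⟩ = sumℤ (λ l → β l * C k l)

    ⟨_,α_⟩ : V → Fin n → ℤ
    ⟨ m ,α l ⟩ = sumℤ (λ k → m k * C k l)

    ⟨_,_⟩ : V → V → ℤ
    ⟨ m , β ⟩ = sumℤ (λ k → m k * ⟨α^ k , β ⟩)

  α-diag : ∀ j → α j j ≡ 1ℤ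
  α-diag j with j Fin.≟ j
  ... | yes _  = refl
  ... | no j≢j = ⊥-elim (j≢j refl)

  α-offdiag : ∀ {j k} → j ≢ k → α j k ≡ 0ℤ
  α-offdiag {j} {k} j≢k with j Fin.≟ k
  ... | yes j≡k = ⊥-elim (j≢k j≡k)
  ... | no _    = refl

  ∑-α : ∀ j (f : Fin n → ℤ) → sumℤ (λ k → α j k * f k) ≡ f j
  ∑-α j f = begin
    sumℤ (λ k → α j k * f k)  ≡⟨ Σℤ.∑-single j _ (λ k j≢k → trans (cong (_* f k) (α-offdiag j≢k)) (ℤ.*-zeroˡ (f k))) ⟩
    α j j * f j               ≡⟨ cong (_* f j) (α-diag j) ⟩
    1ℤ * f j                  ≡⟨ ℤ.*-identityˡ (f j) ⟩
    f j                       ∎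

  ∑-shift : ∀ β c η (f : Fin n → ℤ) →
            sumℤ (λ k → shift β c η k * f k) ≡ sumℤ (λ k → β k * f k) - c * sumℤ (λ k → η k * f k)
  ∑-shift β c η f = begin
    sumℤ (λ k → shift β c η k * f k)
      ≡⟨ ∑-cong (λ k → alg (β k) c (η k) (f k)) ⟩
    sumℤ (λ k → β k * f k + (- c) * (η k * f k))
      ≡⟨ ∑-distrib-+ _ _ ⟩
    _
      ≡⟨ cong (λ t → sumℤ (λ k → β k * f k) + t) (trans (∑-distribˡ-* (- c) _) (sym (ℤ.neg-distribˡ-* c _))) ⟩
    sumℤ (λ k → β k * f k) - c * sumℤ (λ k → η k * f k) ∎
    where
    alg : ∀ b c e f → (b - c * e) * f ≡ b * f + (- c) * (e * f)
    alg = solve-∀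

  ∑-neg : ∀ β (f : Fin n → ℤ) → sumℤ (λ k → neg β k * f k) ≡ - sumℤ (λ k → β k * f k)
  ∑-neg β f = trans (∑-cong (λ k → alg (β k) (f k))) (trans (∑-distribˡ-* (- 1ℤ) _) (ℤ.-1*i≡-i _))
    where
    alg : ∀ b f → (- b) * f ≡ (- 1ℤ) * (b * f)
    alg = solve-∀

  opaque
    unfolding ⟨_,_⟩

    -- The definition is visibly linear on the left; exchanging the two sums makes it visibly linear
    -- on the right.
    ⟨⟩-transpose : ∀ m β → ⟨ m , β ⟩ ≡ sumℤ (λ l → β l * ⟨ m ,α l ⟩)
    ⟨⟩-transpose m β = begin
      sumℤ (λ k → m k * sumℤ (λ l → β l * C k l))
        ≡⟨ ∑-cong (λ k → sym (∑-distribˡ-* (m k) _)) ⟩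
      sumℤ (λ k → sumℤ (λ l → m k * (β l * C k l)))
        ≡⟨ Σℤ.∑-swap {n} {n} _ ⟩
      sumℤ (λ l → sumℤ (λ k → m k * (β l * C k l)))
        ≡⟨ ∑-cong (λ l → trans (∑-cong (λ k → alg (m k) (β l) (C k l))) (∑-distribˡ-* (β l) _)) ⟩
      sumℤ (λ l → β l * sumℤ (λ k → m k * C k l)) ∎
      where
      alg : ∀ a b c → a * (b * c) ≡ b * (a * c)
      alg = solve-∀

    ⟨α^,⟩-cong : ∀ k {β γ} → β ≗ γ → ⟨α^ k , β ⟩ ≡ ⟨α^ k , γ ⟩
    ⟨α^,⟩-cong k e = ∑-cong (λ l → cong (_* C k l) (e l))

    ⟨,α⟩-cong : ∀ {m m′} l → m ≗ m′ → ⟨ m ,α l ⟩ ≡ ⟨ m′ ,α l ⟩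
    ⟨,α⟩-cong l e = ∑-cong (λ k → cong (_* C k l) (e k))

    ⟨⟩-cong : ∀ {m m′ β γ} → m ≗ m′ → β ≗ γ → ⟨ m , β ⟩ ≡ ⟨ m′ , γ ⟩
    ⟨⟩-cong e f = ∑-cong (λ k → cong₂ _*_ (e k) (⟨α^,⟩-cong k f))

    ⟨⟩-zeroˡ : ∀ {m} → (∀ k → m k ≡ 0ℤ) → ∀ β → ⟨ m , β ⟩ ≡ 0ℤ
    ⟨⟩-zeroˡ e β = Σℤ.∑-zero (λ k → trans (cong (_* ⟨α^ k , β ⟩) (e k)) (ℤ.*-zeroˡ ⟨α^ k , β ⟩))

    ⟨⟩-shiftˡ : ∀ m c μ β → ⟨ shift m c μ , β ⟩ ≡ ⟨ m , β ⟩ - c * ⟨ μ , β ⟩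
    ⟨⟩-shiftˡ m c μ β = ∑-shift m c μ (λ k → ⟨α^ k , β ⟩)

    ⟨⟩-shiftʳ : ∀ m β c η → ⟨ m , shift β c η ⟩ ≡ ⟨ m , β ⟩ - c * ⟨ m , η ⟩
    ⟨⟩-shiftʳ m β c η = trans (⟨⟩-transpose m (shift β c η)) (trans (∑-shift β c η (λ l → ⟨ m ,α l ⟩))
      (sym (cong₂ (λ s t → s - c * t) (⟨⟩-transpose m β) (⟨⟩-transpose m η))))

    ⟨⟩-negˡ : ∀ m β → ⟨ neg m , β ⟩ ≡ - ⟨ m , β ⟩
    ⟨⟩-negˡ m β = ∑-neg m (λ k → ⟨α^ k , β ⟩)

    ⟨⟩-negʳ : ∀ m β → ⟨ m , neg β ⟩ ≡ - ⟨ m , β ⟩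
    ⟨⟩-negʳ m β = trans (⟨⟩-transpose m (neg β)) (trans (∑-neg β (λ l → ⟨ m ,α l ⟩)) (cong -_ (sym (⟨⟩-transpose m β))))

    ⟨⟩-αˡ : ∀ j β → ⟨ α j , β ⟩ ≡ ⟨α^ j , β ⟩
    ⟨⟩-αˡ j β = ∑-α j (λ k → ⟨α^ k , β ⟩)

    ⟨⟩-αʳ : ∀ m j → ⟨ m , α j ⟩ ≡ ⟨ m ,α j ⟩
    ⟨⟩-αʳ m j = trans (⟨⟩-transpose m (α j)) (∑-α j (λ l → ⟨ m ,α l ⟩))

    ⟨α^,α⟩ : ∀ i j → ⟨α^ i , α j ⟩ ≡ C i j
    ⟨α^,α⟩ i j = ∑-α j (C i)

    ⟨α^,⟩-shift : ∀ j β c η → ⟨α^ j , shift β c η ⟩ ≡ ⟨α^ j , β ⟩ - c * ⟨α^ j , η ⟩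
    ⟨α^,⟩-shift j β c η = ∑-shift β c η (C j)

  -- The reflection on the coroot side. The unit vector `α j` doubles as the coordinate vector of
  -- α_j^∨.
  reflCo : Fin n → V → V
  reflCo j m k = m k - ⟨ m ,α j ⟩ * α j k

  actCo : List (Fin n) → V → V
  actCo []      m = m
  actCo (j ∷ w) m = actCo w (reflCo j m)

  refl[_,_] : V → V → V → V
  refl[ η^ , η ] β = shift β ⟨ η^ , β ⟩ η

  opaque
    unfolding ⟨α^_,_⟩

    reflRoot-shift : ∀ j β → reflRoot C j β ≗ shift β ⟨α^ j , β ⟩ (α j)
    reflRoot-shift j β k with j Fin.≟ k
    ... | yes _ = cong (λ t → β k - t) (sym (ℤ.*-identityʳ _))
    ... | no _  = sym (trans (cong (λ t → β k - t) (ℤ.*-zeroʳ ⟨α^ j , β ⟩)) (ℤ.+-identityʳ (β k)))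

  reflRoot≗refl : ∀ j β → reflRoot C j β ≗ refl[ α j , α j ] β
  reflRoot≗refl j β k = trans (reflRoot-shift j β k) (cong (λ t → β k - t * α j k) (sym (⟨⟩-αˡ j β)))

  shift-cong : ∀ {β β′ c c′ η η′} → β ≗ β′ → c ≡ c′ → η ≗ η′ → shift β c η ≗ shift β′ c′ η′
  shift-cong {c = c} e refl f k = cong₂ (λ s t → s - c * t) (e k) (f k)

  reflRoot-cong : ∀ j {β γ} → β ≗ γ → reflRoot C j β ≗ reflRoot C j γ
  reflRoot-cong j {β} {γ} e k = begin
    reflRoot C j β k               ≡⟨ reflRoot-shift j β k ⟩
    shift β ⟨α^ j , β ⟩ (α j) k    ≡⟨ shift-cong {η = α j} e (⟨α^,⟩-cong j e) (λ _ → refl) k ⟩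
    shift γ ⟨α^ j , γ ⟩ (α j) k    ≡⟨ sym (reflRoot-shift j γ k) ⟩
    reflRoot C j γ k               ∎

  reflCo-cong : ∀ j {m m′} → m ≗ m′ → reflCo j m ≗ reflCo j m′
  reflCo-cong j e k = cong₂ (λ s t → s - t * α j k) (e k) (⟨,α⟩-cong j e)

  actRoot-cong : ∀ w {β γ} → β ≗ γ → actRoot C w β ≗ actRoot C w γ
  actRoot-cong []      e = e
  actRoot-cong (j ∷ w) e = actRoot-cong w (reflRoot-cong j e)

  actCo-cong : ∀ w {m m′} → m ≗ m′ → actCo w m ≗ actCo w m′
  actCo-cong []      e = e
  actCo-cong (j ∷ w) e = actCo-cong w (reflCo-cong j e)

  reflRoot-linear : ∀ j β c η → reflRoot C j (shift β c η) ≗ shift (reflRoot C j β) c (reflRoot C j η)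
  reflRoot-linear j β c η k = begin
    reflRoot C j (shift β c η) k
      ≡⟨ reflRoot-shift j _ k ⟩
    β k - c * η k - ⟨α^ j , shift β c η ⟩ * α j k
      ≡⟨ cong (λ t → β k - c * η k - t * α j k) (⟨α^,⟩-shift j β c η) ⟩
    β k - c * η k - (⟨α^ j , β ⟩ - c * ⟨α^ j , η ⟩) * α j k
      ≡⟨ alg (β k) c (η k) ⟨α^ j , β ⟩ ⟨α^ j , η ⟩ (α j k) ⟩
    (β k - ⟨α^ j , β ⟩ * α j k) - c * (η k - ⟨α^ j , η ⟩ * α j k)
      ≡⟨ sym (cong₂ (λ s t → s - c * t) (reflRoot-shift j β k) (reflRoot-shift j η k)) ⟩
    shift (reflRoot C j β) c (reflRoot C j η) k ∎
    where
    alg : ∀ b c e x y a → b - c * e - (x - c * y) * a ≡ (b - x * a) - c * (e - y * a)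
    alg = solve-∀

  actRoot-linear : ∀ w β c η → actRoot C w (shift β c η) ≗ shift (actRoot C w β) c (actRoot C w η)
  actRoot-linear []      β c η k = refl
  actRoot-linear (j ∷ w) β c η k =
    trans (actRoot-cong w (reflRoot-linear j β c η) k) (actRoot-linear w _ c _ k)

  neg≗shift : ∀ β → neg β ≗ shift β (+ 2) β
  neg≗shift β k = alg (β k)
    where
    alg : ∀ b → - b ≡ b - + 2 * b
    alg = solve-∀

  reflRoot-neg : ∀ j β → reflRoot C j (neg β) ≗ neg (reflRoot C j β)
  reflRoot-neg j β k = trans (reflRoot-cong j (neg≗shift β) k)
    (trans (reflRoot-linear j β (+ 2) β k) (sym (neg≗shift (reflRoot C j β) k)))

  actRoot-neg : ∀ w β → actRoot C w (neg β) ≗ neg (actRoot C w β)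
  actRoot-neg w β k = trans (actRoot-cong w (neg≗shift β) k)
    (trans (actRoot-linear w β (+ 2) β k) (sym (neg≗shift (actRoot C w β) k)))

  actRoot-++ : ∀ u v β → actRoot C (u ++ v) β ≡ actRoot C v (actRoot C u β)
  actRoot-++ []      v β = refl
  actRoot-++ (j ∷ u) v β = actRoot-++ u v (reflRoot C j β)

  ⟨α^,reflRoot⟩ : ∀ j β → ⟨α^ j , reflRoot C j β ⟩ ≡ - ⟨α^ j , β ⟩
  ⟨α^,reflRoot⟩ j β = begin
    ⟨α^ j , reflRoot C j β ⟩                     ≡⟨ ⟨α^,⟩-cong j (reflRoot-shift j β) ⟩
    ⟨α^ j , shift β ⟨α^ j , β ⟩ (α j) ⟩           ≡⟨ ⟨α^,⟩-shift j β ⟨α^ j , β ⟩ (α j) ⟩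
    ⟨α^ j , β ⟩ - ⟨α^ j , β ⟩ * ⟨α^ j , α j ⟩     ≡⟨ cong (λ t → ⟨α^ j , β ⟩ - ⟨α^ j , β ⟩ * t) (trans
        (⟨α^,α⟩ j j) (diag j)) ⟩
    ⟨α^ j , β ⟩ - ⟨α^ j , β ⟩ * + 2               ≡⟨ alg ⟨α^ j , β ⟩ ⟩
    - ⟨α^ j , β ⟩                                ∎
    where
    alg : ∀ b → b - b * + 2 ≡ - b
    alg = solve-∀

  reflRoot-involutive : ∀ j β → reflRoot C j (reflRoot C j β) ≗ β
  reflRoot-involutive j β k = begin
    reflRoot C j (reflRoot C j β) k
      ≡⟨ reflRoot-shift j _ k ⟩
    reflRoot C j β k - ⟨α^ j , reflRoot C j β ⟩ * α j k
      ≡⟨ cong₂ (λ s t → s - t * α j k) (reflRoot-shift j β k) (⟨α^,reflRoot⟩ j β) ⟩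
    β k - ⟨α^ j , β ⟩ * α j k - (- ⟨α^ j , β ⟩) * α j k
      ≡⟨ alg (β k) ⟨α^ j , β ⟩ (α j k) ⟩
    β k ∎
    where
    alg : ∀ b c a → b - c * a - (- c) * a ≡ b
    alg = solve-∀

  actRoot-reverse : ∀ w β → actRoot C (reverse w) (actRoot C w β) ≗ β
  actRoot-reverse []      β k = refl
  actRoot-reverse (j ∷ w) β k = begin
    actRoot C (reverse (j ∷ w)) (actRoot C w (reflRoot C j β)) k
      ≡⟨ cong (λ t → actRoot C t (actRoot C w (reflRoot C j β)) k) (List.unfold-reverse j w) ⟩
    actRoot C (reverse w ++ [ j ]) (actRoot C w (reflRoot C j β)) k
      ≡⟨ cong (λ f → f k) (actRoot-++ (reverse w) [ j ] _) ⟩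
    reflRoot C j (actRoot C (reverse w) (actRoot C w (reflRoot C j β))) k
      ≡⟨ reflRoot-cong j (actRoot-reverse w (reflRoot C j β)) k ⟩
    reflRoot C j (reflRoot C j β) k
      ≡⟨ reflRoot-involutive j β k ⟩
    β k ∎

  actRoot-reverse′ : ∀ w β → actRoot C w (actRoot C (reverse w) β) ≗ β
  actRoot-reverse′ w β k = subst (λ t → actRoot C t (actRoot C (reverse w) β) k ≡ β k)
    (List.reverse-involutive w) (actRoot-reverse (reverse w) β k)

  ⟨⟩-reflect : ∀ m β η^ η → ⟨ η^ , η ⟩ ≡ + 2 →
               ⟨ shift m ⟨ m , η ⟩ η^ , shift β ⟨ η^ , β ⟩ η ⟩ ≡ ⟨ m , β ⟩
  ⟨⟩-reflect m β η^ η two = begin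
    ⟨ shift m ⟨ m , η ⟩ η^ , shift β ⟨ η^ , β ⟩ η ⟩
      ≡⟨ ⟨⟩-shiftˡ m ⟨ m , η ⟩ η^ (shift β ⟨ η^ , β ⟩ η) ⟩
    ⟨ m , shift β ⟨ η^ , β ⟩ η ⟩ - ⟨ m , η ⟩ * ⟨ η^ , shift β ⟨ η^ , β ⟩ η ⟩
      ≡⟨ cong₂ (λ s t → s - ⟨ m , η ⟩ * t) (⟨⟩-shiftʳ m β ⟨ η^ , β ⟩ η) (⟨⟩-shiftʳ η^ β ⟨ η^ , β ⟩ η) ⟩
    ⟨ m , β ⟩ - ⟨ η^ , β ⟩ * ⟨ m , η ⟩ - ⟨ m , η ⟩ * (⟨ η^ , β ⟩ - ⟨ η^ , β ⟩ * ⟨ η^ , η ⟩)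
      ≡⟨ cong (λ t → ⟨ m , β ⟩ - ⟨ η^ , β ⟩ * ⟨ m , η ⟩ - ⟨ m , η ⟩ * (⟨ η^ , β ⟩ - ⟨ η^ , β ⟩ * t)) two ⟩
    ⟨ m , β ⟩ - ⟨ η^ , β ⟩ * ⟨ m , η ⟩ - ⟨ m , η ⟩ * (⟨ η^ , β ⟩ - ⟨ η^ , β ⟩ * + 2)
      ≡⟨ alg ⟨ m , β ⟩ ⟨ η^ , β ⟩ ⟨ m , η ⟩ ⟩
    ⟨ m , β ⟩ ∎
    where
    alg : ∀ a b c → a - b * c - c * (b - b * + 2) ≡ a
    alg = solve-∀

  ⟨α,α⟩≡2 : ∀ j → ⟨ α j , α j ⟩ ≡ + 2
  ⟨α,α⟩≡2 j = trans (⟨⟩-αˡ j (α j)) (trans (⟨α^,α⟩ j j) (diag j))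

  reflCo-shift : ∀ j m → reflCo j m ≗ shift m ⟨ m , α j ⟩ (α j)
  reflCo-shift j m k = cong (λ t → m k - t * α j k) (sym (⟨⟩-αʳ m j))

  ⟨⟩-reflRoot : ∀ j m β → ⟨ reflCo j m , reflRoot C j β ⟩ ≡ ⟨ m , β ⟩
  ⟨⟩-reflRoot j m β = trans (⟨⟩-cong (reflCo-shift j m) (reflRoot≗refl j β)) (⟨⟩-reflect m β (α j) (α j) (⟨α,α⟩≡2 j))

  ⟨⟩-actRoot : ∀ w m β → ⟨ actCo w m , actRoot C w β ⟩ ≡ ⟨ m , β ⟩
  ⟨⟩-actRoot []      m β = refl
  ⟨⟩-actRoot (j ∷ w) m β = trans (⟨⟩-actRoot w _ _) (⟨⟩-reflRoot j m β)

  -- `typ` names a simple root of the same length, so `D typ` is half the squared length and `prop`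
  -- says co = 2 vec / (vec , vec) without a division. All fields are preserved by reflections.
  record Root : Set where
    field
      vec    : V
      co     : V
      typ    : Fin n
      two    : ⟨ co , vec ⟩ ≡ + 2
      prop   : ∀ k → D typ * co k ≡ D k * vec k
      isRoot : IsRoot C vec
  open Root public

  -- The bilinear form (x , y), normalised by (α_i , α_i) = 2 D_i.
  opaque
    unfolding ⟨_,_⟩

    bform : V → V → ℤ
    bform x y = sumℤ (λ k → D k * x k * ⟨α^ k , y ⟩)

    bform-quad : ∀ x → bform x x ≡ quad (λ i j → C i j * D i) x
    bform-quad x = ∑-cong (λ k → trans (sym (∑-distribˡ-* (D k * x k) _)) (∑-cong (λ l → alg (D k) (x k) (x l)
        (C k l))))
      where
      alg : ∀ d x y c → d * x * (y * c) ≡ x * y * (c * d)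
      alg = solve-∀

    bform-sym : ∀ x y → bform x y ≡ bform y x
    bform-sym x y = begin
      sumℤ (λ k → D k * x k * sumℤ (λ l → y l * C k l))
        ≡⟨ ∑-cong (λ k → sym (∑-distribˡ-* (D k * x k) _)) ⟩
      sumℤ (λ k → sumℤ (λ l → D k * x k * (y l * C k l)))
        ≡⟨ Σℤ.∑-swap {n} {n} _ ⟩
      sumℤ (λ l → sumℤ (λ k → D k * x k * (y l * C k l)))
        ≡⟨ ∑-cong (λ l → trans (∑-cong (λ k → step k l)) (∑-distribˡ-* (D l * y l) _)) ⟩
      sumℤ (λ l → D l * y l * sumℤ (λ k → x k * C l k)) ∎
      where
      alg : ∀ d x y c → d * x * (y * c) ≡ d * c * (x * y)
      alg = solve-∀
      alg₂ : ∀ d x y c → d * c * (x * y) ≡ d * y * (x * c)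
      alg₂ = solve-∀
      step : ∀ k l → D k * x k * (y l * C k l) ≡ D l * y l * (x k * C l k)
      step k l = trans (alg (D k) (x k) (y l) (C k l))
        (trans (cong (_* (x k * y l)) (D-sym k l)) (alg₂ (D l) (x k) (y l) (C l k)))

    bform-co : ∀ {s co vec} → (∀ k → s * co k ≡ D k * vec k) → ∀ y → s * ⟨ co , y ⟩ ≡ bform vec y
    bform-co {s} {co} {vec} p y = trans (sym (∑-distribˡ-* s _))
      (∑-cong (λ k → trans (sym (ℤ.*-assoc s (co k) _)) (cong (_* ⟨α^ k , y ⟩) (p k))))

  opaque
    unfolding ⟨_,_⟩

    -- Proportionality and `D-sym` make the terms a^_k a_l C_kl symmetric in k and l, while C_kk = 2
    -- makes the diagonal even. The pair need not be a root and its coroot: the lemma is applied to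
    -- positive and negative parts.
    ⟨⟩-even : ∀ {s a^ a} → 0ℤ < s → (∀ k → s * a^ k ≡ D k * a k) → ∃[ e ] ⟨ a^ , a ⟩ ≡ + 2 * e
    ⟨⟩-even {s} {a^} {a} s>0 p with symmetric-sum-even M M-sym (λ i → a^ i * a i , trans (cong (λ t → a^ i *
        (a i * t)) (diag i)) (alg (a^ i) (a i)))
      where
      M : Fin n → Fin n → ℤ
      M k l = a^ k * (a l * C k l)
      alg : ∀ x y → x * (y * + 2) ≡ + 2 * (x * y)
      alg = solve-∀
      alg₁ : ∀ s x y c → s * (x * (y * c)) ≡ s * x * (y * c)
      alg₁ = solve-∀
      alg₂ : ∀ d x y c → d * x * (y * c) ≡ d * c * (x * y)
      alg₂ = solve-∀
      alg₃ : ∀ d x y c → d * c * (x * y) ≡ d * y * (x * c)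
      alg₃ = solve-∀
      M-sym : ∀ i j → M i j ≡ M j i
      M-sym i j = *-cancelˡ-0< s>0 (begin
        s * M i j                      ≡⟨ alg₁ s (a^ i) (a j) (C i j) ⟩
        s * a^ i * (a j * C i j)       ≡⟨ cong (_* (a j * C i j)) (p i) ⟩
        D i * a i * (a j * C i j)      ≡⟨ alg₂ (D i) (a i) (a j) (C i j) ⟩
        D i * C i j * (a i * a j)      ≡⟨ cong (_* (a i * a j)) (D-sym i j) ⟩
        D j * C j i * (a i * a j)      ≡⟨ alg₃ (D j) (a i) (a j) (C j i) ⟩
        D j * a j * (a i * C j i)      ≡⟨ cong (_* (a i * C j i)) (sym (p j)) ⟩
        s * a^ j * (a i * C j i)       ≡⟨ sym (alg₁ s (a^ j) (a i) (C j i)) ⟩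
        s * M j i                      ∎)
    ... | e , eq = e , trans (∑-cong (λ k → sym (∑-distribˡ-* (a^ k) _))) eq

  ⟨⟩-pos : ∀ {s a^ a} → 0ℤ < s → (∀ k → s * a^ k ≡ D k * a k) → (∃[ i ] a i ≢ 0ℤ) → 0ℤ < ⟨ a^ , a ⟩
  ⟨⟩-pos {s} {a^} {a} s>0 p a≢0 = 0<*⇒0< s>0 (subst (0ℤ <_)
    (sym (trans (bform-co {s} {a^} {a} p a) (bform-quad a))) (posDef a a≢0))

  ⟨⟩-≥2 : ∀ {s a^ a} → 0ℤ < s → (∀ k → s * a^ k ≡ D k * a k) → (∃[ i ] a i ≢ 0ℤ) → + 2 ≤ ⟨ a^ , a ⟩
  ⟨⟩-≥2 {s} {a^} {a} s>0 p a≢0 with ⟨⟩-even {s} {a^} {a} s>0 p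
  ... | e , eq = subst (+ 2 ≤_) (sym eq) (ℤ.*-monoˡ-≤-nonNeg (+ 2) {1ℤ} {e}
        (ℤ.i<j⇒suc[i]≤j (0<*⇒0< {+ 2} (+<+ (ℕ.s≤s ℕ.z≤n)) (subst (0ℤ <_) eq (⟨⟩-pos s>0 p a≢0)))))

  Pos Neg : V → Set
  Pos β = ∀ k → 0ℤ ≤ β k
  Neg β = ∀ k → β k ≤ 0ℤ

  ∑≤0 : ∀ {m} (f : Fin m → ℤ) → (∀ i → f i ≤ 0ℤ) → sumℤ f ≤ 0ℤ
  ∑≤0 {zero}  f p = ℤ.≤-refl
  ∑≤0 {suc m} f p = ℤ.+-mono-≤ (p zero) (∑≤0 (f ∘ suc) (p ∘ suc))

  nonneg*nonpos : ∀ {i j} → 0ℤ ≤ i → j ≤ 0ℤ → i * j ≤ 0ℤ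
  nonneg*nonpos {i} {j} p q = subst (i * j ≤_) (ℤ.*-zeroʳ i) (ℤ.*-monoˡ-≤-nonNeg i {{ℤ.nonNegative p}} q)

  opaque
    unfolding ⟨_,_⟩

    -- Diagonal terms vanish because the supports are disjoint; all others carry a factor C k l ≤ 0.
    ⟨⟩-disjoint : ∀ {a b} → Pos a → Pos b → (∀ k → a k * b k ≡ 0ℤ) → ⟨ a , b ⟩ ≤ 0ℤ
    ⟨⟩-disjoint {a} {b} pa pb ab = subst (_≤ 0ℤ) (∑-cong (λ k → ∑-distribˡ-* (a k) _)) (∑≤0 _ (λ k → ∑≤0 _ (term k)))
      where
      term : ∀ k l → a k * (b l * C k l) ≤ 0ℤ
      term k l with k Fin.≟ l
      ... | yes refl = ℤ.≤-reflexive (trans (sym (ℤ.*-assoc (a k) (b k) (C k k))) (trans (cong (_* C k k) (ab k))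
          (ℤ.*-zeroˡ (C k k))))
      ... | no k≢l   = nonneg*nonpos (pa k) (nonneg*nonpos (pb l) (offdiag k l k≢l))

  positivePart negativePart : V → V
  positivePart β k = β k ⊔ 0ℤ
  negativePart β k = (- β k) ⊔ 0ℤ

  parts : ∀ i → (i ⊔ 0ℤ) - ((- i) ⊔ 0ℤ) ≡ i
  parts (+ zero)  = refl
  parts +[1+ n ]  = ℤ.+-identityʳ _
  parts -[1+ n ]  = refl

  parts-disjoint : ∀ i j → (0ℤ ≤ i → 0ℤ ≤ j) → (i ≤ 0ℤ → j ≤ 0ℤ) → (i ⊔ 0ℤ) * ((- j) ⊔ 0ℤ) ≡ 0ℤ
  parts-disjoint i j f g with ℤ.≤-total 0ℤ i
  ... | inj₁ 0≤i = trans (cong ((i ⊔ 0ℤ) *_) (ℤ.i≤j⇒i⊔j≡j (ℤ.neg-mono-≤ (f 0≤i)))) (ℤ.*-zeroʳ (i ⊔ 0ℤ))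
  ... | inj₂ i≤0 = trans (cong (_* ((- j) ⊔ 0ℤ)) (ℤ.i≤j⇒i⊔j≡j i≤0)) (ℤ.*-zeroˡ ((- j) ⊔ 0ℤ))

  prop-pos : ∀ {s t i j} → 0ℤ < s → 0ℤ < t → s * i ≡ t * j → 0ℤ ≤ i → 0ℤ ≤ j
  prop-pos s>0 t>0 e p = 0≤*⇒0≤ t>0 (subst (0ℤ ≤_) e (0≤⇒0≤* (ℤ.<⇒≤ s>0) p))

  prop-neg : ∀ {s t i j} → 0ℤ < s → 0ℤ < t → s * i ≡ t * j → i ≤ 0ℤ → j ≤ 0ℤ
  prop-neg {s} {t} {i} {j} s>0 t>0 e p = subst (_≤ 0ℤ) (ℤ.neg-involutive j) (ℤ.neg-mono-≤
      (prop-pos {s} {t} {(- i)} {(- j)} s>0 t>0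
    (trans (sym (ℤ.neg-distribʳ-* s i)) (trans (cong -_ e) (ℤ.neg-distribʳ-* t j))) (ℤ.neg-mono-≤ p)))

  -- Writing β = β⁺ − β⁻ by signs of coordinates, ⟨β^∨,β⟩ = 2 while each of ⟨β^∨±,β±⟩ is
  -- a positive even integer as soon as β± ≠ 0, and the mixed terms only add to this.
  root-sign : ∀ (r : Root) → Pos (vec r) ⊎ Neg (vec r)
  root-sign r with zero? (positivePart (vec r)) | zero? (negativePart (vec r))
  ... | inj₂ p≡0 | _ = inj₂ λ k → subst (vec r k ≤_) (p≡0 k) (ℤ.i≤i⊔j (vec r k) 0ℤ)
  ... | _ | inj₂ q≡0 = inj₁ λ k → subst (0ℤ ≤_) (ℤ.neg-involutive (vec r k))
          (ℤ.neg-mono-≤ (subst (- vec r k ≤_) (q≡0 k) (ℤ.i≤i⊔j (- vec r k) 0ℤ)))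
  ... | inj₁ p≢0 | inj₁ q≢0 = ⊥-elim (4≰2 (subst (+ 4 ≤_) (trans expand (two r))
          (ℤ.+-mono-≤ (ℤ.+-mono-≤ pp≥2 (ℤ.neg-mono-≤ pq≤0)) (ℤ.+-mono-≤ (ℤ.neg-mono-≤ qp≤0) qq≥2))))
    where
    4≰2 : ¬ (+ 4 ≤ + 2)
    4≰2 (+≤+ (ℕ.s≤s (ℕ.s≤s ())))
    s = D (typ r)
    s>0 = D-pos (typ r)
    β = vec r
    β^ = co r
    p = positivePart β
    q = negativePart β
    P = positivePart β^
    Q = negativePart β^
    scale-⊔ : ∀ {c d x y} → 0ℤ < c → 0ℤ < d → c * x ≡ d * y → c * (x ⊔ 0ℤ) ≡ d * (y ⊔ 0ℤ)
    scale-⊔ {c} {d} {x} {y} c>0 d>0 e = begin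
      c * (x ⊔ 0ℤ)     ≡⟨ ℤ.*-distribˡ-⊔-nonNeg c x 0ℤ {{ℤ.nonNegative (ℤ.<⇒≤ c>0)}} ⟩
      c * x ⊔ c * 0ℤ   ≡⟨ cong₂ _⊔_ e (trans (ℤ.*-zeroʳ c) (sym (ℤ.*-zeroʳ d))) ⟩
      d * y ⊔ d * 0ℤ   ≡⟨ sym (ℤ.*-distribˡ-⊔-nonNeg d y 0ℤ {{ℤ.nonNegative (ℤ.<⇒≤ d>0)}}) ⟩
      d * (y ⊔ 0ℤ)     ∎
    Pp : ∀ k → s * P k ≡ D k * p k
    Pp k = scale-⊔ s>0 (D-pos k) (prop r k)
    Qq : ∀ k → s * Q k ≡ D k * q k
    Qq k = scale-⊔ s>0 (D-pos k) (trans (sym (ℤ.neg-distribʳ-* s (β^ k))) (trans (cong -_ (prop r k))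
        (ℤ.neg-distribʳ-* (D k) (β k))))
    pp≥2 = ⟨⟩-≥2 {s} {P} {p} s>0 Pp p≢0
    qq≥2 = ⟨⟩-≥2 {s} {Q} {q} s>0 Qq q≢0
    Pos-⊔ : ∀ (f : V) → Pos (λ k → f k ⊔ 0ℤ)
    Pos-⊔ f k = ℤ.i≤j⊔i (f k) 0ℤ
    pq≤0 : ⟨ P , q ⟩ ≤ 0ℤ
    pq≤0 = ⟨⟩-disjoint (Pos-⊔ β^) (Pos-⊔ (neg β)) (λ k → parts-disjoint (β^ k) (β k)
      (prop-pos s>0 (D-pos k) (prop r k)) (prop-neg s>0 (D-pos k) (prop r k)))
    qp≤0 : ⟨ Q , p ⟩ ≤ 0ℤ
    qp≤0 = ⟨⟩-disjoint (Pos-⊔ (neg β^)) (Pos-⊔ β) (λ k → trans (ℤ.*-comm (Q k) (p k)) (parts-disjoint (β k) (β^ k)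
      (prop-pos (D-pos k) s>0 (sym (prop r k))) (prop-neg (D-pos k) s>0 (sym (prop r k)))))
    alg : ∀ a b c d → a + - b + (- c + d) ≡ a - 1ℤ * b - 1ℤ * (c - 1ℤ * d)
    alg = solve-∀
    shift-parts : ∀ f → shift (positivePart f) 1ℤ (negativePart f) ≗ f
    shift-parts f k = trans (cong (λ t → (f k ⊔ 0ℤ) - t) (ℤ.*-identityˡ _)) (parts (f k))
    expand : ⟨ P , p ⟩ + - ⟨ P , q ⟩ + (- ⟨ Q , p ⟩ + ⟨ Q , q ⟩) ≡ ⟨ β^ , β ⟩
    expand = begin
      ⟨ P , p ⟩ + - ⟨ P , q ⟩ + (- ⟨ Q , p ⟩ + ⟨ Q , q ⟩)
        ≡⟨ alg ⟨ P , p ⟩ ⟨ P , q ⟩ ⟨ Q , p ⟩ ⟨ Q , q ⟩ ⟩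
      ⟨ P , p ⟩ - 1ℤ * ⟨ P , q ⟩ - 1ℤ * (⟨ Q , p ⟩ - 1ℤ * ⟨ Q , q ⟩)
        ≡⟨ sym (cong₂ (λ s t → s - 1ℤ * t) (⟨⟩-shiftʳ P p 1ℤ q) (⟨⟩-shiftʳ Q p 1ℤ q)) ⟩
      ⟨ P , shift p 1ℤ q ⟩ - 1ℤ * ⟨ Q , shift p 1ℤ q ⟩
        ≡⟨ sym (⟨⟩-shiftˡ P 1ℤ Q (shift p 1ℤ q)) ⟩
      ⟨ shift P 1ℤ Q , shift p 1ℤ q ⟩
        ≡⟨ ⟨⟩-cong (shift-parts β^) (shift-parts β) ⟩
      ⟨ β^ , β ⟩ ∎

argmax : ∀ {n} (f : Fin n → ℤ) → Fin n → ∃[ i ] (∀ j → f j ≤ f i)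
argmax {suc zero}    f _ = zero , λ { zero → ℤ.≤-refl }
argmax {suc (suc n)} f _ with argmax (f ∘ suc) zero
... | i , m with ℤ.≤-total (f zero) (f (suc i))
...   | inj₁ p = suc i , λ { zero → p ; (suc j) → m j }
...   | inj₂ p = zero  , λ { zero → ℤ.≤-refl ; (suc j) → ℤ.≤-trans (m j) p }

-- The Weyl group: exchange, words for reflections, bounds on roots.

module WeylGroup {n : ℕ} (C : CartanMatrix n) (IC : IntegralCartan C) where

  open IntegralCartan IC
  open RootSystem C IC
  open ≡-Reasoning

  private
    ∑-cong = Σℤ.∑-cong {n}
    ∑-distrib-+ = Σℤ.∑-distrib-+ {n}
    ∑-distribˡ-* = Σℤ.∑-distribˡ-* {n}

  simpleRoot : Fin n → Root
  simpleRoot j = record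
    { vec = α j ; co = α j ; typ = j ; two = ⟨α,α⟩≡2 j ; prop = prop-α ; isRoot = [] , j , λ k → refl }
    where
    prop-α : ∀ k → D j * α j k ≡ D k * α j k
    prop-α k with j Fin.≟ k
    ... | yes refl = refl
    ... | no _     = trans (ℤ.*-zeroʳ (D j)) (sym (ℤ.*-zeroʳ (D k)))

  -- Turns a pointwise description of the vector into the vector itself, so that `fromIsRoot` can
  -- return an equation to be matched with `refl`.
  rebase : (r : Root) (β : V) → β ≗ vec r → Root
  rebase r β e = record
    { vec = β ; co = co r ; typ = typ r
    ; two = trans (⟨⟩-cong {co r} {co r} (λ _ → refl) e) (two r)
    ; prop = λ k → trans (prop r k) (cong (D k *_) (sym (e k)))
    ; isRoot = let w , i , f = isRoot r in w , i , λ k → trans (e k) (f k) }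

  reflRoot-α : ∀ i → reflRoot C i (α i) ≗ neg (α i)
  reflRoot-α i k = begin
    reflRoot C i (α i) k                 ≡⟨ reflRoot-shift i (α i) k ⟩
    α i k - ⟨α^ i , α i ⟩ * α i k         ≡⟨ cong (λ t → α i k - t * α i k) (trans (⟨α^,α⟩ i i) (diag i)) ⟩
    α i k - + 2 * α i k                  ≡⟨ sym (neg≗shift (α i) k) ⟩
    - α i k                              ∎

  negRoot : Root → Root
  negRoot r = record
    { vec = neg (vec r) ; co = neg (co r) ; typ = typ r
    ; two = trans (⟨⟩-negˡ (co r) (neg (vec r))) (trans (cong -_ (⟨⟩-negʳ (co r) (vec r))) (trans
        (ℤ.neg-involutive _) (two r)))
    ; prop = λ k → trans (sym (ℤ.neg-distribʳ-* (D (typ r)) (co r k))) (trans (cong -_ (prop r k))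
        (ℤ.neg-distribʳ-* (D k) (vec r k)))
    ; isRoot = isRoot-neg (isRoot r) }
    where
    isRoot-neg : ∀ {β} → IsRoot C β → IsRoot C (neg β)
    isRoot-neg (w , i , e) = i ∷ w , i , λ k → trans (cong -_ (e k))
      (trans (sym (actRoot-neg w (α i) k)) (sym (actRoot-cong w (reflRoot-α i) k)))

  -- Both sides are the inner product of the two roots.
  bform-reflection : (r η : Root) → D (typ r) * ⟨ co r , vec η ⟩ ≡ D (typ η) * ⟨ co η , vec r ⟩
  bform-reflection r η = begin
    D (typ r) * ⟨ co r , vec η ⟩    ≡⟨ bform-co {D (typ r)} {co r} {vec r} (prop r) (vec η) ⟩
    bform (vec r) (vec η)          ≡⟨ bform-sym (vec r) (vec η) ⟩
    bform (vec η) (vec r)          ≡⟨ sym (bform-co {D (typ η)} {co η} {vec η} (prop η) (vec r)) ⟩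
    D (typ η) * ⟨ co η , vec r ⟩    ∎

  reflect-prop : (r η : Root) → ∀ k → D (typ r) * shift (co r) ⟨ co r , vec η ⟩ (co η) k
                                     ≡ D k * shift (vec r) ⟨ co η , vec r ⟩ (vec η) k
  reflect-prop r η k = begin
    D t * (co r k - x * co η k)
      ≡⟨ alg₁ (D t) (co r k) x (co η k) ⟩
    D t * co r k - (D t * x) * co η k
      ≡⟨ cong₂ (λ a b → a - b * co η k) (prop r k) (bform-reflection r η) ⟩
    D k * vec r k - (D (typ η) * y) * co η k
      ≡⟨ alg₂ (D k * vec r k) (D (typ η)) y (co η k) ⟩
    D k * vec r k - y * (D (typ η) * co η k)
      ≡⟨ cong (λ a → D k * vec r k - y * a) (prop η k) ⟩
    D k * vec r k - y * (D k * vec η k)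
      ≡⟨ alg₃ (D k) (vec r k) y (vec η k) ⟩
    D k * (vec r k - y * vec η k) ∎
    where
    t = typ r
    x = ⟨ co r , vec η ⟩
    y = ⟨ co η , vec r ⟩
    alg₁ : ∀ d c x e → d * (c - x * e) ≡ d * c - (d * x) * e
    alg₁ = solve-∀
    alg₂ : ∀ v d y e → v - (d * y) * e ≡ v - y * (d * e)
    alg₂ = solve-∀
    alg₃ : ∀ d v y e → d * v - y * (d * e) ≡ d * (v - y * e)
    alg₃ = solve-∀

  -- Vector and coroot come from the reflection formula; the word `c` for the same reflection
  -- extends the witness in `isRoot`.
  reflectBy : (η : Root) (c : List (Fin n)) → (∀ γ → actRoot C c γ ≗ refl[ co η , vec η ] γ) → Root → Root
  reflectBy η c c-refl r = record
    { vec = refl[ co η , vec η ] (vec r)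
    ; co = shift (co r) ⟨ co r , vec η ⟩ (co η)
    ; typ = typ r
    ; two = trans (⟨⟩-reflect (co r) (vec r) (co η) (vec η) (two η)) (two r)
    ; prop = reflect-prop r η
    ; isRoot = let w , i , e = isRoot r in w ++ c , i , λ k → trans (sym (c-refl (vec r) k))
        (trans (actRoot-cong c e k) (cong (λ f → f k) (sym (actRoot-++ w c (α i))))) }

  reflectRoot : Fin n → Root → Root
  reflectRoot j r = record
    { vec = reflRoot C j (vec r)
    ; co = reflCo j (co r)
    ; typ = typ r
    ; two = trans (⟨⟩-reflRoot j (co r) (vec r)) (two r)
    ; prop = λ k → trans (cong (D (typ r) *_) (reflCo-shift j (co r) k))
        (trans (reflect-prop r (simpleRoot j) k) (cong (D k *_) (sym (reflRoot≗refl j (vec r) k))))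
    ; isRoot = let w , i , e = isRoot r in w ++ [ j ] , i , λ k →
        trans (reflRoot-cong j e k) (cong (λ f → f k) (sym (actRoot-++ w [ j ] (α i)))) }

  actOn : List (Fin n) → Root → Root
  actOn []      r = r
  actOn (j ∷ w) r = actOn w (reflectRoot j r)

  vec-actOn : ∀ w r → vec (actOn w r) ≡ actRoot C w (vec r)
  vec-actOn []      r = refl
  vec-actOn (j ∷ w) r = vec-actOn w (reflectRoot j r)

  co-actOn : ∀ w r → co (actOn w r) ≡ actCo w (co r)
  co-actOn []      r = refl
  co-actOn (j ∷ w) r = co-actOn w (reflectRoot j r)

  fromIsRoot : ∀ {β} → IsRoot C β → Σ[ r ∈ Root ] vec r ≡ β
  fromIsRoot {β} (w , i , e) = rebase (actOn w (simpleRoot i)) β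
    (λ k → trans (e k) (cong (λ f → f k) (sym (vec-actOn w (simpleRoot i))))) , refl

  ⟨⟩-zeroʳ : ∀ m {β} → (∀ k → β k ≡ 0ℤ) → ⟨ m , β ⟩ ≡ 0ℤ
  ⟨⟩-zeroʳ m {β} e = trans (⟨⟩-transpose m β) (Σℤ.∑-zero (λ l → trans (cong (_* ⟨ m ,α l ⟩) (e l))
      (ℤ.*-zeroˡ ⟨ m ,α l ⟩)))

  root-nonzero : (r : Root) → ¬ (∀ k → vec r k ≡ 0ℤ)
  root-nonzero r e with trans (sym (two r)) (⟨⟩-zeroʳ (co r) e)
  ... | ()

  Pos-Neg-disjoint : (r : Root) → Pos (vec r) → ¬ Neg (vec r)
  Pos-Neg-disjoint r p q = root-nonzero r (λ k → ℤ.≤-antisym (q k) (p k))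

  co-pos : (r : Root) → Pos (vec r) → Pos (co r)
  co-pos r p k = prop-pos (D-pos k) (D-pos (typ r)) (sym (prop r k)) (p k)

  i*j≡1 : ∀ {i j} → 0ℤ ≤ j → i * j ≡ 1ℤ → (i ≡ 1ℤ) × (j ≡ 1ℤ)
  i*j≡1 {i} {j} 0≤j e = trans (sym (ℤ.*-identityʳ i)) (trans (cong (i *_) (sym j≡1)) e) , j≡1
    where
    ∣j∣≡1 : ∣ j ∣ ≡ 1
    ∣j∣≡1 = ℕ.m*n≡1⇒n≡1 ∣ i ∣ ∣ j ∣ (trans (sym (ℤ.abs-* i j)) (cong ∣_∣ e))
    j≡1 : j ≡ 1ℤ
    j≡1 = trans (sym (ℤ.0≤i⇒+∣i∣≡i 0≤j)) (cong +_ ∣j∣≡1)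

  -- This is where Φ is seen to be reduced: if r = a α_k with coroot a^ α_k^∨, then 2 = ⟨co r , vec
  -- r⟩ = 2 a^ a, and integrality leaves a = a^ = 1.
  single-support : (r : Root) (k : Fin n) → Pos (vec r) → (∀ l → k ≢ l → vec r l ≡ 0ℤ) →
                   (vec r ≗ α k) × (co r ≗ α k)
  single-support r k p z = at-k (vec r) (proj₂ coefs) z , at-k (co r) (proj₁ coefs) z^
    where
    z^ : ∀ l → k ≢ l → co r l ≡ 0ℤ
    z^ l k≢l = *-cancelˡ-0< (D-pos (typ r)) (trans (prop r l)
      (trans (cong (D l *_) (z l k≢l)) (trans (ℤ.*-zeroʳ (D l)) (sym (ℤ.*-zeroʳ (D (typ r)))))))
    -- The vector f_k α_k written as a `shift`, so that the bilinearity lemmas apply to it.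
    scaled : ∀ f → (∀ l → k ≢ l → f l ≡ 0ℤ) → f ≗ shift (α k) (1ℤ - f k) (α k)
    scaled f zf l with k Fin.≟ l
    ... | yes refl = alg (f k)
      where
      alg : ∀ x → x ≡ 1ℤ - (1ℤ - x) * 1ℤ
      alg = solve-∀
    ... | no k≢l = trans (zf l k≢l) (alg (f k))
      where
      alg : ∀ x → 0ℤ ≡ 0ℤ - (1ℤ - x) * 0ℤ
      alg = solve-∀
    a = vec r k
    a^ = co r k
    four : a^ * a * + 2 ≡ + 2
    four = begin
      a^ * a * + 2
        ≡⟨ alg a^ a ⟩
      (+ 2 - (1ℤ - a) * + 2) - (1ℤ - a^) * (+ 2 - (1ℤ - a) * + 2)
        ≡⟨ sym (cong (λ t → (t - (1ℤ - a) * t) - (1ℤ - a^) * (t - (1ℤ - a) * t)) (⟨α,α⟩≡2 k)) ⟩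
      (⟨ α k , α k ⟩ - (1ℤ - a) * ⟨ α k , α k ⟩) - (1ℤ - a^) * (⟨ α k , α k ⟩ - (1ℤ - a) * ⟨ α k , α k ⟩)
        ≡⟨ sym (cong (λ t → t - (1ℤ - a^) * t) (⟨⟩-shiftʳ (α k) (α k) (1ℤ - a) (α k))) ⟩
      ⟨ α k , shift (α k) (1ℤ - a) (α k) ⟩ - (1ℤ - a^) * ⟨ α k , shift (α k) (1ℤ - a) (α k) ⟩
        ≡⟨ sym (⟨⟩-shiftˡ (α k) (1ℤ - a^) (α k) _) ⟩
      ⟨ shift (α k) (1ℤ - a^) (α k) , shift (α k) (1ℤ - a) (α k) ⟩
        ≡⟨ sym (⟨⟩-cong (scaled (co r) z^) (scaled (vec r) z)) ⟩
      ⟨ co r , vec r ⟩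
        ≡⟨ two r ⟩
      + 2 ∎
      where
      alg : ∀ x y → x * y * + 2 ≡ (+ 2 - (1ℤ - y) * + 2) - (1ℤ - x) * (+ 2 - (1ℤ - y) * + 2)
      alg = solve-∀
    coefs : (a^ ≡ 1ℤ) × (a ≡ 1ℤ)
    coefs = i*j≡1 (p k) (ℤ.*-cancelʳ-≡ (a^ * a) 1ℤ (+ 2) four)
    at-k : ∀ f → f k ≡ 1ℤ → (∀ l → k ≢ l → f l ≡ 0ℤ) → f ≗ α k
    at-k f e zf l with k Fin.≟ l
    ... | yes refl = e
    ... | no k≢l   = zf l k≢l

  reflRoot-away : ∀ k β {l} → k ≢ l → reflRoot C k β l ≡ β l
  reflRoot-away k β {l} k≢l = trans (reflRoot-shift k β l)
    (trans (cong (λ t → β l - ⟨α^ k , β ⟩ * t) (α-offdiag k≢l)) (alg (β l) ⟨α^ k , β ⟩))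
    where
    alg : ∀ x y → x - y * 0ℤ ≡ x
    alg = solve-∀

  -- The reflection changes coordinate k only, so every other coordinate is at once nonnegative and
  -- nonpositive.
  only-αₖ-changes-sign : (r : Root) (k : Fin n) → Pos (vec r) → Neg (vec (reflectRoot k r)) →
                         (vec r ≗ α k) × (co r ≗ α k)
  only-αₖ-changes-sign r k p q = single-support r k p
    (λ l k≢l → ℤ.≤-antisym (subst (_≤ 0ℤ) (reflRoot-away k (vec r) k≢l) (q l)) (p l))

  refl-conj : ∀ η^ η k γ → refl[ reflCo k η^ , reflRoot C k η ] (reflRoot C k γ) ≗ reflRoot C k (refl[ η^ , η ] γ)
  refl-conj η^ η k γ l = trans
    (cong (λ t → reflRoot C k γ l - t * reflRoot C k η l) (⟨⟩-reflRoot k η^ γ))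
    (sym (reflRoot-linear k γ ⟨ η^ , γ ⟩ η l))

  refl-cong : ∀ {η^ ζ^ η ζ β γ} → η^ ≗ ζ^ → η ≗ ζ → β ≗ γ → refl[ η^ , η ] β ≗ refl[ ζ^ , ζ ] γ
  refl-cong {ζ^ = ζ^} {ζ = ζ} e f g k = cong₂ _-_ (g k) (cong₂ _*_ (⟨⟩-cong e g) (f k))

  refl≗reflRoot : ∀ {η^ η} k → η^ ≗ α k → η ≗ α k → ∀ γ → refl[ η^ , η ] γ ≗ reflRoot C k γ
  refl≗reflRoot k e f γ l = trans (refl-cong {β = γ} e f (λ _ → refl) l) (sym (reflRoot≗refl k γ l))

  -- Follow the root through the letters of w. At the letter k where it first turns negative it
  -- equals α_k, and that letter is the reflection in r carried along by the preceding letters;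
  -- deleting it gives w′. As w′ is a subword, any restriction on the letters, such as membership in
  -- J, survives.
  exchange : (r : Root) (w : List (Fin n)) → Pos (vec r) → Neg (actRoot C w (vec r)) →
             ∃[ w′ ] (length w ≡ suc (length w′) × (∀ {P : Fin n → Set} → All P w → All P w′)
                     × (∀ γ → actRoot C w′ γ ≗ actRoot C w (refl[ co r , vec r ] γ)))
  exchange r []      p q = ⊥-elim (Pos-Neg-disjoint r p q)
  exchange r (k ∷ w) p q with root-sign (reflectRoot k r)
  ... | inj₂ neg-k = w , refl , (λ { (_ ∷ ps) → ps }) , λ γ l → actRoot-cong w (λ l′ → sym (trans
          (reflRoot-cong k (refl≗reflRoot k (proj₂ rk) (proj₁ rk) γ) l′) (reflRoot-involutive k γ l′))) l
    where rk = only-αₖ-changes-sign r k p neg-k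
  ... | inj₁ pos-k with exchange (reflectRoot k r) w pos-k q
  ...   | w′ , len , all , act = k ∷ w′ , cong suc len , (λ { (a ∷ ps) → a ∷ all ps }) , λ γ l →
          trans (act (reflRoot C k γ) l) (actRoot-cong w (refl-conj (co r) (vec r) k γ) l)

  -- The factor 1 puts the height into the form handled by `∑-shift` and `∑-α`.
  ht : V → ℤ
  ht β = sumℤ (λ k → β k * 1ℤ)

  ht-nonneg : ∀ {β} → Pos β → 0ℤ ≤ ht β
  ht-nonneg {β} p = ∑-nonneg _ (λ k → subst (0ℤ ≤_) (sym (ℤ.*-identityʳ (β k))) (p k))

  ht-reflRoot : ∀ k β → ht (reflRoot C k β) ≡ ht β - ⟨α^ k , β ⟩
  ht-reflRoot k β = begin
    ht (reflRoot C k β)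
      ≡⟨ ∑-cong (λ l → cong (_* 1ℤ) (reflRoot-shift k β l)) ⟩
    ht (shift β ⟨α^ k , β ⟩ (α k))
      ≡⟨ ∑-shift β ⟨α^ k , β ⟩ (α k) (λ _ → 1ℤ) ⟩
    ht β - ⟨α^ k , β ⟩ * ht (α k)
      ≡⟨ cong (λ t → ht β - t) (trans (cong (⟨α^ k , β ⟩ *_) (∑-α k (λ _ → 1ℤ))) (ℤ.*-identityʳ _)) ⟩
    ht β - ⟨α^ k , β ⟩ ∎

  opaque
    unfolding ⟨_,_⟩

    -- 2 = ⟨co r , vec r⟩ is the sum of the co_k ⟨α_k^∨ , r⟩, so one term is positive, and co_k ≥ 0
    -- decides the sign of both factors.
    positive-pairing : (r : Root) → Pos (vec r) → ∃[ k ] (0ℤ < vec r k × 0ℤ < ⟨α^ k , vec r ⟩)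
    positive-pairing r p with ∑-pos⇒term-pos (λ k → co r k * ⟨α^ k , vec r ⟩) (subst (0ℤ <_) (sym (two r)) (+<+
        (ℕ.s≤s ℕ.z≤n)))
    ... | k , 0<cd = k , vec>0 , 0<*⇒0< co>0 0<cd
      where
      co>0 : 0ℤ < co r k
      co>0 = ℤ.≤∧≢⇒< (co-pos r p k) λ e → ℤ.<-irrefl refl
        (subst (0ℤ <_) (trans (cong (_* ⟨α^ k , vec r ⟩) (sym e)) (ℤ.*-zeroˡ ⟨α^ k , vec r ⟩)) 0<cd)
      vec>0 : 0ℤ < vec r k
      vec>0 = 0<*⇒0< (D-pos k) (subst (0ℤ <_) (prop r k) (0<⇒0<* (D-pos (typ r)) co>0))

  refl-involutive : (η : Root) → ∀ γ → refl[ co η , vec η ] (refl[ co η , vec η ] γ) ≗ γ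
  refl-involutive η γ k = begin
    γ k - ⟨ co η , γ ⟩ * vec η k - ⟨ co η , refl[ co η , vec η ] γ ⟩ * vec η k
      ≡⟨ cong (λ t → γ k - ⟨ co η , γ ⟩ * vec η k - t * vec η k)
           (trans (⟨⟩-shiftʳ (co η) γ ⟨ co η , γ ⟩ (vec η)) (cong (λ t → ⟨ co η , γ ⟩ - ⟨ co η , γ ⟩ * t) (two η))) ⟩
    γ k - ⟨ co η , γ ⟩ * vec η k - (⟨ co η , γ ⟩ - ⟨ co η , γ ⟩ * + 2) * vec η k
      ≡⟨ alg (γ k) ⟨ co η , γ ⟩ (vec η k) ⟩
    γ k ∎
    where
    alg : ∀ g x v → g - x * v - (x - x * + 2) * v ≡ g
    alg = solve-∀

  Reflects : (Fin n → Set) → Root → Set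
  Reflects P r = ∃[ c ] (All P c × (∀ γ → actRoot C c γ ≗ refl[ co r , vec r ] γ))

  -- Induction on the height: reflecting r in an α_k with which it pairs positively lowers the
  -- height, and s_r = s_k s_r′ s_k for the lower root r′. When r′ is negative, r is α_k itself. The
  -- letter k lies in the support of r, so reflections in Φ_J become words in W_J.
  reflection-word′ : ∀ {P : Fin n → Set} fuel (r : Root) → Pos (vec r) → (∀ k → vec r k ≢ 0ℤ → P k) →
                     ht (vec r) < + fuel → Reflects P r
  reflection-word′ zero r p supp h = ⊥-elim (ℤ.<-irrefl refl (ℤ.≤-<-trans (ht-nonneg p) h))
  reflection-word′ {P} (suc fuel) r p supp h with positive-pairing r p
  ... | k , 0<rk , 0<c with root-sign (reflectRoot k r)
  ...   | inj₂ neg-k = [ k ] , supp k (λ e → ℤ.<-irrefl (sym e) 0<rk) ∷ [] ,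
            λ γ l → sym (refl≗reflRoot k (proj₂ rk) (proj₁ rk) γ l)
    where rk = only-αₖ-changes-sign r k p neg-k
  ...   | inj₁ pos-k with reflection-word′ fuel (reflectRoot k r) pos-k supp′ h′
    where
    supp′ : ∀ l → reflRoot C k (vec r) l ≢ 0ℤ → P l
    supp′ l ≢0 = supp l λ e → ≢0 (trans (reflRoot-away k (vec r) {l}
      (λ k≡l → ℤ.<-irrefl (trans (sym e) (cong (vec r) (sym k≡l))) 0<rk)) e)
    h′ : ht (reflRoot C k (vec r)) < + fuel
    h′ = subst (_< + fuel) (sym (ht-reflRoot k (vec r))) (ℤ.<-≤-trans
      (subst (ht (vec r) - ⟨α^ k , vec r ⟩ <_) (ℤ.+-identityʳ _) (ℤ.+-monoʳ-< (ht (vec r)) (ℤ.neg-mono-< 0<c)))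
      (ℤ.i<j⇒i≤pred[j] h))
  ...     | c , ps , act = k ∷ c ++ [ k ] , Pk ∷ All.++⁺ ps (Pk ∷ []) , λ γ l → begin
            actRoot C (c ++ [ k ]) (reflRoot C k γ) l
              ≡⟨ cong (λ f → f l) (actRoot-++ c [ k ] (reflRoot C k γ)) ⟩
            reflRoot C k (actRoot C c (reflRoot C k γ)) l
              ≡⟨ reflRoot-cong k (λ l′ → trans (act (reflRoot C k γ) l′) (refl-conj (co r) (vec r) k γ l′)) l ⟩
            reflRoot C k (reflRoot C k (refl[ co r , vec r ] γ)) l
              ≡⟨ reflRoot-involutive k _ l ⟩
            refl[ co r , vec r ] γ l ∎
    where
    Pk : P k
    Pk = supp k (λ e → ℤ.<-irrefl (sym e) 0<rk)

  reflection-word : ∀ {P : Fin n → Set} (r : Root) → (∀ k → vec r k ≢ 0ℤ → P k) → Reflects P r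
  reflection-word r supp with root-sign r
  ... | inj₁ p = reflection-word′ (suc ∣ ht (vec r) ∣) r p supp
        (subst (_< + suc ∣ ht (vec r) ∣) (ℤ.0≤i⇒+∣i∣≡i (ht-nonneg p)) (+<+ ℕ.≤-refl))
  ... | inj₂ q with reflection-word′ (suc ∣ ht (neg (vec r)) ∣) (negRoot r) p′ supp′
        (subst (_< + suc ∣ ht (neg (vec r)) ∣) (ℤ.0≤i⇒+∣i∣≡i (ht-nonneg p′)) (+<+ ℕ.≤-refl))
    where
    p′ : Pos (neg (vec r))
    p′ k = ℤ.neg-mono-≤ (q k)
    supp′ : ∀ k → neg (vec r) k ≢ 0ℤ → _
    supp′ k ≢0 = supp k (λ e → ≢0 (cong -_ e))
  ...   | c , ps , act = c , ps , λ γ k → trans (act γ k)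
          (trans (cong (λ t → γ k - t * - vec r k) (⟨⟩-negˡ (co r) γ)) (alg (γ k) ⟨ co r , γ ⟩ (vec r k)))
    where
    alg : ∀ g x v → g - (- x) * (- v) ≡ g - x * v
    alg = solve-∀

  -- The squared length 2 D (typ r) is at most the sum `M` of all 2 D k, a bound that does not
  -- depend on the root.
  root-bound : ∃[ K ] ((r : Root) → ∀ k → ∣ vec r k ∣ ℕ.≤ K)
  root-bound = proj₁ bounded , λ r → proj₂ bounded (vec r) (quad≤ r)
    where
    B : Fin n → Fin n → ℤ
    B i j = C i j * D i
    B-sym : SymmetricMatrix B
    B-sym i j = trans (ℤ.*-comm (C i j) (D i)) (trans (D-sym i j) (ℤ.*-comm (D j) (C j i)))
    M : ℤ
    M = sumℤ (λ k → D k * + 2)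
    bounded = posDef⇒bounded B B-sym posDef M
    quad≤ : ∀ r → quad B (vec r) ≤ M
    quad≤ r = subst (_≤ M)
      (trans (cong (D (typ r) *_) (sym (two r))) (trans (bform-co {D (typ r)} {co r} {vec r} (prop r) (vec r))
      (bform-quad (vec r))))
      (∑-term-≤ (λ k → D k * + 2) (λ k → 0≤⇒0≤* (ℤ.<⇒≤ (D-pos k)) (+≤+ ℕ.z≤n)) (typ r))

  ht-bound : ∃[ H ] ((r : Root) → ht (vec r) ≤ + H)
  ht-bound = L ℕ.* K , λ r → ℤ.≤-trans (i≤∣i∣ (ht (vec r))) (+≤+ (subst (λ t → ∣ t ∣ ℕ.≤ L ℕ.* K)
      (∑-cong (λ k → ℤ.*-comm 1ℤ (vec r k))) (∣∑∣≤ (λ _ → 1ℤ) (vec r) K (proj₂ root-bound r))))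
    where
    i≤∣i∣ : ∀ i → i ≤ + ∣ i ∣
    i≤∣i∣ (+ _)    = ℤ.≤-refl
    i≤∣i∣ -[1+ _ ] = ℤ.-≤+
    K = proj₁ root-bound
    L = ∣ sumℤ {n} (λ i → + 1) ∣

  -- Dominant roots and the highest root.

  Dominant : V → Set
  Dominant β = ∀ k → 0ℤ ≤ ⟨α^ k , β ⟩

  -- Reflecting in a simple root with negative pairing lowers no coordinate and raises the height by
  -- at least 1; at fuel 0 one more step would pass the height bound. The coordinatewise growth
  -- serves the comparison with θ, and the unchanged `typ` keeps a long root long.
  climb′ : ∀ fuel (r : Root) → Pos (vec r) → + proj₁ ht-bound ≤ ht (vec r) + + fuel →
           ∃[ w ] (Dominant (vec (actOn w r)) × (∀ k → vec r k ≤ vec (actOn w r) k) × typ (actOn w r) ≡ typ r)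
  climb′ fuel r p h with any? (λ k → ⟨α^ k , vec r ⟩ ℤ.<? 0ℤ)
  ... | no ¬neg = [] , (λ k → ℤ.≮⇒≥ (λ q → ¬neg (k , q))) , (λ k → ℤ.≤-refl) , refl
  ... | yes (k , c<0) = continue fuel h
    where
    r₁ = reflectRoot k r
    r≤r₁ : ∀ l → vec r l ≤ vec r₁ l
    r≤r₁ l = subst (vec r l ≤_) (sym (reflRoot-shift k (vec r) l))
      (subst (_≤ vec r l - ⟨α^ k , vec r ⟩ * α k l) (ℤ.+-identityʳ (vec r l)) (ℤ.+-monoʳ-≤ (vec r l) 0≤-cα))
      where
      0≤α : 0ℤ ≤ α k l
      0≤α with k Fin.≟ l
      ... | yes _ = +≤+ ℕ.z≤n
      ... | no _  = +≤+ ℕ.z≤n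
      0≤-cα : 0ℤ ≤ - (⟨α^ k , vec r ⟩ * α k l)
      0≤-cα = subst (0ℤ ≤_) (sym (ℤ.neg-distribˡ-* ⟨α^ k , vec r ⟩ (α k l))) (0≤⇒0≤* (ℤ.neg-mono-≤ (ℤ.<⇒≤ c<0)) 0≤α)
    p₁ : Pos (vec r₁)
    p₁ l = ℤ.≤-trans (p l) (r≤r₁ l)
    ht₁ : ht (vec r) + 1ℤ ≤ ht (vec r₁)
    ht₁ = subst (ht (vec r) + 1ℤ ≤_) (sym (ht-reflRoot k (vec r)))
      (ℤ.+-monoʳ-≤ (ht (vec r)) (ℤ.i<j⇒suc[i]≤j (ℤ.neg-mono-< c<0)))
    continue : ∀ fuel → + proj₁ ht-bound ≤ ht (vec r) + + fuel → _
    continue zero h = ⊥-elim (ℤ.<-irrefl refl (ℤ.<-≤-trans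
      (ℤ.≤-<-trans (subst (+ proj₁ ht-bound ≤_) (ℤ.+-identityʳ (ht (vec r))) h)
        (subst (_< ht (vec r) + 1ℤ) (ℤ.+-identityʳ (ht (vec r))) (ℤ.+-monoʳ-< (ht (vec r)) (+<+ (ℕ.s≤s ℕ.z≤n)))))
      (ℤ.≤-trans ht₁ (proj₂ ht-bound r₁))))
    continue (suc fuel) h with climb′ fuel r₁ p₁ (ℤ.≤-trans h
        (subst (_≤ ht (vec r₁) + + fuel) (ℤ.+-assoc (ht (vec r)) 1ℤ (+ fuel)) (ℤ.+-monoˡ-≤ (+ fuel) ht₁)))
    ... | w , dom , ≤w , t = k ∷ w , dom , (λ l → ℤ.≤-trans (r≤r₁ l) (≤w l)) , t

  climb : (r : Root) → Pos (vec r) →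
          ∃[ w ] (Dominant (vec (actOn w r)) × (∀ k → vec r k ≤ vec (actOn w r) k) × typ (actOn w r) ≡ typ r)
  climb r p = climb′ (proj₁ ht-bound) r p
    (subst (_≤ ht (vec r) + + proj₁ ht-bound) (ℤ.+-identityˡ _) (ℤ.+-monoˡ-≤ (+ proj₁ ht-bound) (ht-nonneg p)))

  zeros : V → Subset n
  zeros β = Vec.tabulate (λ k → does (β k ℤ.≟ 0ℤ))

  ∈zeros⇒≡0 : ∀ β {k} → k ∈ zeros β → β k ≡ 0ℤ
  ∈zeros⇒≡0 β {k} m
    with β k ℤ.≟ 0ℤ | trans (sym (Vec.lookup∘tabulate (λ k → does (β k ℤ.≟ 0ℤ)) k)) (Vec.[]=⇒lookup m)
  ... | yes e | _ = e
  ... | no _  | ()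

  ≡0⇒∈zeros : ∀ β {k} → β k ≡ 0ℤ → k ∈ zeros β
  ≡0⇒∈zeros β {k} e = Vec.lookup⇒[]= k (zeros β)
    (trans (Vec.lookup∘tabulate (λ k → does (β k ℤ.≟ 0ℤ)) k) (dec-true (β k ℤ.≟ 0ℤ) e))

  opaque
    unfolding ⟨_,_⟩

    -- If r vanishes at i, dominance at i is a sum of nonpositive terms.
    zeros-closed : (r : Root) → Pos (vec r) → Dominant (vec r) →
                   ∀ i j → i ∈ zeros (vec r) → j ∉ zeros (vec r) → C i j ≡ 0ℤ
    zeros-closed r p dom i j i∈S j∉S = *-cancelˡ-0< rj>0 (trans term≡0 (sym (ℤ.*-zeroʳ (vec r j))))
      where
      rj>0 : 0ℤ < vec r j
      rj>0 = ℤ.≤∧≢⇒< (p j) (λ e → j∉S (≡0⇒∈zeros (vec r) (sym e)))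
      term≤0 : ∀ l → vec r l * C i l ≤ 0ℤ
      term≤0 l with i Fin.≟ l
      ... | yes refl = ℤ.≤-reflexive (trans (cong (_* C i i) (∈zeros⇒≡0 (vec r) i∈S)) (ℤ.*-zeroˡ (C i i)))
      ... | no i≢l   = nonneg*nonpos (p l) (offdiag i l i≢l)
      negated-sum≤0 : sumℤ (λ l → - (vec r l * C i l)) ≤ 0ℤ
      negated-sum≤0 = subst (_≤ 0ℤ) (sym (trans (∑-cong (λ l → ℤ.neg-distribˡ-* (vec r l) (C i l))) (∑-neg (vec r)
          (C i))))
        (ℤ.neg-mono-≤ (dom i))
      term≡0 : vec r j * C i j ≡ 0ℤ
      term≡0 = ℤ.≤-antisym (term≤0 j) (subst (0ℤ ≤_) (ℤ.neg-involutive _) (ℤ.neg-mono-≤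
        (ℤ.≤-trans (∑-term-≤ _ (λ l → ℤ.neg-mono-≤ (term≤0 l)) j) negated-sum≤0)))

  -- Irreducibility, applied to the set of zero coordinates: it is everything or nothing, and a root
  -- is nonzero.
  dominant-full-support : (r : Root) → Pos (vec r) → Dominant (vec r) → ∀ k → 0ℤ < vec r k
  dominant-full-support r p dom k with irreducible (zeros (vec r)) (zeros-closed r p dom)
  ... | inj₁ all-zero  = ⊥-elim (root-nonzero r (λ l → ∈zeros⇒≡0 (vec r) (all-zero l)))
  ... | inj₂ none-zero = ℤ.≤∧≢⇒< (p k) (λ e → none-zero k (≡0⇒∈zeros (vec r) (sym e)))

  dominant-co : (θ : Root) → Dominant (vec θ) → ∀ l → 0ℤ ≤ ⟨ co θ ,α l ⟩
  dominant-co θ dom l = 0≤*⇒0≤ (D-pos (typ θ)) (subst (0ℤ ≤_) (sym (begin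
      D (typ θ) * ⟨ co θ ,α l ⟩      ≡⟨ cong (D (typ θ) *_) (sym (⟨⟩-αʳ (co θ) l)) ⟩
      D (typ θ) * ⟨ co θ , α l ⟩     ≡⟨ bform-reflection θ (simpleRoot l) ⟩
      D l * ⟨ α l , vec θ ⟩          ≡⟨ cong (D l *_) (⟨⟩-αˡ l (vec θ)) ⟩
      D l * ⟨α^ l , vec θ ⟩          ∎)) (0≤⇒0≤* (ℤ.<⇒≤ (D-pos l)) (dom l)))

  dominant-pairing : (θ : Root) → Dominant (vec θ) → ∀ {β} → Pos β → 0ℤ ≤ ⟨ co θ , β ⟩
  dominant-pairing θ dom {β} p = subst (0ℤ ≤_) (sym (⟨⟩-transpose (co θ) β))
    (∑-nonneg _ (λ l → 0≤⇒0≤* (p l) (dominant-co θ dom l)))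

  -- If the sum of the nonnegative terms γ_l ⟨θ^∨,α_l⟩ vanished, θ^∨ would pair to 0 with every
  -- simple root, against ⟨θ^∨,θ⟩ = 2.
  dominant-pairing-pos : (θ γ : Root) → Dominant (vec θ) → (∀ k → 0ℤ < vec γ k) → 0ℤ < ⟨ co θ , vec γ ⟩
  dominant-pairing-pos θ γ dom p = ℤ.≤∧≢⇒< (dominant-pairing θ dom (λ k → ℤ.<⇒≤ (p k))) λ e →
      contra (trans (sym (two θ)) (trans (⟨⟩-transpose (co θ) (vec θ))
        (Σℤ.∑-zero (λ l → trans (cong (vec θ l *_) (co≡0 (sym e) l)) (ℤ.*-zeroʳ (vec θ l))))))
    where
    contra : ¬ (+ 2 ≡ 0ℤ)
    contra ()
    co≡0 : ⟨ co θ , vec γ ⟩ ≡ 0ℤ → ∀ l → ⟨ co θ ,α l ⟩ ≡ 0ℤ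
    co≡0 e l = *-cancelˡ-0< (p l) (trans (ℤ.≤-antisym
        (subst (vec γ l * ⟨ co θ ,α l ⟩ ≤_) (trans (sym (⟨⟩-transpose (co θ) (vec γ))) e)
          (∑-term-≤ (λ l → vec γ l * ⟨ co θ ,α l ⟩) (λ l → 0≤⇒0≤* (ℤ.<⇒≤ (p l)) (dominant-co θ dom l)) l))
        (0≤⇒0≤* (ℤ.<⇒≤ (p l)) (dominant-co θ dom l)))
      (sym (ℤ.*-zeroʳ (vec γ l))))

  opaque
    unfolding bform

    bform-shiftˡ : ∀ x c y z → bform (shift x c y) z ≡ bform x z - c * bform y z
    bform-shiftˡ x c y z = trans (∑-cong (λ k → alg₁ (D k) (shift x c y k) ⟨α^ k , z ⟩))
      (trans (∑-shift x c y (λ k → D k * ⟨α^ k , z ⟩))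
        (sym (cong₂ (λ s t → s - c * t) (∑-cong (λ k → alg₁ (D k) (x k) ⟨α^ k , z ⟩)) (∑-cong (λ k → alg₁ (D k)
        (y k) ⟨α^ k , z ⟩)))))
      where
      alg₁ : ∀ d x z → d * x * z ≡ x * (d * z)
      alg₁ = solve-∀

  norm-difference : (θ γ : Root) → bform (shift (vec θ) 1ℤ (vec γ)) (shift (vec θ) 1ℤ (vec γ))
                    ≡ + 2 * D (typ θ) + + 2 * D (typ γ) - + 2 * (D (typ θ) * ⟨ co θ , vec γ ⟩)
  norm-difference θ γ = begin
    bform δ δ
      ≡⟨ bform-shiftˡ (vec θ) 1ℤ (vec γ) δ ⟩
    bform (vec θ) δ - 1ℤ * bform (vec γ) δ
      ≡⟨ sym (cong₂ (λ s t → s - 1ℤ * t) (bform-co {D (typ θ)} {co θ} {vec θ} (prop θ) δ) (bform-co {D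
          (typ γ)} {co γ} {vec γ} (prop γ) δ)) ⟩
    Dθ * ⟨ co θ , δ ⟩ - 1ℤ * (Dγ * ⟨ co γ , δ ⟩)
      ≡⟨ cong₂ (λ s t → Dθ * s - 1ℤ * (Dγ * t)) (⟨⟩-shiftʳ (co θ) (vec θ) 1ℤ (vec γ)) (⟨⟩-shiftʳ (co γ) (vec θ) 1ℤ
          (vec γ)) ⟩
    Dθ * (⟨ co θ , vec θ ⟩ - 1ℤ * q) - 1ℤ * (Dγ * (⟨ co γ , vec θ ⟩ - 1ℤ * ⟨ co γ , vec γ ⟩))
      ≡⟨ cong₂ (λ s t → Dθ * (s - 1ℤ * q) - 1ℤ * (Dγ * (⟨ co γ , vec θ ⟩ - 1ℤ * t))) (two θ) (two γ) ⟩
    Dθ * (+ 2 - 1ℤ * q) - 1ℤ * (Dγ * (⟨ co γ , vec θ ⟩ - 1ℤ * + 2))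
      ≡⟨ alg₁ Dθ q Dγ ⟨ co γ , vec θ ⟩ ⟩
    + 2 * Dθ + + 2 * Dγ - Dθ * q - Dγ * ⟨ co γ , vec θ ⟩
      ≡⟨ cong (λ t → + 2 * Dθ + + 2 * Dγ - Dθ * q - t) (bform-reflection γ θ) ⟩
    + 2 * Dθ + + 2 * Dγ - Dθ * q - Dθ * q
      ≡⟨ alg₂ (+ 2 * Dθ + + 2 * Dγ) (Dθ * q) ⟩
    + 2 * Dθ + + 2 * Dγ - + 2 * (Dθ * q) ∎
    where
    δ = shift (vec θ) 1ℤ (vec γ)
    Dθ = D (typ θ)
    Dγ = D (typ γ)
    q = ⟨ co θ , vec γ ⟩
    alg₁ : ∀ a q b p → a * (+ 2 - 1ℤ * q) - 1ℤ * (b * (p - 1ℤ * + 2)) ≡ + 2 * a + + 2 * b - a * q - b * p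
    alg₁ = solve-∀
    alg₂ : ∀ x y → x - y - y ≡ x - + 2 * y
    alg₂ = solve-∀

  -- With q = ⟨θ^∨,γ⟩ the squared length of θ - γ is 2 Dθ + 2 Dγ - 2 Dθ q ≤ 2 (Dγ - Dθ) ≤ 0, so
  -- positive definiteness makes the difference zero.
  long-pairing-≥2⇒equal : (θ γ : Root) → D (typ γ) ≤ D (typ θ) → + 2 ≤ ⟨ co θ , vec γ ⟩ → vec γ ≗ vec θ
  long-pairing-≥2⇒equal θ γ Dγ≤Dθ 2≤q with zero? (shift (vec θ) 1ℤ (vec γ))
  ... | inj₂ δ≡0 = λ k → begin
        vec γ k                                  ≡⟨ alg (vec θ k) (vec γ k) ⟩
        vec θ k - (vec θ k - 1ℤ * vec γ k)        ≡⟨ cong (λ t → vec θ k - t) (δ≡0 k) ⟩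
        vec θ k - 0ℤ                             ≡⟨ ℤ.+-identityʳ (vec θ k) ⟩
        vec θ k                                  ∎
    where
    alg : ∀ x y → y ≡ x - (x - 1ℤ * y)
    alg = solve-∀
  ... | inj₁ δ≢0 = ⊥-elim (ℤ.<-irrefl refl (ℤ.<-≤-trans (posDef δ δ≢0) norm≤0))
    where
    δ = shift (vec θ) 1ℤ (vec γ)
    Dθ = D (typ θ)
    Dγ = D (typ γ)
    q = ⟨ co θ , vec γ ⟩
    alg : ∀ a b q → + 0 - (+ 2 * a + + 2 * b - + 2 * (a * q)) ≡ + 2 * (a * (q - + 2) + (a - b))
    alg = solve-∀
    0≤ : 0ℤ ≤ 0ℤ - (+ 2 * Dθ + + 2 * Dγ - + 2 * (Dθ * q))
    0≤ = subst (0ℤ ≤_) (sym (alg Dθ Dγ q)) (0≤⇒0≤* {+ 2} (+≤+ ℕ.z≤n)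
      (ℤ.+-mono-≤ (0≤⇒0≤* (ℤ.<⇒≤ (D-pos (typ θ))) (ℤ.i≤j⇒0≤j-i 2≤q)) (ℤ.i≤j⇒0≤j-i Dγ≤Dθ)))
    norm≤0 : quad (λ i j → C i j * D i) δ ≤ 0ℤ
    norm≤0 = subst (_≤ 0ℤ) (trans (sym (norm-difference θ γ)) (bform-quad δ)) (ℤ.0≤i-j⇒j≤i 0≤)

  α-pos : ∀ j → Pos (α j)
  α-pos j k with j Fin.≟ k
  ... | yes _ = +≤+ ℕ.z≤n
  ... | no _  = +≤+ ℕ.z≤n

  -- Climbing from a simple root with the largest D; the argument only witnesses that the rank is
  -- positive.
  long-dominant-root : Fin n →
    Σ[ θ ∈ Root ] (Pos (vec θ) × Dominant (vec θ) × (∀ (γ : Root) → D (typ γ) ≤ D (typ θ)))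
  long-dominant-root i₀ with argmax D i₀
  ... | i , D-max with climb (simpleRoot i) (α-pos i)
  ...   | w , dom , ≤w , t = actOn w (simpleRoot i) , (λ k → ℤ.≤-trans (α-pos i k) (≤w k)) , dom ,
          λ γ → subst (λ t → D (typ γ) ≤ D t) (sym t) (D-max (typ γ))

  module HighestRoot (θ : Root) (θ-pos : Pos (vec θ)) (θ-dominant : Dominant (vec θ))
                     (θ-long : ∀ (γ : Root) → D (typ γ) ≤ D (typ θ)) where

    θ-word : Reflects (λ _ → ⊤) θ
    θ-word = reflection-word θ (λ _ _ → tt)

    θ-reflect : Root → Root
    θ-reflect = reflectBy θ (proj₁ θ-word) (proj₂ (proj₂ θ-word))

    ⟨θ^,θ-reflect⟩ : ∀ γ → ⟨ co θ , vec (θ-reflect γ) ⟩ ≡ - ⟨ co θ , vec γ ⟩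
    ⟨θ^,θ-reflect⟩ γ = trans (⟨⟩-shiftʳ (co θ) (vec γ) ⟨ co θ , vec γ ⟩ (vec θ))
      (trans (cong (λ t → ⟨ co θ , vec γ ⟩ - ⟨ co θ , vec γ ⟩ * t) (two θ)) (alg ⟨ co θ , vec γ ⟩))
      where
      alg : ∀ x → x - x * + 2 ≡ - x
      alg = solve-∀

    -- Full support of γ makes the pairing with θ^∨ at least 1, and a value of 2 or more forces γ =
    -- θ because θ is long.
    dominant-cases : (γ : Root) → Pos (vec γ) → Dominant (vec γ) → (⟨ co θ , vec γ ⟩ ≡ 1ℤ) ⊎ (vec γ ≗ vec θ)
    dominant-cases γ p dom with ⟨ co θ , vec γ ⟩ ℤ.≟ 1ℤ
    ... | yes q≡1 = inj₁ q≡1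
    ... | no q≢1  = inj₂ (long-pairing-≥2⇒equal θ γ (θ-long γ) (ℤ.i<j⇒suc[i]≤j {1ℤ}
          (ℤ.≤∧≢⇒< (ℤ.i<j⇒suc[i]≤j (dominant-pairing-pos θ γ θ-dominant (dominant-full-support γ p dom)))
          (λ e → q≢1 (sym e)))))

    -- When the pairing is 1, the reflection of γ in θ is the root γ - θ, which pairs to -1 with
    -- θ^∨. A dominant coroot pairs nonnegatively with positive roots, so γ - θ is negative.
    dominant≤θ : (γ : Root) → Pos (vec γ) → Dominant (vec γ) → ∀ k → vec γ k ≤ vec θ k
    dominant≤θ γ p dom k with dominant-cases γ p dom
    ... | inj₂ e = ℤ.≤-reflexive (e k)
    ... | inj₁ q≡1 with root-sign (θ-reflect γ)
    ...   | inj₂ neg-refl = ℤ.i-j≤0⇒i≤j (subst (_≤ 0ℤ)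
            (trans (cong (λ t → vec γ k - t * vec θ k) q≡1) (cong (λ t → vec γ k - t) (ℤ.*-identityˡ (vec θ k))))
            (neg-refl k))
    ...   | inj₁ pos-refl with subst (0ℤ ≤_) (trans (⟨θ^,θ-reflect⟩ γ) (cong -_ q≡1))
        (dominant-pairing θ θ-dominant pos-refl)
    ...     | ()

    root≤θ : (r : Root) → ∀ k → vec r k ≤ vec θ k
    root≤θ r k with root-sign r
    ... | inj₂ q = ℤ.≤-trans (q k) (θ-pos k)
    ... | inj₁ p with climb r p
    ...   | w , dom , ≤w , _ = ℤ.≤-trans (≤w k)
            (dominant≤θ (actOn w r) (λ l → ℤ.≤-trans (p l) (≤w l)) dom k)

-- Rational arithmetic and the passage to integral Cartan data.

module Σℚ = Summation ℚ.+-*-isCommutativeRing sumℚ (λ _ → refl) (λ _ → refl)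

ringℚ : AlmostCommutativeRing 0ℓ 0ℓ
ringℚ = fromCommutativeRing ℚ.+-*-commutativeRing (λ q → dec⇒maybe (0ℚ ℚ.≟ q))

toℚᵘ-ι : ∀ a → ℚ.toℚᵘ (ι a) ℚᵘ.≃ mkℚᵘ a 0
toℚᵘ-ι a = ℚ.toℚᵘ-fromℚᵘ (mkℚᵘ a 0)

opaque
  ι-+ : ∀ a b → ι (a + b) ≡ ι a ℚ.+ ι b
  ι-+ a b = ℚ.toℚᵘ-injective (begin
    ℚ.toℚᵘ (ι (a + b))                        ≈⟨ toℚᵘ-ι (a + b) ⟩
    mkℚᵘ (a + b) 0                              ≈⟨ *≡* (alg a b) ⟩
    mkℚᵘ a 0 ℚᵘ.+ mkℚᵘ b 0                      ≈⟨ ℚᵘ.≃-sym (ℚᵘ.+-cong (toℚᵘ-ι a) (toℚᵘ-ι b)) ⟩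
    ℚ.toℚᵘ (ι a) ℚᵘ.+ ℚ.toℚᵘ (ι b)          ≈⟨ ℚᵘ.≃-sym (ℚ.toℚᵘ-homo-+ (ι a) (ι b)) ⟩
    ℚ.toℚᵘ (ι a ℚ.+ ι b)                    ∎)
    where
    open ℚᵘ.≃-Reasoning
    alg : ∀ a b → (a + b) * + 1 ≡ (a * + 1 + b * + 1) * + 1
    alg = solve-∀

  ι-* : ∀ a b → ι (a * b) ≡ ι a ℚ.* ι b
  ι-* a b = ℚ.toℚᵘ-injective (begin
    ℚ.toℚᵘ (ι (a * b))                        ≈⟨ toℚᵘ-ι (a * b) ⟩
    mkℚᵘ (a * b) 0                              ≈⟨ *≡* refl ⟩
    mkℚᵘ a 0 ℚᵘ.* mkℚᵘ b 0                      ≈⟨ ℚᵘ.≃-sym (ℚᵘ.*-cong (toℚᵘ-ι a) (toℚᵘ-ι b)) ⟩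
    ℚ.toℚᵘ (ι a) ℚᵘ.* ℚ.toℚᵘ (ι b)          ≈⟨ ℚᵘ.≃-sym (ℚ.toℚᵘ-homo-* (ι a) (ι b)) ⟩
    ℚ.toℚᵘ (ι a ℚ.* ι b)                    ∎)
    where open ℚᵘ.≃-Reasoning

  ι-neg : ∀ a → ι (- a) ≡ ℚ.- ι a
  ι-neg a = ℚ.toℚᵘ-injective (begin
    ℚ.toℚᵘ (ι (- a))      ≈⟨ toℚᵘ-ι (- a) ⟩
    ℚᵘ.- mkℚᵘ a 0           ≈⟨ ℚᵘ.≃-sym (ℚᵘ.-‿cong (toℚᵘ-ι a)) ⟩
    ℚᵘ.- ℚ.toℚᵘ (ι a)     ≈⟨ ℚᵘ.≃-sym (ℚ.toℚᵘ-homo‿- (ι a)) ⟩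
    ℚ.toℚᵘ (ℚ.- ι a)      ∎)
    where open ℚᵘ.≃-Reasoning

  ι-mono-< : ∀ {a b} → a < b → ι a ℚ.< ι b
  ι-mono-< {a} {b} p = ℚ.toℚᵘ-cancel-< (ℚᵘ.<-respˡ-≃ (ℚᵘ.≃-sym (toℚᵘ-ι a)) (ℚᵘ.<-respʳ-≃ (ℚᵘ.≃-sym (toℚᵘ-ι b))
    (*<* (subst₂ _<_ (sym (ℤ.*-identityʳ a)) (sym (ℤ.*-identityʳ b)) p))))

  ι-cancel-< : ∀ {a b} → ι a ℚ.< ι b → a < b
  ι-cancel-< {a} {b} p with ℤ.<-cmp a b
  ... | tri< a<b _ _ = a<b
  ... | tri≈ _ refl _ = ⊥-elim (ℚ.<-irrefl refl p)
  ... | tri> _ _ b<a  = ⊥-elim (ℚ.<-asym p (ι-mono-< b<a))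

  ι-injective : ∀ {a b} → ι a ≡ ι b → a ≡ b
  ι-injective {a} {b} e with ℤ.<-cmp a b
  ... | tri< a<b _ _ = ⊥-elim (ℚ.<-irrefl e (ι-mono-< a<b))
  ... | tri≈ _ a≡b _ = a≡b
  ... | tri> _ _ b<a = ⊥-elim (ℚ.<-irrefl (sym e) (ι-mono-< b<a))

  ι-denominator : ∀ q → ι (↥ q) ≡ q ℚ.* ι (↧ q)
  ι-denominator q@(ℚ.mkℚ a d-1 _) = ℚ.toℚᵘ-injective (begin
    ℚ.toℚᵘ (ι (↥ q))                  ≈⟨ toℚᵘ-ι (↥ q) ⟩
    mkℚᵘ (↥ q) 0                        ≈⟨ *≡* (trans (cong (λ t → a * + t) (ℕ.*-identityʳ (suc d-1))) (sym
        (ℤ.*-identityʳ (a * + suc d-1)))) ⟩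
    ℚ.toℚᵘ q ℚᵘ.* mkℚᵘ (↧ q) 0          ≈⟨ ℚᵘ.≃-sym (ℚᵘ.*-cong (ℚᵘ.≃-refl {ℚ.toℚᵘ q}) (toℚᵘ-ι (↧ q))) ⟩
    ℚ.toℚᵘ q ℚᵘ.* ℚ.toℚᵘ (ι (↧ q))    ≈⟨ ℚᵘ.≃-sym (ℚ.toℚᵘ-homo-* q (ι (↧ q))) ⟩
    ℚ.toℚᵘ (q ℚ.* ι (↧ q))            ∎)
    where
    open ℚᵘ.≃-Reasoning

  ι-sum : ∀ {n} (f : Fin n → ℤ) → ι (sumℤ f) ≡ sumℚ (λ i → ι (f i))
  ι-sum {zero}  f = refl
  ι-sum {suc n} f = trans (ι-+ (f zero) _) (cong (ι (f zero) ℚ.+_) (ι-sum (f ∘ suc)))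

common-denominator : ∀ {n} (f : Fin n → ℚ) →
  Σ[ M ∈ ℤ ] Σ[ D ∈ (Fin n → ℤ) ] (0ℤ < M × (∀ k → ι (D k) ≡ f k ℚ.* ι M))
common-denominator {zero}  f = 1ℤ , (λ ()) , +<+ (ℕ.s≤s ℕ.z≤n) , λ ()
common-denominator {suc n} f with common-denominator (f ∘ suc)
... | M , D , M>0 , e = ↧ f zero * M , D′ , 0<⇒0<* {↧ f zero} (+<+ (ℕ.s≤s ℕ.z≤n)) M>0 , e′
  where
  D′ : Fin (suc n) → ℤ
  D′ zero    = ↥ f zero * M
  D′ (suc k) = ↧ f zero * D k
  alg₁ : ∀ x y z → x ℚ.* y ℚ.* z ≡ x ℚ.* (y ℚ.* z)
  alg₁ = solve-∀-in ringℚ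
  alg₂ : ∀ x y z → x ℚ.* (y ℚ.* z) ≡ y ℚ.* (x ℚ.* z)
  alg₂ = solve-∀-in ringℚ
  open ≡-Reasoning
  e′ : ∀ k → ι (D′ k) ≡ f k ℚ.* ι (↧ f zero * M)
  e′ zero = begin
    ι (↥ f zero * M)                            ≡⟨ ι-* (↥ f zero) M ⟩
    ι (↥ f zero) ℚ.* ι M                      ≡⟨ cong (ℚ._* ι M) (ι-denominator (f zero)) ⟩
    f zero ℚ.* ι (↧ f zero) ℚ.* ι M           ≡⟨ alg₁ (f zero) (ι (↧ f zero)) (ι M) ⟩
    f zero ℚ.* (ι (↧ f zero) ℚ.* ι M)         ≡⟨ cong (f zero ℚ.*_) (sym (ι-* (↧ f zero) M)) ⟩
    f zero ℚ.* ι (↧ f zero * M)                 ∎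
  e′ (suc k) = begin
    ι (↧ f zero * D k)                          ≡⟨ ι-* (↧ f zero) (D k) ⟩
    ι (↧ f zero) ℚ.* ι (D k)                  ≡⟨ cong (ι (↧ f zero) ℚ.*_) (e k) ⟩
    ι (↧ f zero) ℚ.* (f (suc k) ℚ.* ι M)      ≡⟨ alg₂ (ι (↧ f zero)) (f (suc k)) (ι M) ⟩
    f (suc k) ℚ.* (ι (↧ f zero) ℚ.* ι M)      ≡⟨ cong (f (suc k) ℚ.*_) (sym (ι-* (↧ f zero) M)) ⟩
    f (suc k) ℚ.* ι (↧ f zero * M)              ∎

0<q*ι : ∀ {q M} → 0ℚ ℚ.< q → 0ℤ < M → 0ℚ ℚ.< q ℚ.* ι M
0<q*ι {q} {M} q>0 M>0 = ℚ.positive⁻¹ _ {{ℚ.pos*pos⇒pos q {{ℚ.positive q>0}} (ι M) {{ℚ.positive (ι-mono-< M>0)}}}}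

integralCartan : ∀ {n} {C : CartanMatrix n} → IsFiniteIrreducibleCartan C → IntegralCartan C
integralCartan {n} {C} ifc with common-denominator (IsFiniteIrreducibleCartan.d ifc)
... | M , D , M>0 , D≡dM = record
  { diag = diag ; offdiag = offdiag ; D = D
  ; D-pos = λ i → ι-cancel-< {0ℤ} (subst (0ℚ ℚ.<_) (sym (D≡dM i)) (0<q*ι (d-pos i) M>0))
  ; D-sym = λ i j → ι-injective (begin
      ι (D i * C i j)                       ≡⟨ DC i j ⟩
      ι (C i j) ℚ.* d i ℚ.* ι M           ≡⟨ cong (ℚ._* ι M) (d-sym i j) ⟩
      ι (C j i) ℚ.* d j ℚ.* ι M           ≡⟨ sym (DC j i) ⟩
      ι (D j * C j i)                       ∎)
  ; posDef = λ x (i , xi≢0) → ι-cancel-< {0ℤ} (subst (0ℚ ℚ.<_) (sym (form x))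
      (0<q*ι (posdef (λ i → ι (x i)) (i , λ e → xi≢0 (ι-injective e))) M>0))
  ; irreducible = irreducible }
  where
  open IsFiniteIrreducibleCartan ifc
  open ≡-Reasoning
  alg₁ : ∀ d m c → d ℚ.* m ℚ.* c ≡ c ℚ.* d ℚ.* m
  alg₁ = solve-∀-in ringℚ
  alg₂ : ∀ x y c d m → x ℚ.* y ℚ.* (c ℚ.* (d ℚ.* m)) ≡ m ℚ.* (x ℚ.* y ℚ.* c ℚ.* d)
  alg₂ = solve-∀-in ringℚ
  DC : ∀ i j → ι (D i * C i j) ≡ ι (C i j) ℚ.* d i ℚ.* ι M
  DC i j = trans (ι-* (D i) (C i j)) (trans (cong (ℚ._* ι (C i j)) (D≡dM i)) (alg₁ (d i) (ι M) (ι (C i j))))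
  term : ∀ (x : Fin n → ℤ) i j → ι (x i * x j * (C i j * D i))
         ≡ ι M ℚ.* (ι (x i) ℚ.* ι (x j) ℚ.* ι (C i j) ℚ.* d i)
  term x i j = begin
    ι (x i * x j * (C i j * D i))
      ≡⟨ ι-* (x i * x j) (C i j * D i) ⟩
    ι (x i * x j) ℚ.* ι (C i j * D i)
      ≡⟨ cong₂ ℚ._*_ (ι-* (x i) (x j)) (ι-* (C i j) (D i)) ⟩
    ι (x i) ℚ.* ι (x j) ℚ.* (ι (C i j) ℚ.* ι (D i))
      ≡⟨ cong (λ t → ι (x i) ℚ.* ι (x j) ℚ.* (ι (C i j) ℚ.* t)) (D≡dM i) ⟩
    ι (x i) ℚ.* ι (x j) ℚ.* (ι (C i j) ℚ.* (d i ℚ.* ι M))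
      ≡⟨ alg₂ (ι (x i)) (ι (x j)) (ι (C i j)) (d i) (ι M) ⟩
    ι M ℚ.* (ι (x i) ℚ.* ι (x j) ℚ.* ι (C i j) ℚ.* d i) ∎
  q : (Fin n → ℤ) → Fin n → Fin n → ℚ
  q x i j = ι (x i) ℚ.* ι (x j) ℚ.* ι (C i j) ℚ.* d i
  form : ∀ x → ι (quad (λ i j → C i j * D i) x) ≡ sumℚ (λ i → sumℚ (λ j → q x i j)) ℚ.* ι M
  form x = begin
    ι (quad (λ i j → C i j * D i) x)
      ≡⟨ ι-sum {n} (λ i → sumℤ (λ j → x i * x j * (C i j * D i))) ⟩
    sumℚ (λ i → ι (sumℤ (λ j → x i * x j * (C i j * D i))))
      ≡⟨ Σℚ.∑-cong (λ i → trans (ι-sum {n} _) (trans (Σℚ.∑-cong (λ j → term x i j)) (Σℚ.∑-distribˡ-* {n} (ι M)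
          (q x i)))) ⟩
    sumℚ (λ i → ι M ℚ.* sumℚ (λ j → q x i j))
      ≡⟨ Σℚ.∑-distribˡ-* {n} (ι M) _ ⟩
    ι M ℚ.* sumℚ (λ i → sumℚ (λ j → q x i j))
      ≡⟨ ℚ.*-comm (ι M) _ ⟩
    sumℚ (λ i → sumℚ (λ j → q x i j)) ℚ.* ι M ∎

InUnit : ℚ → Set
InUnit q = (0ℚ ℚ.< q) × (q ℚ.< 1ℚ)

-- Two points of the open unit interval differ by less than 1. All integral data of an alcove are
-- extracted through this fact.
unit-shift-integer : ∀ {q} k → InUnit q → InUnit (q ℚ.+ ι k) → k ≡ 0ℤ
unit-shift-integer {q} k (0<q , q<1) (0<q+k , q+k<1) = ℤ.≤-antisym
    (ℤ.i<j⇒i≤pred[j] {k} {1ℤ} (ι-cancel-< (subst₂ ℚ._<_ (alg₁ q (ι k)) refl (ℚ.+-mono-< q+k<1 (ℚ.neg-antimono-< 0<q)))))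
    (subst (0ℤ ≤_) (alg k) (ℤ.i<j⇒i≤pred[j] (ι-cancel-< {0ℤ} {1ℤ + k} (subst (0ℚ ℚ.<_)
      (trans (alg₂ q (ι k) 1ℚ) (sym (ι-+ 1ℤ k))) (ℚ.+-mono-< 0<q+k 0<1-q)))))
  where
  alg : ∀ k → - 1ℤ + (1ℤ + k) ≡ k
  alg = solve-∀
  alg₁ : ∀ q k → q ℚ.+ k ℚ.+ ℚ.- q ≡ k
  alg₁ = solve-∀-in ringℚ
  alg₂ : ∀ q k o → q ℚ.+ k ℚ.+ (o ℚ.+ ℚ.- q) ≡ o ℚ.+ k
  alg₂ = solve-∀-in ringℚ
  0<1-q : 0ℚ ℚ.< 1ℚ ℚ.+ ℚ.- q
  0<1-q = subst₂ ℚ._<_ (ℚ.+-inverseʳ q) refl (ℚ.+-monoˡ-< (ℚ.- q) q<1)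

unit-reflect : ∀ {q} → InUnit q → InUnit (ℚ.- q ℚ.+ 1ℚ)
unit-reflect {q} (0<q , q<1) =
  subst₂ ℚ._<_ (ℚ.+-inverseˡ q) refl (ℚ.+-monoʳ-< (ℚ.- q) q<1) ,
  subst (ℚ.- q ℚ.+ 1ℚ ℚ.<_) (ℚ.+-identityˡ 1ℚ) (ℚ.+-monoˡ-< 1ℚ (ℚ.neg-antimono-< 0<q))

∑ℚ-nonneg : ∀ {n} (f : Fin n → ℚ) → (∀ i → 0ℚ ℚ.≤ f i) → 0ℚ ℚ.≤ sumℚ f
∑ℚ-nonneg {zero}  f p = ℚ.≤-refl
∑ℚ-nonneg {suc n} f p = ℚ.+-mono-≤ (p zero) (∑ℚ-nonneg (f ∘ suc) (p ∘ suc))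

opaque
  unit-fraction : ∀ m → ∃[ ε ] (0ℚ ℚ.< ε × ι (+ suc m) ℚ.* ε ≡ 1ℚ)
  unit-fraction m = ε , ℚ.positive⁻¹ ε {{ℚ.1/pos⇒pos q {{q>0}}}} , ℚ.*-inverseʳ q {{ℚ.pos⇒nonZero q {{q>0}}}}
    where
    q : ℚ
    q = ι (+ suc m)
    q>0 : ℚ.Positive q
    q>0 = ℚ.positive (ι-mono-< {0ℤ} {+ suc m} (+<+ (ℕ.s≤s ℕ.z≤n)))
    ε : ℚ
    ε = (ℚ.1/ q) {{ℚ.pos⇒nonZero q {{q>0}}}}

-- The affine Weyl group acting on points, seen through pairings.

module AffineAction {n : ℕ} (C : CartanMatrix n) (IC : IntegralCartan C) where

  open IntegralCartan IC
  open RootSystem C IC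
  open WeylGroup C IC
  open ≡-Reasoning

  private
    ∑ℚ-cong = Σℚ.∑-cong {n}
    ∑ℚ-distrib-+ = Σℚ.∑-distrib-+ {n}
    ∑ℚ-distribˡ-* = Σℚ.∑-distribˡ-* {n}

  P : Set
  P = Fin n → ℚ

  pair-cong : ∀ {x y β γ} → x ≗ y → β ≗ γ → pair C x β ≡ pair C y γ
  pair-cong e f = ∑ℚ-cong (λ i → cong₂ ℚ._*_ (cong ι (f i)) (e i))

  pair-shift : ∀ x β c η → pair C x (shift β c η) ≡ pair C x β ℚ.- ι c ℚ.* pair C x η
  pair-shift x β c η = begin
    pair C x (shift β c η)
      ≡⟨ ∑ℚ-cong (λ i → trans (cong (ℚ._* x i) (ι-shift i)) (alg (ι (β i)) (ι c) (ι (η i)) (x i))) ⟩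
    sumℚ (λ i → ι (β i) ℚ.* x i ℚ.+ (ℚ.- ι c) ℚ.* (ι (η i) ℚ.* x i))
      ≡⟨ ∑ℚ-distrib-+ (λ i → ι (β i) ℚ.* x i) (λ i → (ℚ.- ι c) ℚ.* (ι (η i) ℚ.* x i)) ⟩
    pair C x β ℚ.+ sumℚ (λ i → (ℚ.- ι c) ℚ.* (ι (η i) ℚ.* x i))
      ≡⟨ cong (λ t → pair C x β ℚ.+ t) (trans (∑ℚ-distribˡ-* (ℚ.- ι c) (λ i → ι (η i) ℚ.* x i))
           (sym (ℚ.neg-distribˡ-* (ι c) (pair C x η)))) ⟩
    pair C x β ℚ.- ι c ℚ.* pair C x η ∎
    where
    ι-shift : ∀ i → ι (β i - c * η i) ≡ ι (β i) ℚ.- ι c ℚ.* ι (η i)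
    ι-shift i = trans (ι-+ (β i) (- (c * η i))) (cong (ι (β i) ℚ.+_) (trans (ι-neg (c * η i)) (cong ℚ.-_ (ι-* c
        (η i)))))
    alg : ∀ b c e x → (b ℚ.- c ℚ.* e) ℚ.* x ≡ b ℚ.* x ℚ.+ (ℚ.- c) ℚ.* (e ℚ.* x)
    alg = solve-∀-in ringℚ

  pair-neg : ∀ x β → pair C x (neg β) ≡ ℚ.- pair C x β
  pair-neg x β = trans (pair-cong {x} (λ _ → refl) (neg≗shift β))
    (trans (pair-shift x β (+ 2) β) (trans (cong (λ t → pair C x β ℚ.- t ℚ.* pair C x β) (ι-+ 1ℤ 1ℤ)) (trans (alg
    (pair C x β) 1ℚ) step)))
    where
    alg : ∀ p o → p ℚ.- (o ℚ.+ o) ℚ.* p ≡ p ℚ.- o ℚ.* p ℚ.- o ℚ.* p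
    alg = solve-∀-in ringℚ
    alg₂ : ∀ p → p ℚ.- p ℚ.- p ≡ ℚ.- p
    alg₂ = solve-∀-in ringℚ
    step : pair C x β ℚ.- 1ℚ ℚ.* pair C x β ℚ.- 1ℚ ℚ.* pair C x β ≡ ℚ.- pair C x β
    step = trans (cong (λ t → pair C x β ℚ.- t ℚ.- t) (ℚ.*-identityˡ (pair C x β))) (alg₂ (pair C x β))

  ι-α-single : ∀ (f : P) j → sumℚ (λ k → ι (α j k) ℚ.* f k) ≡ f j
  ι-α-single f j = begin
    sumℚ (λ k → ι (α j k) ℚ.* f k)
      ≡⟨ Σℚ.∑-single {n} j _ (λ k j≢k → trans (cong (λ t → ι t ℚ.* f k) (α-offdiag j≢k)) (ℚ.*-zeroˡ (f k))) ⟩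
    ι (α j j) ℚ.* f j              ≡⟨ cong (λ t → ι t ℚ.* f j) (α-diag j) ⟩
    1ℚ ℚ.* f j                     ≡⟨ ℚ.*-identityˡ (f j) ⟩
    f j                            ∎

  pair-α : ∀ x j → pair C x (α j) ≡ x j
  pair-α x j = ι-α-single x j

  pair-ext : ∀ {x y} → (∀ β → pair C x β ≡ pair C y β) → x ≗ y
  pair-ext {x} {y} e i = trans (sym (pair-α x i)) (trans (e (α i)) (pair-α y i))

  opaque
    unfolding ⟨_,_⟩

    pair-refl-s : ∀ j x β → pair C (actGen C (refl-s j) x) β ≡ pair C x (reflRoot C j β)
    pair-refl-s j x β = begin
      pair C (actGen C (refl-s j) x) β
        ≡⟨ ∑ℚ-cong (λ k → alg (ι (β k)) (x k) (x j) (ι (C j k))) ⟩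
      sumℚ (λ k → ι (β k) ℚ.* x k ℚ.+ (ℚ.- x j) ℚ.* (ι (β k) ℚ.* ι (C j k)))
        ≡⟨ ∑ℚ-distrib-+ (λ k → ι (β k) ℚ.* x k) _ ⟩
      pair C x β ℚ.+ sumℚ (λ k → (ℚ.- x j) ℚ.* (ι (β k) ℚ.* ι (C j k)))
        ≡⟨ cong (pair C x β ℚ.+_) (trans (∑ℚ-distribˡ-* (ℚ.- x j) _)
             (cong ((ℚ.- x j) ℚ.*_) (trans (∑ℚ-cong (λ k → sym (ι-* (β k) (C j k)))) (sym (ι-sum
             (λ k → β k * C j k)))))) ⟩
      pair C x β ℚ.+ (ℚ.- x j) ℚ.* ι ⟨α^ j , β ⟩
        ≡⟨ cong (λ t → pair C x β ℚ.+ (ℚ.- t) ℚ.* ι ⟨α^ j , β ⟩) (sym (pair-α x j)) ⟩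
      pair C x β ℚ.+ (ℚ.- pair C x (α j)) ℚ.* ι ⟨α^ j , β ⟩
        ≡⟨ alg₂ (pair C x β) (pair C x (α j)) (ι ⟨α^ j , β ⟩) ⟩
      pair C x β ℚ.- ι ⟨α^ j , β ⟩ ℚ.* pair C x (α j)
        ≡⟨ sym (pair-shift x β ⟨α^ j , β ⟩ (α j)) ⟩
      pair C x (shift β ⟨α^ j , β ⟩ (α j))
        ≡⟨ pair-cong {x} (λ _ → refl) (λ k → sym (reflRoot-shift j β k)) ⟩
      pair C x (reflRoot C j β) ∎
      where
      alg : ∀ b xk xj c → b ℚ.* (xk ℚ.- xj ℚ.* c) ≡ b ℚ.* xk ℚ.+ (ℚ.- xj) ℚ.* (b ℚ.* c)
      alg = solve-∀-in ringℚ
      alg₂ : ∀ p a c → p ℚ.+ (ℚ.- a) ℚ.* c ≡ p ℚ.- c ℚ.* a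
      alg₂ = solve-∀-in ringℚ

    translate-coordinate : ∀ m x i → translate C m x i ≡ x i ℚ.+ ι ⟨ m ,α i ⟩
    translate-coordinate m x i = cong (x i ℚ.+_)
      (trans (∑ℚ-cong (λ k → sym (ι-* (m k) (C k i)))) (sym (ι-sum (λ k → m k * C k i))))

    ⟨α,α⟩-entry : ∀ k i → ⟨ α k ,α i ⟩ ≡ C k i
    ⟨α,α⟩-entry k i = ∑-α k (λ l → C l i)

  pair-translate : ∀ m x β → pair C (translate C m x) β ≡ pair C x β ℚ.+ ι ⟨ m , β ⟩
  pair-translate m x β = begin
    pair C (translate C m x) β
      ≡⟨ ∑ℚ-cong (λ i → trans (cong (ι (β i) ℚ.*_) (translate-coordinate m x i)) (ℚ.*-distribˡ-+ (ι (β i)) (x i) _)) ⟩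
    sumℚ (λ i → ι (β i) ℚ.* x i ℚ.+ ι (β i) ℚ.* ι ⟨ m ,α i ⟩)
      ≡⟨ ∑ℚ-distrib-+ (λ i → ι (β i) ℚ.* x i) _ ⟩
    pair C x β ℚ.+ sumℚ (λ i → ι (β i) ℚ.* ι ⟨ m ,α i ⟩)
      ≡⟨ cong (pair C x β ℚ.+_) (trans (∑ℚ-cong (λ i → sym (ι-* (β i) ⟨ m ,α i ⟩)))
           (trans (sym (ι-sum (λ i → β i * ⟨ m ,α i ⟩))) (cong ι (sym (⟨⟩-transpose m β))))) ⟩
    pair C x β ℚ.+ ι ⟨ m , β ⟩ ∎

  -- Each letter is self-adjoint for the pairing, so moving the letters across one by one reverses
  -- their order.
  pair-actW : ∀ w x β → pair C (actW C w x) β ≡ pair C x (actRoot C (reverse w) β)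
  pair-actW []      x β = refl
  pair-actW (j ∷ w) x β = begin
    pair C (actW C w (actGen C (refl-s j) x)) β
      ≡⟨ pair-actW w (actGen C (refl-s j) x) β ⟩
    pair C (actGen C (refl-s j) x) (actRoot C (reverse w) β)
      ≡⟨ pair-refl-s j x _ ⟩
    pair C x (reflRoot C j (actRoot C (reverse w) β))
      ≡⟨ cong (pair C x) (sym (actRoot-++ (reverse w) [ j ] β)) ⟩
    pair C x (actRoot C (reverse w ++ [ j ]) β)
      ≡⟨ cong (λ t → pair C x (actRoot C t β)) (sym (List.unfold-reverse j w)) ⟩
    pair C x (actRoot C (reverse (j ∷ w)) β) ∎

  pair-actW-reverse : ∀ w x β → pair C (actW C (reverse w) x) β ≡ pair C x (actRoot C w β)
  pair-actW-reverse w x β = trans (pair-actW (reverse w) x β)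
    (cong (λ t → pair C x (actRoot C t β)) (List.reverse-involutive w))

  actW-++ : ∀ u v x → actW C (u ++ v) x ≡ actW C v (actW C u x)
  actW-++ []      v x = refl
  actW-++ (j ∷ u) v x = actW-++ u v _

  act-++ : ∀ u v x → act C (u ++ v) x ≡ act C v (act C u x)
  act-++ []      v x = refl
  act-++ (g ∷ u) v x = act-++ u v _

  embed : List (Fin n) → Word C
  embed = map refl-s

  act-embed : ∀ c x → act C (embed c) x ≡ actW C c x
  act-embed []      x = refl
  act-embed (j ∷ c) x = act-embed c _

  embed-All : ∀ {J c} → InWJ C J c → InW̃J C J (embed c)
  embed-All []       = []
  embed-All (p ∷ ps) = p ∷ embed-All ps

  -- Every word acts as x ↦ (x) (linear part) + (translation part).
  linear : Word C → List (Fin n)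
  linear []             = []
  linear (refl-s j ∷ w) = j ∷ linear w
  linear (tr+ k ∷ w)    = linear w
  linear (tr- k ∷ w)    = linear w

  -- A translation letter is still acted on by the linear letters after it, hence
  -- `actCo (linear w)`; the coefficient -1 in `shift` adds and 1 subtracts.
  translation : Word C → V
  translation []             = λ _ → 0ℤ
  translation (refl-s j ∷ w) = translation w
  translation (tr+ k ∷ w)    = shift (translation w) (- 1ℤ) (actCo (linear w) (α k))
  translation (tr- k ∷ w)    = shift (translation w) 1ℤ (actCo (linear w) (α k))

  pair-tr+ : ∀ k x β → pair C (actGen C (tr+ k) x) β ≡ pair C x β ℚ.+ ι ⟨ α k , β ⟩
  pair-tr+ k x β = trans (pair-cong {β = β} (λ i → trans (cong (λ t → x i ℚ.+ ι t) (sym (⟨α,α⟩-entry k i)))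
    (sym (translate-coordinate (α k) x i))) (λ _ → refl)) (pair-translate (α k) x β)

  pair-tr- : ∀ k x β → pair C (actGen C (tr- k) x) β ≡ pair C x β ℚ.+ ι (- ⟨ α k , β ⟩)
  pair-tr- k x β = trans (pair-cong {β = β} (λ i → trans (cong (x i ℚ.+_)
    (trans (sym (ι-neg (C k i))) (cong ι (trans (cong -_ (sym (trans (⟨⟩-αʳ (α k) i) (⟨α,α⟩-entry k i))))
      (trans (sym (⟨⟩-negˡ (α k) (α i))) (⟨⟩-αʳ (neg (α k)) i))))))
    (sym (translate-coordinate (neg (α k)) x i))) (λ _ → refl))
    (trans (pair-translate (neg (α k)) x β) (cong (λ t → pair C x β ℚ.+ ι t) (⟨⟩-negˡ (α k) β)))

  ⟨⟩-actRoot-reverse : ∀ w m β → ⟨ m , actRoot C (reverse w) β ⟩ ≡ ⟨ actCo w m , β ⟩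
  ⟨⟩-actRoot-reverse w m β = trans (sym (⟨⟩-actRoot w m (actRoot C (reverse w) β)))
    (⟨⟩-cong {actCo w m} (λ _ → refl) (actRoot-reverse′ w β))

  pair-act : ∀ w x β → pair C (act C w x) β ≡ pair C x (actRoot C (reverse (linear w)) β) ℚ.+ ι ⟨ translation w , β ⟩
  pair-act [] x β = sym (trans (cong (λ t → pair C x β ℚ.+ ι t) (⟨⟩-zeroˡ (λ _ → refl) β)) (ℚ.+-identityʳ (pair C x β)))
  pair-act (refl-s j ∷ w) x β = begin
    pair C (act C w (actGen C (refl-s j) x)) β
      ≡⟨ pair-act w _ β ⟩
    pair C (actGen C (refl-s j) x) (actRoot C (reverse (linear w)) β) ℚ.+ ι ⟨ translation w , β ⟩
      ≡⟨ cong (ℚ._+ ι ⟨ translation w , β ⟩) (trans (sym (pair-actW (linear w) _ β)) (pair-actW (j ∷ linear w) x β)) ⟩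
    pair C x (actRoot C (reverse (j ∷ linear w)) β) ℚ.+ ι ⟨ translation w , β ⟩ ∎
  pair-act (tr+ k ∷ w) x β = begin
    pair C (act C w (actGen C (tr+ k) x)) β
      ≡⟨ pair-act w _ β ⟩
    pair C (actGen C (tr+ k) x) γ ℚ.+ ι ⟨ translation w , β ⟩
      ≡⟨ cong (ℚ._+ ι ⟨ translation w , β ⟩) (pair-tr+ k x γ) ⟩
    pair C x γ ℚ.+ ι ⟨ α k , γ ⟩ ℚ.+ ι ⟨ translation w , β ⟩
      ≡⟨ trans (ℚ.+-assoc (pair C x γ) _ _) (cong (pair C x γ ℚ.+_) (sym (ι-+ ⟨ α k , γ ⟩ ⟨ translation w , β ⟩))) ⟩
    pair C x γ ℚ.+ ι (⟨ α k , γ ⟩ + ⟨ translation w , β ⟩)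
      ≡⟨ cong (λ t → pair C x γ ℚ.+ ι t) (trans (cong (_+ ⟨ translation w , β ⟩) (⟨⟩-actRoot-reverse (linear w)
          (α k) β))
           (trans (alg ⟨ actCo (linear w) (α k) , β ⟩ ⟨ translation w , β ⟩) (sym (⟨⟩-shiftˡ (translation w)
           (- 1ℤ) (actCo (linear w) (α k)) β)))) ⟩
    pair C x γ ℚ.+ ι ⟨ translation (tr+ k ∷ w) , β ⟩ ∎
    where
    γ = actRoot C (reverse (linear w)) β
    alg : ∀ a b → a + b ≡ b - (- 1ℤ) * a
    alg = solve-∀
  pair-act (tr- k ∷ w) x β = begin
    pair C (act C w (actGen C (tr- k) x)) β
      ≡⟨ pair-act w _ β ⟩
    pair C (actGen C (tr- k) x) γ ℚ.+ ι ⟨ translation w , β ⟩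
      ≡⟨ cong (ℚ._+ ι ⟨ translation w , β ⟩) (pair-tr- k x γ) ⟩
    pair C x γ ℚ.+ ι (- ⟨ α k , γ ⟩) ℚ.+ ι ⟨ translation w , β ⟩
      ≡⟨ trans (ℚ.+-assoc (pair C x γ) _ _) (cong (pair C x γ ℚ.+_) (sym (ι-+ (- ⟨ α k , γ ⟩) ⟨ translation w , β ⟩))) ⟩
    pair C x γ ℚ.+ ι (- ⟨ α k , γ ⟩ + ⟨ translation w , β ⟩)
      ≡⟨ cong (λ t → pair C x γ ℚ.+ ι t) (trans (cong (λ t → - t + ⟨ translation w , β ⟩) (⟨⟩-actRoot-reverse
          (linear w) (α k) β))
           (trans (alg ⟨ actCo (linear w) (α k) , β ⟩ ⟨ translation w , β ⟩) (sym (⟨⟩-shiftˡ (translation w) 1ℤ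
           (actCo (linear w) (α k)) β)))) ⟩
    pair C x γ ℚ.+ ι ⟨ translation (tr- k ∷ w) , β ⟩ ∎
    where
    γ = actRoot C (reverse (linear w)) β
    alg : ∀ a b → - a + b ≡ b - 1ℤ * a
    alg = solve-∀

  pair-determines : ∀ {β γ} → (∀ x → pair C x β ≡ pair C x γ) → β ≗ γ
  pair-determines {β} {γ} e k = ι-injective (trans (sym (at-k β)) (trans (e (λ i → ι (α k i))) (at-k γ)))
    where
    at-k : ∀ β → pair C (λ i → ι (α k i)) β ≡ ι (β k)
    at-k β = trans (∑ℚ-cong (λ i → ℚ.*-comm (ι (β i)) (ι (α k i)))) (ι-α-single (λ i → ι (β i)) k)

  SupportedIn : Subset n → V → Set
  SupportedIn J β = ∀ k → β k ≢ 0ℤ → k ∈ J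

  supported-shift : ∀ {J β η} c → SupportedIn J β → SupportedIn J η → SupportedIn J (shift β c η)
  supported-shift {J} {β} {η} c p q k ≢0 with β k ℤ.≟ 0ℤ | η k ℤ.≟ 0ℤ
  ... | no β≢0 | _      = p k β≢0
  ... | yes _  | no η≢0 = q k η≢0
  ... | yes β≡0 | yes η≡0 = ⊥-elim (≢0 (trans (cong₂ (λ s t → s - c * t) β≡0 η≡0) (cong (λ t → 0ℤ - t) (ℤ.*-zeroʳ c))))

  supported-cong : ∀ {J β γ} → β ≗ γ → SupportedIn J β → SupportedIn J γ
  supported-cong e p k ≢0 = p k (λ β≡0 → ≢0 (trans (sym (e k)) β≡0))

  supported-α : ∀ {J j} → j ∈ J → SupportedIn J (α j)
  supported-α {J} {j} j∈J k ≢0 with j Fin.≟ k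
  ... | yes refl = j∈J
  ... | no _     = ⊥-elim (≢0 refl)

  supported-actRoot : ∀ {J w β} → InWJ C J w → SupportedIn J β → SupportedIn J (actRoot C w β)
  supported-actRoot []                       q = q
  supported-actRoot {w = j ∷ w} {β} (p ∷ ps) q = supported-actRoot ps
    (supported-cong (λ k → sym (reflRoot-shift j β k)) (supported-shift ⟨α^ j , β ⟩ q (supported-α p)))

  supported-actCo : ∀ {J w m} → InWJ C J w → SupportedIn J m → SupportedIn J (actCo w m)
  supported-actCo []                       q = q
  supported-actCo {w = j ∷ w} {m} (p ∷ ps) q = supported-actCo ps (supported-shift ⟨ m ,α j ⟩ q (supported-α p))

  linear-InWJ : ∀ {J w} → InW̃J C J w → InWJ C J (linear w)
  linear-InWJ []                      = []
  linear-InWJ {w = refl-s j ∷ _} (p ∷ ps) = p ∷ linear-InWJ ps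
  linear-InWJ {w = tr+ k ∷ _}    (p ∷ ps) = linear-InWJ ps
  linear-InWJ {w = tr- k ∷ _}    (p ∷ ps) = linear-InWJ ps

  translation-supported : ∀ {J w} → InW̃J C J w → SupportedIn J (translation w)
  translation-supported []                      k ≢0 = ⊥-elim (≢0 refl)
  translation-supported {w = refl-s j ∷ _} (p ∷ ps) = translation-supported ps
  translation-supported {w = tr+ k ∷ _}    (p ∷ ps) =
    supported-shift (- 1ℤ) (translation-supported ps) (supported-actCo (linear-InWJ ps) (supported-α p))
  translation-supported {w = tr- k ∷ _}    (p ∷ ps) =
    supported-shift 1ℤ (translation-supported ps) (supported-actCo (linear-InWJ ps) (supported-α p))

  reverse-InWJ : ∀ {J w} → InWJ C J w → InWJ C J (reverse w)
  reverse-InWJ {J} {[]}    []       = []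
  reverse-InWJ {J} {j ∷ w} (p ∷ ps) = subst (InWJ C J) (sym (List.unfold-reverse j w)) (All.++⁺ (reverse-InWJ ps)
      (p ∷ []))

  inRegion : ∀ {J x} → InRegionJ C J x → (r : Root) → Pos (vec r) → SupportedIn J (vec r) → InUnit (pair C x (vec r))
  inRegion region r p supp = region (vec r) (isRoot r , p , supp)

  inRegion⁻ : ∀ {J x} → ((r : Root) → Pos (vec r) → SupportedIn J (vec r) → InUnit (pair C x (vec r))) → InRegionJ C J x
  inRegion⁻ f β (root , p , supp) with fromIsRoot root
  ... | r , refl = f r p supp

  inA0 : ∀ {x} → InA0 C x → (r : Root) → Pos (vec r) → InUnit (pair C x (vec r))
  inA0 region r p = inRegion region r p (λ _ _ → Subset.∈⊤)

  -- 1/(H + 1) for the height bound H. The point `p₀` is then ε ρ^∨, and its pairing ht(β) ε with a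
  -- positive root β is less than 1.
  ε : ℚ
  ε = proj₁ (unit-fraction (proj₁ ht-bound))

  p₀ : P
  p₀ _ = ε

  pair-p₀ : ∀ β → pair C p₀ β ≡ ι (ht β) ℚ.* ε
  pair-p₀ β = begin
    sumℚ (λ i → ι (β i) ℚ.* ε)         ≡⟨ ∑ℚ-cong (λ i → ℚ.*-comm (ι (β i)) ε) ⟩
    sumℚ (λ i → ε ℚ.* ι (β i))         ≡⟨ ∑ℚ-distribˡ-* ε (λ i → ι (β i)) ⟩
    ε ℚ.* sumℚ (λ i → ι (β i))         ≡⟨ ℚ.*-comm ε _ ⟩
    sumℚ (λ i → ι (β i)) ℚ.* ε         ≡⟨ cong (ℚ._* ε) (trans (∑ℚ-cong (λ i → cong ι (sym (ℤ.*-identityʳ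
        (β i))))) (sym (ι-sum (λ i → β i * 1ℤ)))) ⟩
    ι (ht β) ℚ.* ε                     ∎

  ht-pos : (r : Root) → Pos (vec r) → 0ℤ < ht (vec r)
  ht-pos r p = ℤ.≤∧≢⇒< (ht-nonneg p) λ e → root-nonzero r λ k → ℤ.≤-antisym
    (subst₂ _≤_ (ℤ.*-identityʳ (vec r k)) (sym e)
      (∑-term-≤ (λ l → vec r l * 1ℤ) (λ l → subst (0ℤ ≤_) (sym (ℤ.*-identityʳ (vec r l))) (p l)) k)) (p k)

  p₀∈A₀ : InA0 C p₀
  p₀∈A₀ = inRegion⁻ λ r p _ →
    subst (0ℚ ℚ.<_) (sym (pair-p₀ (vec r)))
      (subst (ℚ._< ι (ht (vec r)) ℚ.* ε) (ℚ.*-zeroˡ ε) (ℚ.*-monoˡ-<-pos ε {{ε-positive}} (ι-mono-< (ht-pos r p)))) ,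
    subst (ℚ._< 1ℚ) (sym (pair-p₀ (vec r)))
      (subst (ι (ht (vec r)) ℚ.* ε ℚ.<_) scale*ε
        (ℚ.*-monoˡ-<-pos ε {{ε-positive}} (ι-mono-< {ht (vec r)} {+ suc (proj₁ ht-bound)} (ℤ.≤-<-trans
        (proj₂ ht-bound r) (+<+ ℕ.≤-refl)))))
    where
    ε-positive : ℚ.Positive ε
    ε-positive = ℚ.positive (proj₁ (proj₂ (unit-fraction (proj₁ ht-bound))))
    scale*ε : ι (+ suc (proj₁ ht-bound)) ℚ.* ε ≡ 1ℚ
    scale*ε = proj₂ (proj₂ (unit-fraction (proj₁ ht-bound)))

-- E i is L / D i. As α_i^∨ = α_i / D_i, multiplying coroot coordinates by E i gives L times the
-- same vector in root coordinates.
common-multiple : ∀ {n} (D : Fin n → ℤ) → (∀ i → 0ℤ < D i) →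
  Σ[ L ∈ ℤ ] Σ[ E ∈ (Fin n → ℤ) ] (0ℤ < L × (∀ i → 0ℤ < E i) × (∀ i → D i * E i ≡ L))
common-multiple {zero}  D D>0 = 1ℤ , (λ ()) , +<+ (ℕ.s≤s ℕ.z≤n) , (λ ()) , λ ()
common-multiple {suc n} D D>0 with common-multiple (D ∘ suc) (D>0 ∘ suc)
... | L , E , L>0 , E>0 , DE≡L = D zero * L , E′ , 0<⇒0<* (D>0 zero) L>0 ,
      (λ { zero → L>0 ; (suc i) → 0<⇒0<* (D>0 zero) (E>0 i) }) ,
      λ { zero → refl ; (suc i) → trans (alg (D (suc i)) (D zero) (E i)) (cong (D zero *_) (DE≡L i)) }
  where
  E′ : Fin (suc n) → ℤ
  E′ zero    = L
  E′ (suc i) = D zero * E i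
  alg : ∀ a b c → a * (b * c) ≡ b * (a * c)
  alg = solve-∀

-- The hypotheses leave c = 1 or c = -1, with the sign of x.
closer-to-zero : ∀ x c → 0ℤ < x * c → ∣ c ∣ ℕ.≤ 1 → ∣ x ∣ ≡ suc ∣ x - c ∣
closer-to-zero +[1+ a ] +[1+ 0 ] _ _ = refl
closer-to-zero -[1+ zero ]  -[1+ 0 ] _ _ = refl
closer-to-zero -[1+ suc a ] -[1+ 0 ] _ _ = refl
closer-to-zero (+ 0)    c        p _ = ⊥-elim (ℤ.<-irrefl (sym (ℤ.*-zeroˡ c)) p)
closer-to-zero x@(+[1+ a ]) (+ 0) p _ = ⊥-elim (ℤ.<-irrefl (sym (ℤ.*-zeroʳ x)) p)
closer-to-zero x@(-[1+ a ]) (+ 0) p _ = ⊥-elim (ℤ.<-irrefl (sym (ℤ.*-zeroʳ x)) p)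
closer-to-zero +[1+ a ] -[1+ 0 ] () _
closer-to-zero -[1+ a ] +[1+ 0 ] () _
closer-to-zero _ +[1+ suc c ] _ (ℕ.s≤s ())
closer-to-zero _ -[1+ suc c ] _ (ℕ.s≤s ())

-- Freeness of the action of W̃_J on alcoves inside 𝒜_J.

module FundamentalAlcove {n : ℕ} (C : CartanMatrix n) (IC : IntegralCartan C) where

  open IntegralCartan IC
  open RootSystem C IC
  open WeylGroup C IC
  open AffineAction C IC
  open ≡-Reasoning

  -- With x the vector m rescaled to root coordinates, ⟨m , x⟩ is the sum of the E_k m_k ⟨m,α_k⟩ and
  -- is positive by positive definiteness, so one term is positive.
  coroot-positivity : ∀ m → (∃[ k ] m k ≢ 0ℤ) → ∃[ k ] 0ℤ < m k * ⟨ m ,α k ⟩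
  coroot-positivity m (i , mi≢0) with common-multiple D D-pos
  ... | L , E , L>0 , E>0 , DE≡L with ∑-pos⇒term-pos (λ l → x l * ⟨ m ,α l ⟩) (subst (0ℤ <_) (⟨⟩-transpose m x)
          (⟨⟩-pos {L} {m} {x} L>0 prop-x (i , λ e → mi≢0 (*-cancelˡ-0< (E>0 i) (trans e (sym (ℤ.*-zeroʳ (E i))))))))
    where
    x : V
    x k = E k * m k
    prop-x : ∀ k → L * m k ≡ D k * x k
    prop-x k = trans (cong (_* m k) (sym (DE≡L k))) (ℤ.*-assoc (D k) (E k) (m k))
  ...   | k , p = k , 0<*⇒0< (E>0 k) (subst (0ℤ <_) (ℤ.*-assoc (E k) (m k) ⟨ m ,α k ⟩) p)

  ⟨⟩-nondegenerate : ∀ {m} → (∀ l → ⟨ m ,α l ⟩ ≡ 0ℤ) → ∀ k → m k ≡ 0ℤ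
  ⟨⟩-nondegenerate {m} e with zero? m
  ... | inj₂ m≡0 = m≡0
  ... | inj₁ m≢0 with coroot-positivity m m≢0
  ...   | k , p = ⊥-elim (ℤ.<-irrefl (sym (trans (cong (m k *_) (e k)) (ℤ.*-zeroʳ (m k)))) p)

  size : V → ℤ
  size m = sumℤ (λ k → + ∣ m k ∣)

  size-reflCo : ∀ k m → 0ℤ < m k * ⟨ m ,α k ⟩ → ∣ ⟨ m ,α k ⟩ ∣ ℕ.≤ 1 → size m ≡ size (reflCo k m) + 1ℤ
  size-reflCo k m p c≤1 = begin
    size m
      ≡⟨ Σℤ.∑-cong {n} term ⟩
    sumℤ (λ l → + ∣ reflCo k m l ∣ + α k l * 1ℤ)
      ≡⟨ Σℤ.∑-distrib-+ {n} (λ l → + ∣ reflCo k m l ∣) (λ l → α k l * 1ℤ) ⟩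
    size (reflCo k m) + sumℤ (λ l → α k l * 1ℤ)
      ≡⟨ cong (λ t → size (reflCo k m) + t) (∑-α k (λ _ → 1ℤ)) ⟩
    size (reflCo k m) + 1ℤ ∎
    where
    c = ⟨ m ,α k ⟩
    term : ∀ l → + ∣ m l ∣ ≡ + ∣ m l - c * α k l ∣ + α k l * 1ℤ
    term l with k Fin.≟ l
    ... | yes refl = trans (cong +_ (closer-to-zero (m k) c p c≤1))
            (trans (cong +_ (ℕ.+-comm 1 ∣ m k - c ∣)) (cong (λ t → + ∣ m k - t ∣ + 1ℤ) (sym (ℤ.*-identityʳ c))))
    ... | no _ = trans (cong (λ t → + ∣ t ∣) (alg (m l) c)) (sym (ℤ.+-identityʳ _))
      where
      alg : ∀ x c → x ≡ x - c * 0ℤ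
      alg = solve-∀

  -- The bound is two-sided and ranges over all of Φ_J, not only over positive roots, so that it is
  -- stable under W_J.
  Minuscule : Subset n → V → Set
  Minuscule J m = ∀ (r : Root) → SupportedIn J (vec r) → ∣ ⟨ m , vec r ⟩ ∣ ℕ.≤ 1

  minuscule-trivial′ : ∀ {J} fuel m → size m < + fuel → SupportedIn J m → Minuscule J m → ∀ k → m k ≡ 0ℤ
  minuscule-trivial′ zero m h supp min =
    ⊥-elim (ℤ.<-irrefl refl (ℤ.≤-<-trans (∑-nonneg (λ k → + ∣ m k ∣) (λ k → +≤+ ℕ.z≤n)) h))
  minuscule-trivial′ {J} (suc fuel) m h supp min with zero? m
  ... | inj₂ m≡0 = m≡0
  ... | inj₁ m≢0 with coroot-positivity m m≢0
  ...   | k , p = ⊥-elim (ℤ.<-irrefl (sym (trans (cong (m k *_) c≡0) (ℤ.*-zeroʳ (m k)))) p)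
    where
    k∈J : k ∈ J
    k∈J = supp k λ mk≡0 → ℤ.<-irrefl (sym (trans (cong (_* ⟨ m ,α k ⟩) mk≡0) (ℤ.*-zeroˡ ⟨ m ,α k ⟩))) p
    c≤1 : ∣ ⟨ m ,α k ⟩ ∣ ℕ.≤ 1
    c≤1 = subst (λ t → ∣ t ∣ ℕ.≤ 1) (⟨⟩-αʳ m k) (min (simpleRoot k) (supported-α k∈J))
    h′ : size (reflCo k m) < + fuel
    h′ = ℤ.<-≤-trans (subst₂ _<_ (ℤ.+-identityʳ _) (sym (size-reflCo k m p c≤1)) (ℤ.+-monoʳ-< (size (reflCo k m))
        (+<+ (ℕ.s≤s ℕ.z≤n))))
           (ℤ.i<j⇒i≤pred[j] h)
    min′ : Minuscule J (reflCo k m)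
    min′ r supp-r = subst (λ t → ∣ t ∣ ℕ.≤ 1)
      (trans (sym (⟨⟩-reflRoot k m (reflRoot C k (vec r)))) (⟨⟩-cong {reflCo k m} (λ _ → refl)
      (reflRoot-involutive k (vec r))))
      (min (reflectRoot k r) (supported-actRoot {w = k ∷ []} (k∈J ∷ []) supp-r))
    reflected≡0 : ∀ l → reflCo k m l ≡ 0ℤ
    reflected≡0 = minuscule-trivial′ fuel (reflCo k m) h′ (supported-actCo {w = k ∷ []} (k∈J ∷ []) supp) min′
    -- Reflections preserve pairings, so once the reflected vector is zero, m itself pairs to 0 with
    -- α_k, against `p`.
    c≡0 : ⟨ m ,α k ⟩ ≡ 0ℤ
    c≡0 = trans (sym (⟨⟩-αʳ m k)) (trans (sym (⟨⟩-reflRoot k m (α k))) (⟨⟩-zeroˡ reflected≡0 (reflRoot C k (α k))))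

  minuscule-trivial : ∀ {J m} → SupportedIn J m → Minuscule J m → ∀ k → m k ≡ 0ℤ
  minuscule-trivial {J} {m} = minuscule-trivial′ (suc ∣ size m ∣) m
    (subst (_< + suc ∣ size m ∣) (ℤ.0≤i⇒+∣i∣≡i (∑-nonneg (λ k → + ∣ m k ∣) (λ k → +≤+ ℕ.z≤n))) (+<+ ℕ.≤-refl))

  actRoot-∷-α : ∀ j w → actRoot C (j ∷ w) (α j) ≗ neg (actRoot C w (α j))
  actRoot-∷-α j w k = trans (actRoot-cong w (reflRoot-α j) k) (actRoot-neg w (α j) k)

  neg-Pos : ∀ {β γ} → γ ≗ neg β → Pos γ → Neg β
  neg-Pos {β} e p k = subst (_≤ 0ℤ) (trans (cong -_ (e k)) (ℤ.neg-involutive (β k))) (ℤ.neg-mono-≤ (p k))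

  Pos-neg : ∀ {β γ} → γ ≗ neg β → Neg β → Pos γ
  Pos-neg e q k = subst (0ℤ ≤_) (sym (e k)) (ℤ.neg-mono-≤ (q k))

  neg-of-Pos : ∀ {β γ} → γ ≗ neg β → Pos β → Neg γ
  neg-of-Pos e p k = subst (_≤ 0ℤ) (sym (e k)) (ℤ.neg-mono-≤ (p k))

  exchange-simple : ∀ j w → Neg (actRoot C w (α j)) →
    ∃[ w′ ] (length w ≡ suc (length w′) × (∀ {P : Fin n → Set} → All P w → All P w′)
            × (∀ γ → actRoot C w′ γ ≗ actRoot C (j ∷ w) γ))
  exchange-simple j w q with exchange (simpleRoot j) w (α-pos j) q
  ... | w′ , len , all , act = w′ , len , all , λ γ k →
        trans (act γ k) (actRoot-cong w (λ l → sym (reflRoot≗refl j γ l)) k)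

  -- If j ∷ v keeps α_j positive, then v makes α_j negative, and exchange yields a word for the same
  -- element that is two letters shorter and still in W_J. Descent ends at the empty word.
  positive-on-simple⇒trivial′ : ∀ {J} fuel v → length v ℕ.< fuel → InWJ C J v →
    (∀ j → j ∈ J → Pos (actRoot C v (α j))) → ∀ β → actRoot C v β ≗ β
  positive-on-simple⇒trivial′ fuel       []      h ps pos β k = refl
  positive-on-simple⇒trivial′ (suc fuel) (j ∷ v) h (j∈J ∷ ps) pos β k
    with exchange-simple j v (neg-Pos (actRoot-∷-α j v) (pos j j∈J))
  ... | v′ , len , all , act = trans (sym (act β k))
        (positive-on-simple⇒trivial′ fuel v′ (ℕ.<-trans (ℕ.≤-reflexive (sym len)) (ℕ.s<s⁻¹ h)) (all ps)
          (λ i i∈J l → subst (0ℤ ≤_) (sym (act (α i) l)) (pos i i∈J l)) β k)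

  positive-on-simple⇒trivial : ∀ {J v} → InWJ C J v →
    (∀ j → j ∈ J → Pos (actRoot C v (α j))) → ∀ β → actRoot C v β ≗ β
  positive-on-simple⇒trivial {v = v} = positive-on-simple⇒trivial′ (suc (length v)) v ℕ.≤-refl

  -- z and z′ lie in the same fundamental alcove of W̃_J and z′ = z y with y ∈ W̃_J, so y = 1:
  -- the translation part μ of y pairs to 0 or 1 with the positive roots of Φ_J, hence is zero,
  -- and then the linear part preserves positivity.
  alcove-free : ∀ {J z z′ c μ} → InRegionJ C J z → InRegionJ C J z′ → InWJ C J c → SupportedIn J μ →
    (∀ β → pair C z′ β ≡ pair C z (actRoot C c β) ℚ.+ ι ⟨ μ , β ⟩) →
    (∀ β → actRoot C c β ≗ β) × (∀ k → μ k ≡ 0ℤ)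
  alcove-free {J} {z} {z′} {c} {μ} z∈ z′∈ c∈ μ∈ e = positive-on-simple⇒trivial c∈ c-pos , μ≡0
    where
    value : (r : Root) → Pos (vec r) → SupportedIn J (vec r) →
            (Pos (actRoot C c (vec r)) × ⟨ μ , vec r ⟩ ≡ 0ℤ) ⊎ (⟨ μ , vec r ⟩ ≡ 1ℤ)
    value r p supp with root-sign (actOn c r)
    ... | inj₁ p′ = inj₁ (subst Pos (vec-actOn c r) p′ ,
            unit-shift-integer ⟨ μ , vec r ⟩ (inRegion z∈ (actOn c r) p′ supp′)
              (subst InUnit (trans (e (vec r)) (cong (λ β → pair C z β ℚ.+ ι ⟨ μ , vec r ⟩) (sym
              (vec-actOn c r)))) (inRegion z′∈ r p supp)))
      where
      supp′ : SupportedIn J (vec (actOn c r))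
      supp′ = subst (SupportedIn J) (sym (vec-actOn c r)) (supported-actRoot c∈ supp)
    ... | inj₂ q′ = inj₂ (ℤ.i-j≡0⇒i≡j _ _ (unit-shift-integer (⟨ μ , vec r ⟩ - 1ℤ)
            (unit-reflect (inRegion z∈ (negRoot δ) (λ k → ℤ.neg-mono-≤ (q′ k)) supp′))
            (subst InUnit eq (inRegion z′∈ r p supp))))
      where
      δ = actOn c r
      supp′ : SupportedIn J (neg (vec δ))
      supp′ k ≢0 = subst (SupportedIn J) (sym (vec-actOn c r)) (supported-actRoot c∈ supp) k (λ e → ≢0 (cong -_ e))
      a = pair C z (vec δ)
      m = ⟨ μ , vec r ⟩
      alg : ∀ a m o → a ℚ.+ m ≡ ℚ.- (ℚ.- a) ℚ.+ o ℚ.+ (m ℚ.- o)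
      alg = solve-∀-in ringℚ
      eq : pair C z′ (vec r) ≡ ℚ.- pair C z (neg (vec δ)) ℚ.+ 1ℚ ℚ.+ ι (m - 1ℤ)
      eq = begin
        pair C z′ (vec r)
          ≡⟨ trans (e (vec r)) (cong (λ β → pair C z β ℚ.+ ι m) (sym (vec-actOn c r))) ⟩
        a ℚ.+ ι m
          ≡⟨ alg a (ι m) 1ℚ ⟩
        ℚ.- (ℚ.- a) ℚ.+ 1ℚ ℚ.+ (ι m ℚ.- 1ℚ)
          ≡⟨ cong₂ (λ s t → ℚ.- s ℚ.+ 1ℚ ℚ.+ t) (sym (pair-neg z (vec δ))) (sym (trans (ι-+ m (- 1ℤ)) (cong
              (ι m ℚ.+_) (ι-neg 1ℤ)))) ⟩
        ℚ.- pair C z (neg (vec δ)) ℚ.+ 1ℚ ℚ.+ ι (m - 1ℤ) ∎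
    ∣value∣ : (r : Root) → Pos (vec r) → SupportedIn J (vec r) → ∣ ⟨ μ , vec r ⟩ ∣ ℕ.≤ 1
    ∣value∣ r p supp with value r p supp
    ... | inj₁ (_ , e) = subst (λ t → ∣ t ∣ ℕ.≤ 1) (sym e) ℕ.z≤n
    ... | inj₂ e       = subst (λ t → ∣ t ∣ ℕ.≤ 1) (sym e) ℕ.≤-refl
    minuscule : Minuscule J μ
    minuscule r supp with root-sign r
    ... | inj₁ p = ∣value∣ r p supp
    ... | inj₂ q = subst (ℕ._≤ 1) (trans (cong ∣_∣ (⟨⟩-negʳ μ (vec r))) (ℤ.∣-i∣≡∣i∣ ⟨ μ , vec r ⟩))
            (∣value∣ (negRoot r) (λ k → ℤ.neg-mono-≤ (q k)) (λ k ≢0 → supp k (λ e → ≢0 (cong -_ e))))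
    μ≡0 : ∀ k → μ k ≡ 0ℤ
    μ≡0 = minuscule-trivial μ∈ minuscule
    c-pos : ∀ j → j ∈ J → Pos (actRoot C c (α j))
    c-pos j j∈J with value (simpleRoot j) (α-pos j) (supported-α j∈J)
    ... | inj₁ (p , _) = p
    ... | inj₂ e₁ with trans (sym e₁) (⟨⟩-zeroˡ μ≡0 (α j))
    ...   | ()

  -- Minimal length representatives of the cosets u W_J.

  actRoot-reverse-cong : ∀ {u u′} → (∀ β → actRoot C u β ≗ actRoot C u′ β) →
                         ∀ β → actRoot C (reverse u) β ≗ actRoot C (reverse u′) β
  actRoot-reverse-cong {u} {u′} e β k = begin
    actRoot C (reverse u) β k
      ≡⟨ sym (actRoot-reverse u′ _ k) ⟩
    actRoot C (reverse u′) (actRoot C u′ (actRoot C (reverse u) β)) k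
      ≡⟨ actRoot-cong (reverse u′) (λ l → trans (sym (e _ l)) (actRoot-reverse′ u β l)) k ⟩
    actRoot C (reverse u′) β k ∎

  actW⇒actRoot : ∀ u u′ → (∀ x → actW C u x ≗ actW C u′ x) → ∀ β → actRoot C u β ≗ actRoot C u′ β
  actW⇒actRoot u u′ e β k = subst₂ (λ v v′ → actRoot C v β k ≡ actRoot C v′ β k)
    (List.reverse-involutive u) (List.reverse-involutive u′)
    (actRoot-reverse-cong {reverse u} {reverse u′} (λ γ → pair-determines (λ x →
      trans (sym (pair-actW u x γ)) (trans (pair-cong {β = γ} (e x) (λ _ → refl)) (pair-actW u′ x γ)))) β k)

  actRoot⇒actW : ∀ u u′ → (∀ β → actRoot C u β ≗ actRoot C u′ β) → ∀ x → actW C u x ≗ actW C u′ x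
  actRoot⇒actW u u′ e x = pair-ext (λ β → trans (pair-actW u x β)
    (trans (pair-cong {x} (λ _ → refl) (actRoot-reverse-cong {u} {u′} e β)) (sym (pair-actW u′ x β))))

  actW-cong : ∀ w {x y} → x ≗ y → actW C w x ≗ actW C w y
  actW-cong w {x} {y} e = pair-ext (λ β → trans (pair-actW w x β)
    (trans (pair-cong {β = actRoot C (reverse w) β} e (λ _ → refl)) (sym (pair-actW w y β))))

  act-cong : ∀ w {x y} → x ≗ y → act C w x ≗ act C w y
  act-cong w {x} {y} e = pair-ext (λ β → trans (pair-act w x β)
    (trans (cong (ℚ._+ ι ⟨ translation w , β ⟩) (pair-cong {β = actRoot C (reverse (linear w)) β} e (λ _ → refl)))
    (sym (pair-act w y β))))

  -- The root criterion for ℓ(u s_j) > ℓ(u), j in J. The inverse appears because (x u , α_j) = (x ,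
  -- α_j u⁻¹).
  PositiveOn : Subset n → List (Fin n) → Set
  PositiveOn J u = ∀ j → j ∈ J → Pos (actRoot C (reverse u) (α j))

  -- Exchange for the inverse element, read backwards: a letter is lost when s_j is multiplied on
  -- the right.
  exchangeʳ : ∀ j u → Neg (actRoot C (reverse u) (α j)) →
    ∃[ u′ ] (length u ≡ suc (length u′) × (∀ x → actW C u′ x ≗ actW C (j ∷ []) (actW C u x)))
  exchangeʳ j u q with exchange-simple j (reverse u) q
  ... | w′ , len , _ , act = reverse w′ , trans (sym (List.length-reverse u)) (trans len (cong suc (sym
      (List.length-reverse w′)))) ,
        λ x → pair-ext (λ β → begin
          pair C (actW C (reverse w′) x) β              ≡⟨ pair-actW-reverse w′ x β ⟩
          pair C x (actRoot C w′ β)                     ≡⟨ pair-cong {x} (λ _ → refl) (act β) ⟩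
          pair C x (actRoot C (reverse u) (reflRoot C j β))   ≡⟨ sym (pair-actW u x (reflRoot C j β)) ⟩
          pair C (actW C u x) (reflRoot C j β)          ≡⟨ sym (pair-refl-s j (actW C u x) β) ⟩
          pair C (actW C (j ∷ []) (actW C u x)) β       ∎)

  minRep⇒positive : ∀ {J u} → IsMinRep C J u → PositiveOn J u
  minRep⇒positive {J} {u} min j j∈J with root-sign (actOn (reverse u) (simpleRoot j))
  ... | inj₁ p = subst Pos (vec-actOn (reverse u) (simpleRoot j)) p
  ... | inj₂ q with exchangeʳ j u (subst Neg (vec-actOn (reverse u) (simpleRoot j)) q)
  ...   | u′ , len , e = ⊥-elim (ℕ.<-irrefl refl (ℕ.≤-trans (ℕ.≤-reflexive (sym len)) (min u′ (j ∷ []) (j∈J ∷ []) e)))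

  -- For r in Φ_J⁺ the number (p₀ u , r) is a nonnegative combination of the positive (p₀ u , α_k)
  -- with k in J, so u⁻¹ cannot make r negative; on a positive image the bounds are those of A₀.
  positive⇒inRegion : ∀ {J u} → PositiveOn J u → InRegionJ C J (actW C u p₀)
  positive⇒inRegion {J} {u} pos = inRegion⁻ region
    where
    region : (r : Root) → Pos (vec r) → SupportedIn J (vec r) → InUnit (pair C (actW C u p₀) (vec r))
    region r p supp with root-sign (actOn (reverse u) r)
    ... | inj₁ p′ = subst InUnit (sym (pair-actW u p₀ (vec r)))
            (subst (λ β → InUnit (pair C p₀ β)) (vec-actOn (reverse u) r) (inA0 p₀∈A₀ (actOn (reverse u) r) p′))
    ... | inj₂ q′ = ⊥-elim (ℚ.<-irrefl refl (ℚ.≤-<-trans (∑ℚ-nonneg _ term) negative))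
      where
      δ = actOn (reverse u) r
      negative : pair C (actW C u p₀) (vec r) ℚ.< 0ℚ
      negative = subst (ℚ._< 0ℚ) (begin
          ℚ.- pair C p₀ (neg (vec δ))     ≡⟨ cong ℚ.-_ (pair-neg p₀ (vec δ)) ⟩
          ℚ.- (ℚ.- pair C p₀ (vec δ))     ≡⟨ ℚneg-involutive (pair C p₀ (vec δ)) ⟩
          pair C p₀ (vec δ)               ≡⟨ cong (pair C p₀) (vec-actOn (reverse u) r) ⟩
          pair C p₀ (actRoot C (reverse u) (vec r))   ≡⟨ sym (pair-actW u p₀ (vec r)) ⟩
          pair C (actW C u p₀) (vec r)    ∎)
        (ℚ.neg-antimono-< (proj₁ (inA0 p₀∈A₀ (negRoot δ) (λ k → ℤ.neg-mono-≤ (q′ k)))))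
        where
        ℚneg-involutive : ∀ q → ℚ.- (ℚ.- q) ≡ q
        ℚneg-involutive = solve-∀-in ringℚ
      term : ∀ k → 0ℚ ℚ.≤ ι (vec r k) ℚ.* actW C u p₀ k
      term k with vec r k ℤ.≟ 0ℤ
      ... | yes e = ℚ.≤-reflexive (sym (trans (cong (λ t → ι t ℚ.* actW C u p₀ k) e) (ℚ.*-zeroˡ (actW C u p₀ k))))
      ... | no ≢0 = ℚ.<⇒≤ (ℚ.positive⁻¹ _ {{ℚ.pos*pos⇒pos (ι (vec r k)) {{ℚ.positive (ι-mono-< {0ℤ} (ℤ.≤∧≢⇒< (p k)
          (λ e → ≢0 (sym e))))}}
              (actW C u p₀ k) {{ℚ.positive coordinate>0}}}})
        where
        αk = actOn (reverse u) (simpleRoot k)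
        coordinate>0 : 0ℚ ℚ.< actW C u p₀ k
        coordinate>0 = subst (0ℚ ℚ.<_) (begin
            pair C p₀ (vec αk)                        ≡⟨ cong (pair C p₀) (vec-actOn (reverse u) (simpleRoot k)) ⟩
            pair C p₀ (actRoot C (reverse u) (α k))   ≡⟨ sym (pair-actW u p₀ (α k)) ⟩
            pair C (actW C u p₀) (α k)                ≡⟨ pair-α (actW C u p₀) k ⟩
            actW C u p₀ k                             ∎)
          (proj₁ (inA0 p₀∈A₀ αk (subst Pos (sym (vec-actOn (reverse u) (simpleRoot k))) (pos k (supp k ≢0)))))

  -- The case of zero translation in `alcove-free`, at the points p₀ u and p₀ u′: a coset of W_J
  -- contains only one positive element.
  positive-unique : ∀ {J u u′ c} → PositiveOn J u → PositiveOn J u′ → InWJ C J c →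
    (∀ x → actW C u′ x ≗ actW C c (actW C u x)) → ∀ x → actW C c x ≗ x
  positive-unique {J} {u} {u′} {c} pos pos′ c∈ e x = pair-ext (λ β → trans (pair-actW c x β)
      (pair-cong {x} (λ _ → refl) (proj₁ trivial β)))
    where
    trivial = alcove-free {J} {actW C u p₀} {actW C u′ p₀} {reverse c} {λ _ → 0ℤ}
      (positive⇒inRegion {J} {u} pos) (positive⇒inRegion {J} {u′} pos′) (reverse-InWJ c∈) (λ k ≢0 → ⊥-elim (≢0 refl))
      (λ β → trans (pair-cong {β = β} (e p₀) (λ _ → refl)) (trans (pair-actW c (actW C u p₀) β)
        (sym (trans (cong (λ t → pair C (actW C u p₀) (actRoot C (reverse c) β) ℚ.+ ι t) (⟨⟩-zeroˡ
        (λ _ → refl) β)) (ℚ.+-identityʳ _)))))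

  -- Each letter lengthens the element spelled by the letters after it, expressed by roots instead
  -- of by comparison with all other words.
  Reduced : List (Fin n) → Set
  Reduced []      = ⊤
  Reduced (j ∷ u) = Pos (actRoot C u (α j)) × Reduced u

  -- The first letter j of the reduced word makes α_j negative under the whole element, so exchange
  -- strips one letter from any competing word; then induct on the rest.
  reduced-shortest : ∀ u u′ → Reduced u → (∀ β → actRoot C u β ≗ actRoot C u′ β) → length u ℕ.≤ length u′
  reduced-shortest []      u′ _ _ = ℕ.z≤n
  reduced-shortest (j ∷ u) u′ (p , red) e
    with exchange-simple j u′ (λ k → subst (_≤ 0ℤ) (e (α j) k) (neg-of-Pos (actRoot-∷-α j u) p k))
  ... | u″ , len , _ , act = subst (suc (length u) ℕ.≤_) (sym len) (ℕ.s≤s (reduced-shortest u u″ red (λ β k → begin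
        actRoot C u β k                                ≡⟨ sym (actRoot-cong u (reflRoot-involutive j β) k) ⟩
        actRoot C (j ∷ u) (reflRoot C j β) k           ≡⟨ e (reflRoot C j β) k ⟩
        actRoot C u′ (reflRoot C j β) k                ≡⟨ sym (act β k) ⟩
        actRoot C u″ β k                               ∎)))

  -- Prepending j either keeps the word reduced or lets exchange delete a letter. The shortened word
  -- is not known to be reduced and is processed again, so recursion is on fuel.
  reduced-word : ∀ fuel w → length w ℕ.< fuel →
    ∃[ u ] (Reduced u × length u ℕ.≤ length w × (∀ β → actRoot C u β ≗ actRoot C w β))
  reduced-word fuel       []      h = [] , tt , ℕ.z≤n , λ β k → refl
  reduced-word (suc fuel) (j ∷ w) h with reduced-word fuel w (ℕ.s<s⁻¹ h)
  ... | u , red , len , e with root-sign (actOn u (simpleRoot j))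
  ...   | inj₁ p = j ∷ u , (subst Pos (vec-actOn u (simpleRoot j)) p , red) , ℕ.s≤s len , λ β → e (reflRoot C j β)
  ...   | inj₂ q with exchange-simple j u (subst Neg (vec-actOn u (simpleRoot j)) q)
  ...     | u′ , len′ , _ , act with reduced-word fuel u′ (ℕ.<-≤-trans (ℕ.≤-reflexive (sym len′)) (ℕ.≤-trans len
      (ℕ.<⇒≤ (ℕ.s<s⁻¹ h))))
  ...       | u″ , red″ , len″ , e″ = u″ , red″ ,
              ℕ.≤-trans len″ (ℕ.≤-trans (ℕ.n≤1+n _) (ℕ.≤-trans (ℕ.≤-reflexive (sym len′)) (ℕ.≤-trans len
                  (ℕ.n≤1+n _)))) ,
              λ β k → trans (e″ β k) (trans (act β k) (e (reflRoot C j β) k))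

  -- As long as u⁻¹ makes some α_j with j in J negative, u s_j lies in the same coset and has a
  -- shorter word; c collects the letters j used.
  coset-minimum : ∀ J fuel w → length w ℕ.< fuel →
    ∃[ u ] ∃[ c ] (Reduced u × PositiveOn J u × length u ℕ.≤ length w × InWJ C J c
                  × (∀ x → actW C u x ≗ actW C c (actW C w x)))
  coset-minimum J (suc fuel) w h with reduced-word (suc (length w)) w ℕ.≤-refl
  ... | u , red , len , e with any? (λ j → j Subset.∈? J ×-dec ¬? (all? (λ k → 0ℤ ℤ.≤? actRoot C (reverse u) (α j) k)))
  ...   | no none = u , [] , red , (λ j j∈J → decidable-stable (all? (λ k → 0ℤ ℤ.≤? actRoot C (reverse u) (α j) k))
            (λ ¬p → none (j , j∈J , ¬p))) , len , [] , actRoot⇒actW u w e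
  ...   | yes (j , j∈J , ¬p) with root-sign (actOn (reverse u) (simpleRoot j))
  ...     | inj₁ p = ⊥-elim (¬p (subst Pos (vec-actOn (reverse u) (simpleRoot j)) p))
  ...     | inj₂ q with exchangeʳ j u (subst Neg (vec-actOn (reverse u) (simpleRoot j)) q)
  ...       | u′ , len′ , e′ with coset-minimum J fuel u′ (ℕ.<-≤-trans (ℕ.≤-reflexive (sym len′)) (ℕ.≤-trans len
      (ℕ.s≤s⁻¹ h)))
  ...         | u″ , c , red″ , pos″ , len″ , c∈ , e″ = u″ , j ∷ c , red″ , pos″ ,
                ℕ.≤-trans len″ (ℕ.≤-trans (ℕ.n≤1+n _) (ℕ.≤-trans (ℕ.≤-reflexive (sym len′)) len)) , j∈J ∷ c∈ ,
                λ x k → trans (e″ x k) (actW-cong c (λ l → trans (e′ x l) (actW-cong (j ∷ [])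
                    (actRoot⇒actW u w e x) l)) k)

  -- A competitor u′ shrinks to a positive element u″ of the same coset. Uniqueness gives u″ = u as
  -- group elements, and a reduced word is no longer than any other word for its element.
  reduced∧positive⇒minRep : ∀ {J u} → Reduced u → PositiveOn J u → IsMinRep C J u
  reduced∧positive⇒minRep {J} {u} red pos u′ v v∈ e with coset-minimum J (suc (length u′)) u′ ℕ.≤-refl
  ... | u″ , c , red″ , pos″ , len″ , c∈ , e″ = ℕ.≤-trans
        (reduced-shortest u u″ red (actW⇒actRoot u u″ (λ x k → sym (trans (u″≗ x k) (trivial (actW C u x) k))))) len″
    where
    u″≗ : ∀ x → actW C u″ x ≗ actW C (v ++ c) (actW C u x)
    u″≗ x k = trans (e″ x k) (trans (actW-cong c (e x) k) (cong (λ f → f k) (sym (actW-++ v c (actW C u x)))))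
    trivial = positive-unique {J} {u} {u″} {v ++ c} pos pos″ (All.++⁺ v∈ c∈) u″≗

-- Integral data of alcoves in 𝒜_J, and words for translations and affine reflections.

module Bullet {n : ℕ} (C : CartanMatrix n) (IC : IntegralCartan C) where

  open IntegralCartan IC
  open RootSystem C IC
  open WeylGroup C IC
  open AffineAction C IC
  open FundamentalAlcove C IC
  open ≡-Reasoning

  -- For x in A₀ and a root β, ν β = - ⌊(x , β)⌋.
  ν : Root → ℤ
  ν r with root-sign r
  ... | inj₁ _ = 0ℤ
  ... | inj₂ _ = 1ℤ

  ν-pos : ∀ r → Pos (vec r) → ν r ≡ 0ℤ
  ν-pos r p with root-sign r
  ... | inj₁ _ = refl
  ... | inj₂ q = ⊥-elim (Pos-Neg-disjoint r p q)

  ν-neg : ∀ r → Neg (vec r) → ν r ≡ 1ℤ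
  ν-neg r q with root-sign r
  ... | inj₁ p = ⊥-elim (Pos-Neg-disjoint r p q)
  ... | inj₂ _ = refl

  Pos-cong : ∀ {β γ} → β ≗ γ → Pos β → Pos γ
  Pos-cong e p k = subst (0ℤ ≤_) (e k) (p k)

  Neg-cong : ∀ {β γ} → β ≗ γ → Neg β → Neg γ
  Neg-cong e q k = subst (_≤ 0ℤ) (e k) (q k)

  A₀-unit : ∀ {x} → InA0 C x → (r : Root) → InUnit (pair C x (vec r) ℚ.+ ι (ν r))
  A₀-unit {x} x∈ r with root-sign r
  ... | inj₁ p = subst InUnit (sym (ℚ.+-identityʳ (pair C x (vec r)))) (inA0 x∈ r p)
  ... | inj₂ q = subst InUnit (cong (ℚ._+ 1ℚ) (trans (cong ℚ.-_ (pair-neg x (vec r))) (alg (pair C x (vec r)))))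
          (unit-reflect (inA0 x∈ (negRoot r) (λ k → ℤ.neg-mono-≤ (q k))))
    where
    alg : ∀ q → ℚ.- (ℚ.- q) ≡ q
    alg = solve-∀-in ringℚ

  -- At `p₀` both the integer ⟨translation w , r⟩ and the integer ν carry the same rational number
  -- into the unit interval, so they agree. The conclusion no longer mentions a point.
  liesIn-value : ∀ {J w} → LiesIn C J w → (r : Root) → Pos (vec r) → SupportedIn J (vec r) →
                 ⟨ translation w , vec r ⟩ ≡ ν (actOn (reverse (linear w)) r)
  liesIn-value {J} {w} lies r p supp = ℤ.i-j≡0⇒i≡j _ _ (unit-shift-integer (t - ν γ) (A₀-unit p₀∈A₀ γ)
      (subst InUnit eq (inRegion (lies p₀ p₀∈A₀) r p supp)))
    where
    γ = actOn (reverse (linear w)) r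
    t = ⟨ translation w , vec r ⟩
    alg : ∀ a t v → a ℚ.+ t ≡ a ℚ.+ v ℚ.+ (t ℚ.- v)
    alg = solve-∀-in ringℚ
    eq : pair C (act C w p₀) (vec r) ≡ pair C p₀ (vec γ) ℚ.+ ι (ν γ) ℚ.+ ι (t - ν γ)
    eq = begin
      pair C (act C w p₀) (vec r)
        ≡⟨ pair-act w p₀ (vec r) ⟩
      pair C p₀ (actRoot C (reverse (linear w)) (vec r)) ℚ.+ ι t
        ≡⟨ cong (λ β → pair C p₀ β ℚ.+ ι t) (sym (vec-actOn (reverse (linear w)) r)) ⟩
      pair C p₀ (vec γ) ℚ.+ ι t
        ≡⟨ alg (pair C p₀ (vec γ)) (ι t) (ι (ν γ)) ⟩
      pair C p₀ (vec γ) ℚ.+ ι (ν γ) ℚ.+ (ι t ℚ.- ι (ν γ))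
        ≡⟨ cong (λ s → pair C p₀ (vec γ) ℚ.+ ι (ν γ) ℚ.+ s) (sym (trans (ι-+ t (- ν γ)) (cong (ι t ℚ.+_) (ι-neg
            (ν γ))))) ⟩
      pair C p₀ (vec γ) ℚ.+ ι (ν γ) ℚ.+ ι (t - ν γ) ∎

  inRegion-cong : ∀ {J x y} → x ≗ y → InRegionJ C J x → InRegionJ C J y
  inRegion-cong {x = x} e x∈ β root = subst InUnit (pair-cong {β = β} e (λ _ → refl)) (x∈ β root)

  ⟨⟩-+ˡ : ∀ m m′ β → ⟨ (λ k → m k + m′ k) , β ⟩ ≡ ⟨ m , β ⟩ + ⟨ m′ , β ⟩
  ⟨⟩-+ˡ m m′ β = trans (⟨⟩-cong {β = β} (λ k → alg (m k) (m′ k)) (λ _ → refl))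
    (trans (⟨⟩-shiftˡ m (- 1ℤ) m′ β) (sym (alg ⟨ m , β ⟩ ⟨ m′ , β ⟩)))
    where
    alg : ∀ x y → x + y ≡ x - (- 1ℤ) * y
    alg = solve-∀

  -- Generators are required only where m is nonzero, so for m in Q_J^∨ only indices in J occur.
  lattice-induction : (Q : V → Set) → (∀ {m m′} → m ≗ m′ → Q m → Q m′) → Q (λ _ → 0ℤ) →
    (∀ m m′ → Q m → Q m′ → Q (λ k → m k + m′ k)) →
    ∀ m → (∀ k → m k ≢ 0ℤ → Q (α k) × Q (neg (α k))) → Q m
  lattice-induction Q Q-cong Q0 Q+ m gen = Q-cong total (partial (λ k → k))
    where
    multiple : ∀ k → Q (α k) → Q (neg (α k)) → ∀ c → Q (λ i → c * α k i)
    multiple k q⁺ q⁻ (+ zero)       = Q-cong (λ i → sym (ℤ.*-zeroˡ (α k i))) Q0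
    multiple k q⁺ q⁻ +[1+ a ]       = Q-cong (λ i → alg (α k i) (+ a)) (Q+ _ _ q⁺ (multiple k q⁺ q⁻ (+ a)))
      where
      alg : ∀ x a → x + a * x ≡ (1ℤ + a) * x
      alg = solve-∀
    multiple k q⁺ q⁻ -[1+ zero ]    = Q-cong (λ i → sym (ℤ.-1*i≡-i (α k i))) q⁻
    multiple k q⁺ q⁻ -[1+ suc a ]   = Q-cong (λ i → alg (α k i) -[1+ a ]) (Q+ _ _ q⁻ (multiple k q⁺ q⁻ -[1+ a ]))
      where
      alg : ∀ x a → - x + a * x ≡ (- 1ℤ + a) * x
      alg = solve-∀
    term : ∀ k → Q (λ i → m k * α k i)
    term k with m k ℤ.≟ 0ℤ
    ... | yes e = Q-cong (λ i → sym (trans (cong (_* α k i) e) (ℤ.*-zeroˡ (α k i)))) Q0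
    ... | no ≢0 = multiple k (proj₁ (gen k ≢0)) (proj₂ (gen k ≢0)) (m k)
    partial : ∀ {l} (f : Fin l → Fin n) → Q (λ i → sumℤ (λ k → m (f k) * α (f k) i))
    partial {zero}  f = Q0
    partial {suc l} f = Q+ _ _ (term (f zero)) (partial (f ∘ suc))
    total : (λ i → sumℤ (λ k → m k * α k i)) ≗ m
    total i = trans (Σℤ.∑-single {n} i _ (λ k i≢k → trans (cong (m k *_) (α-offdiag (i≢k ∘ sym))) (ℤ.*-zeroʳ (m k))))
      (trans (cong (m i *_) (α-diag i)) (ℤ.*-identityʳ (m i)))

  InW̃J-++ : ∀ {J u v} → InW̃J C J u → InW̃J C J v → InW̃J C J (u ++ v)
  InW̃J-++ = All.++⁺

  Translates : Word C → V → Set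
  Translates g m = ∀ x β → pair C (act C g x) β ≡ pair C x β ℚ.+ ι ⟨ m , β ⟩

  translation-word : ∀ {J m} → SupportedIn J m → ∃[ g ] (InW̃J C J g × Translates g m)
  translation-word {J} {m} supp = lattice-induction Q Q-cong Q0 Q+ m gen
    where
    Q : V → Set
    Q m = ∃[ g ] (InW̃J C J g × Translates g m)
    Q-cong : ∀ {m m′} → m ≗ m′ → Q m → Q m′
    Q-cong e (g , g∈ , t) = g , g∈ , λ x β → trans (t x β) (cong (λ s → pair C x β ℚ.+ ι s) (⟨⟩-cong {β = β} e
        (λ _ → refl)))
    Q0 : Q (λ _ → 0ℤ)
    Q0 = [] , [] , pair-act []
    Q+ : ∀ m m′ → Q m → Q m′ → Q (λ k → m k + m′ k)
    Q+ m m′ (g , g∈ , t) (g′ , g′∈ , t′) = g ++ g′ , InW̃J-++ g∈ g′∈ , λ x β → begin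
      pair C (act C (g ++ g′) x) β                        ≡⟨ cong (λ y → pair C y β) (act-++ g g′ x) ⟩
      pair C (act C g′ (act C g x)) β                     ≡⟨ t′ (act C g x) β ⟩
      pair C (act C g x) β ℚ.+ ι ⟨ m′ , β ⟩               ≡⟨ cong (ℚ._+ ι ⟨ m′ , β ⟩) (t x β) ⟩
      pair C x β ℚ.+ ι ⟨ m , β ⟩ ℚ.+ ι ⟨ m′ , β ⟩         ≡⟨ ℚ.+-assoc (pair C x β) _ _ ⟩
      pair C x β ℚ.+ (ι ⟨ m , β ⟩ ℚ.+ ι ⟨ m′ , β ⟩)       ≡⟨ cong (pair C x β ℚ.+_) (sym (trans (cong ι
          (⟨⟩-+ˡ m m′ β)) (ι-+ ⟨ m , β ⟩ ⟨ m′ , β ⟩))) ⟩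
      pair C x β ℚ.+ ι ⟨ (λ k → m k + m′ k) , β ⟩         ∎
    gen : ∀ k → m k ≢ 0ℤ → Q (α k) × Q (neg (α k))
    gen k ≢0 = (tr+ k ∷ [] , supp k ≢0 ∷ [] , pair-tr+ k) ,
      (tr- k ∷ [] , supp k ≢0 ∷ [] , λ x β → trans (pair-tr- k x β) (cong (λ s → pair C x β ℚ.+ ι s) (sym (⟨⟩-negˡ
      (α k) β))))

  co-supported : ∀ {J} (r : Root) → SupportedIn J (vec r) → SupportedIn J (co r)
  co-supported r supp k ≢0 = supp k λ e → ≢0 (*-cancelˡ-0< (D-pos (typ r))
    (trans (prop r k) (trans (cong (D k *_) e) (trans (ℤ.*-zeroʳ (D k)) (sym (ℤ.*-zeroʳ (D (typ r))))))))

  Acts : Word C → (V → V) → (V → ℤ) → Set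
  Acts g F φ = ∀ x β → pair C (act C g x) β ≡ pair C x (F β) ℚ.+ ι (φ β)

  -- The element is s_{η,c}, the linear reflection followed by the translation by c η^∨. Both
  -- factors have words in J because η^∨ has the support of η.
  affine-reflection-word : ∀ {J} (η : Root) c → SupportedIn J (vec η) →
    ∃[ g ] (InW̃J C J g × Acts g refl[ co η , vec η ] (λ β → c * ⟨ co η , β ⟩))
  affine-reflection-word {J} η c supp =
    embed (reverse w) ++ t , InW̃J-++ (embed-All (reverse-InWJ w∈)) (proj₁ (proj₂ shift-word)) , λ x β → begin
        pair C (act C (embed (reverse w) ++ t) x) β
          ≡⟨ cong (λ y → pair C y β) (trans (act-++ (embed (reverse w)) t x) (cong (act C t) (act-embed
              (reverse w) x))) ⟩
        pair C (act C t (actW C (reverse w) x)) β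
          ≡⟨ t-acts (actW C (reverse w) x) β ⟩
        pair C (actW C (reverse w) x) β ℚ.+ ι ⟨ (λ k → 0ℤ - (- c) * co η k) , β ⟩
          ≡⟨ cong₂ (λ s t → s ℚ.+ ι t) (trans (pair-actW-reverse w x β) (pair-cong {x} (λ _ → refl) (w-refl β)))
               (trans (⟨⟩-shiftˡ (λ _ → 0ℤ) (- c) (co η) β) (trans (cong (λ t → t - (- c) * ⟨ co η , β ⟩)
               (⟨⟩-zeroˡ (λ _ → refl) β)) (alg c ⟨ co η , β ⟩))) ⟩
        pair C x (refl[ co η , vec η ] β) ℚ.+ ι (c * ⟨ co η , β ⟩) ∎
    where
    reflects : Reflects (_∈ J) η
    reflects = reflection-word η supp
    w = proj₁ reflects
    w∈ = proj₁ (proj₂ reflects)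
    w-refl = proj₂ (proj₂ reflects)
    shift-word = translation-word {J} {λ k → 0ℤ - (- c) * co η k}
      (supported-shift {β = λ _ → 0ℤ} (- c) (λ k ≢0 → ⊥-elim (≢0 refl)) (co-supported η supp))
    t = proj₁ shift-word
    t-acts = proj₂ (proj₂ shift-word)
    alg : ∀ c p → 0ℤ - (- c) * p ≡ c * p
    alg = solve-∀

  -- The affine reflection s_{η,c} moves A₀ only across the hyperplanes parallel to its own.
  Wall : Root → ℤ → Set
  Wall η c = ∀ (γ γ′ : Root) → vec γ′ ≗ refl[ co η , vec η ] (vec γ) →
    (vec γ ≗ vec η) ⊎ (vec γ ≗ neg (vec η)) ⊎ (ν γ′ ≡ ν γ + c * ⟨ co η , vec γ ⟩)

  -- A simple reflection preserves the sign of every root except plus or minus α_i, and at level 0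
  -- there is nothing else to compare.
  simple-wall : ∀ i → Wall (simpleRoot i) 0ℤ
  simple-wall i γ γ′ e with root-sign γ | root-sign γ′
  ... | inj₁ p | inj₁ p′ = inj₂ (inj₂ refl)
  ... | inj₂ q | inj₂ q′ = inj₂ (inj₂ refl)
  ... | inj₁ p | inj₂ q′ = inj₁ (proj₁ (only-αₖ-changes-sign γ i p
          (Neg-cong (λ k → trans (e k) (sym (reflRoot≗refl i (vec γ) k))) q′)))
  ... | inj₂ q | inj₁ p′ = inj₂ (inj₁ λ k → trans (sym (ℤ.neg-involutive (vec γ k)))
          (cong -_ (proj₁ (only-αₖ-changes-sign (negRoot γ) i (λ l → ℤ.neg-mono-≤ (q l))
            (neg-of-Pos (λ l → trans (reflRoot-neg i (vec γ) l)
              (cong -_ (trans (reflRoot≗refl i (vec γ) l) (sym (e l))))) p′)) k)))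

  -- Elements whose products with alcoves of 𝒜_J can be brought back.

  Returns : Subset n → Word C → Set
  Returns J g = ∀ w → LiesIn C J w → ∃[ v ] (InW̃J C J v × LiesIn C J (g ++ (w ++ v)))

  conjugate-pairing : ∀ w (η : Root) β →
    ⟨ co η , actRoot C (reverse w) β ⟩ ≡ ⟨ co (actOn w η) , β ⟩
  conjugate-pairing w η β = trans (⟨⟩-actRoot-reverse w (co η) β) (cong (λ m → ⟨ m , β ⟩) (sym (co-actOn w η)))

  conjugate-vec : ∀ w (η : Root) → actRoot C (reverse w) (vec (actOn w η)) ≗ vec η
  conjugate-vec w η k = trans (cong (λ β → actRoot C (reverse w) β k) (vec-actOn w η)) (actRoot-reverse w (vec η) k)

  -- If the mirror of s_{η,c}, carried along by w, belongs to Φ_J, then reflecting in it leads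
  -- back to w itself; otherwise the reflected alcove has not left 𝒜_J.
  wall⇒returns : ∀ {J η c g} → Acts g refl[ co η , vec η ] (λ β → c * ⟨ co η , β ⟩) → Wall η c → Returns J g
  wall⇒returns {J} {η} {c} {g} g-acts wall w lies
    with all? (λ k → (vec (actOn (linear w) η) k ℤ.≟ 0ℤ) ⊎-dec (k Subset.∈? J))
  ... | yes dec = v , v∈ , λ x x∈ → inRegion-cong (λ k → sym (back x k)) (lies x x∈)
    where
    w₀ = linear w
    m = translation w
    δ = actOn w₀ η
    supp : SupportedIn J (vec δ)
    supp k ≢0 with dec k
    ... | inj₁ e = ⊥-elim (≢0 e)
    ... | inj₂ k∈J = k∈J
    -- Carrying the hyperplane (x , η) = c along w turns η into δ and adds ⟨m , δ⟩ to the level.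
    reflection = affine-reflection-word δ (⟨ m , vec δ ⟩ + c) supp
    v = proj₁ reflection
    v∈ = proj₁ (proj₂ reflection)
    back : ∀ x → act C (g ++ (w ++ v)) x ≗ act C w x
    back x = pair-ext λ β → let q = ⟨ co δ , β ⟩
                                γ = actRoot C (reverse w₀) β
                                k = ⟨ m , vec δ ⟩ + c
                                sβ = refl[ co δ , vec δ ] β
                                γ₁≗ : actRoot C (reverse w₀) sβ ≗ shift γ q (vec η)
                                γ₁≗ = λ i → trans (actRoot-linear (reverse w₀) β q (vec δ) i)
                                        (cong (λ t → γ i - q * t) (conjugate-vec w₀ η i))
                                ηγ₁ : ⟨ co η , actRoot C (reverse w₀) sβ ⟩ ≡ - q
                                ηγ₁ = trans (conjugate-pairing w₀ η sβ) (trans (⟨⟩-shiftʳ (co δ) β q (vec δ))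
                                        (trans (cong (λ t → q - q * t) (two δ)) (alg₁ q)))
                                sγ₁ : refl[ co η , vec η ] (actRoot C (reverse w₀) sβ) ≗ γ
                                sγ₁ = λ i → trans (cong₂ (λ s t → s - t * vec η i) (γ₁≗ i) ηγ₁) (alg₂ (γ i) q (vec η i))
                            in begin
      pair C (act C (g ++ (w ++ v)) x) β
        ≡⟨ cong (λ y → pair C y β) (trans (act-++ g (w ++ v) x) (act-++ w v (act C g x))) ⟩
      pair C (act C v (act C w (act C g x))) β
        ≡⟨ proj₂ (proj₂ reflection) _ β ⟩
      pair C (act C w (act C g x)) sβ ℚ.+ ι (k * q)
        ≡⟨ cong (ℚ._+ ι (k * q)) (pair-act w (act C g x) sβ) ⟩
      pair C (act C g x) (actRoot C (reverse w₀) sβ) ℚ.+ ι ⟨ m , sβ ⟩ ℚ.+ ι (k * q)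
        ≡⟨ cong (λ t → t ℚ.+ ι ⟨ m , sβ ⟩ ℚ.+ ι (k * q)) (trans (g-acts x _)
             (cong₂ (λ s t → s ℚ.+ ι (c * t)) (pair-cong {x} (λ _ → refl) sγ₁) ηγ₁)) ⟩
      pair C x γ ℚ.+ ι (c * - q) ℚ.+ ι ⟨ m , sβ ⟩ ℚ.+ ι (k * q)
        ≡⟨ ι-collect (pair C x γ) (c * - q) ⟨ m , sβ ⟩ (k * q) ⟩
      pair C x γ ℚ.+ ι (c * - q + ⟨ m , sβ ⟩ + k * q)
        ≡⟨ cong (λ t → pair C x γ ℚ.+ ι t) (trans (cong (λ t → c * - q + t + k * q) (⟨⟩-shiftʳ m β q (vec δ)))
             (alg₃ c q ⟨ m , β ⟩ ⟨ m , vec δ ⟩)) ⟩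
      pair C x γ ℚ.+ ι ⟨ m , β ⟩
        ≡⟨ sym (pair-act w x β) ⟩
      pair C (act C w x) β ∎
      where
      alg₁ : ∀ q → q - q * + 2 ≡ - q
      alg₁ = solve-∀
      alg₂ : ∀ g q e → g - q * e - (- q) * e ≡ g
      alg₂ = solve-∀
      alg₃ : ∀ c q b d → c * - q + (b - q * d) + (d + c) * q ≡ b
      alg₃ = solve-∀
      alg₄ : ∀ p a b d → p ℚ.+ a ℚ.+ b ℚ.+ d ≡ p ℚ.+ (a ℚ.+ b ℚ.+ d)
      alg₄ = solve-∀-in ringℚ
      ι-collect : ∀ p a b d → p ℚ.+ ι a ℚ.+ ι b ℚ.+ ι d ≡ p ℚ.+ ι (a + b + d)
      ι-collect p a b d = trans (alg₄ p (ι a) (ι b) (ι d))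
        (cong (p ℚ.+_) (sym (trans (ι-+ (a + b) d) (cong (ℚ._+ ι d) (ι-+ a b)))))
  ... | no ¬supp = [] , [] , λ x x∈ → inRegion⁻ λ r p supp → subst InUnit (sym (value x r p supp)) (A₀-unit x∈ (γ′ r))
    where
    w₀ = linear w
    m = translation w
    δ = actOn w₀ η
    s-word = reflection-word {λ _ → ⊤} η (λ _ _ → tt)
    γ γ′ : Root → Root
    γ r = actOn (reverse w₀) r
    γ′ r = reflectBy η (proj₁ s-word) (proj₂ (proj₂ s-word)) (γ r)
    r≗ : ∀ r {ζ} → vec (γ r) ≗ ζ → vec r ≗ actRoot C w₀ ζ
    r≗ r e k = trans (sym (actRoot-reverse′ w₀ (vec r) k))
      (trans (cong (λ β → actRoot C w₀ β k) (sym (vec-actOn (reverse w₀) r))) (actRoot-cong w₀ e k))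
    zero-or-J : ∀ {a} k → (a ≡ 0ℤ → vec δ k ≡ 0ℤ) → (a ≢ 0ℤ → k ∈ J) → (vec δ k ≡ 0ℤ) ⊎ (k ∈ J)
    zero-or-J {a} k f h with a ℤ.≟ 0ℤ
    ... | yes e = inj₁ (f e)
    ... | no ≢0 = inj₂ (h ≢0)
    sign-rule : ∀ r → SupportedIn J (vec r) → ν (γ′ r) ≡ ν (γ r) + c * ⟨ co η , vec (γ r) ⟩
    sign-rule r supp with wall (γ r) (γ′ r) (λ _ → refl)
    ... | inj₂ (inj₂ e) = e
    ... | inj₁ e = ⊥-elim (¬supp λ k → zero-or-J k
            (λ z → trans (cong (λ f → f k) (vec-actOn w₀ η)) (trans (sym (r≗ r e k)) z)) (supp k))
    ... | inj₂ (inj₁ e) = ⊥-elim (¬supp λ k → zero-or-J k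
            (λ z → trans (cong (λ f → f k) (vec-actOn w₀ η)) (trans (sym (ℤ.neg-involutive _))
              (cong -_ (trans (sym (actRoot-neg w₀ (vec η) k)) (trans (sym (r≗ r e k)) z))))) (supp k))
    value : ∀ x r → Pos (vec r) → SupportedIn J (vec r) →
            pair C (act C (g ++ (w ++ [])) x) (vec r) ≡ pair C x (vec (γ′ r)) ℚ.+ ι (ν (γ′ r))
    value x r p supp = begin
      pair C (act C (g ++ (w ++ [])) x) (vec r)
        ≡⟨ cong (λ y → pair C y (vec r)) (trans (cong (λ w → act C (g ++ w) x) (List.++-identityʳ w)) (act-++ g w x)) ⟩
      pair C (act C w (act C g x)) (vec r)
        ≡⟨ pair-act w (act C g x) (vec r) ⟩
      pair C (act C g x) (actRoot C (reverse w₀) (vec r)) ℚ.+ ι ⟨ m , vec r ⟩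
        ≡⟨ cong₂ (λ β t → pair C (act C g x) β ℚ.+ ι t) (sym (vec-actOn (reverse w₀) r))
            (liesIn-value {J} {w} lies r p supp) ⟩
      pair C (act C g x) (vec (γ r)) ℚ.+ ι (ν (γ r))
        ≡⟨ cong (ℚ._+ ι (ν (γ r))) (g-acts x (vec (γ r))) ⟩
      pair C x (vec (γ′ r)) ℚ.+ ι (c * ⟨ co η , vec (γ r) ⟩) ℚ.+ ι (ν (γ r))
        ≡⟨ alg (pair C x (vec (γ′ r))) (ι (c * ⟨ co η , vec (γ r) ⟩)) (ι (ν (γ r))) ⟩
      pair C x (vec (γ′ r)) ℚ.+ (ι (ν (γ r)) ℚ.+ ι (c * ⟨ co η , vec (γ r) ⟩))
        ≡⟨ cong (pair C x (vec (γ′ r)) ℚ.+_) (sym (trans (cong ι (sign-rule r supp)) (ι-+ (ν (γ r)) _))) ⟩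
      pair C x (vec (γ′ r)) ℚ.+ ι (ν (γ′ r)) ∎
      where
      alg : ∀ a b d → a ℚ.+ b ℚ.+ d ≡ a ℚ.+ (d ℚ.+ b)
      alg = solve-∀-in ringℚ

  liesIn-cong : ∀ {J w w′} → (∀ x → act C w x ≗ act C w′ x) → LiesIn C J w → LiesIn C J w′
  liesIn-cong e lies x x∈ = inRegion-cong (e x) (lies x x∈)

  returns-++ : ∀ {J g h} → Returns J g → Returns J h → Returns J (g ++ h)
  returns-++ {J} {g} {h} rg rh w lies = v₁ ++ v₂ , InW̃J-++ {J} {v₁} (proj₁ (proj₂ step₁)) (proj₁ (proj₂ step₂)) ,
      subst (LiesIn C J) reassociate (proj₂ (proj₂ step₂))
    where
    step₁ = rh w lies
    v₁ = proj₁ step₁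
    step₂ = rg (h ++ (w ++ v₁)) (proj₂ (proj₂ step₁))
    v₂ = proj₁ step₂
    reassociate : g ++ ((h ++ (w ++ v₁)) ++ v₂) ≡ (g ++ h) ++ (w ++ (v₁ ++ v₂))
    reassociate = begin
      g ++ ((h ++ (w ++ v₁)) ++ v₂)    ≡⟨ cong (g ++_) (List.++-assoc h (w ++ v₁) v₂) ⟩
      g ++ (h ++ ((w ++ v₁) ++ v₂))    ≡⟨ cong (λ t → g ++ (h ++ t)) (List.++-assoc w v₁ v₂) ⟩
      g ++ (h ++ (w ++ (v₁ ++ v₂)))    ≡⟨ sym (List.++-assoc g h (w ++ (v₁ ++ v₂))) ⟩
      (g ++ h) ++ (w ++ (v₁ ++ v₂))    ∎

  returns-cong : ∀ {J g h} → (∀ x → act C g x ≗ act C h x) → Returns J g → Returns J h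
  returns-cong {J} {g} {h} e rg w lies = proj₁ step , proj₁ (proj₂ step) ,
      liesIn-cong {J} {g ++ (w ++ proj₁ step)} {h ++ (w ++ proj₁ step)} same (proj₂ (proj₂ step))
    where
    step = rg w lies
    same : ∀ x → act C (g ++ (w ++ proj₁ step)) x ≗ act C (h ++ (w ++ proj₁ step)) x
    same x k = trans (cong (λ f → f k) (act-++ g (w ++ proj₁ step) x))
      (trans (act-cong (w ++ proj₁ step) (e x) k) (cong (λ f → f k) (sym (act-++ h (w ++ proj₁ step) x))))

  -- A group element x ↦ x g, recorded through (x g , β) = (x , F β) + φ β.
  record Realized (J : Subset n) (F : V → V) (φ : V → ℤ) : Set where
    constructor realized
    field
      word        : Word C
      word-return : Returns J word
      word-acts   : Acts word F φ
  open Realized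

  acts-++ : ∀ {g h F G φ ψ} → Acts g F φ → Acts h G ψ → Acts (g ++ h) (F ∘ G) (λ β → φ (G β) + ψ β)
  acts-++ {g} {h} {F} {G} {φ} {ψ} ag ah x β = begin
    pair C (act C (g ++ h) x) β                                ≡⟨ cong (λ y → pair C y β) (act-++ g h x) ⟩
    pair C (act C h (act C g x)) β                             ≡⟨ ah (act C g x) β ⟩
    pair C (act C g x) (G β) ℚ.+ ι (ψ β)                       ≡⟨ cong (ℚ._+ ι (ψ β)) (ag x (G β)) ⟩
    pair C x (F (G β)) ℚ.+ ι (φ (G β)) ℚ.+ ι (ψ β)             ≡⟨ ℚ.+-assoc (pair C x (F (G β))) _ _ ⟩
    pair C x (F (G β)) ℚ.+ (ι (φ (G β)) ℚ.+ ι (ψ β))           ≡⟨ cong (pair C x (F (G β)) ℚ.+_) (sym (ι-+ (φ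
        (G β)) (ψ β))) ⟩
    pair C x (F (G β)) ℚ.+ ι (φ (G β) + ψ β)                   ∎

  realized-∘ : ∀ {J F G φ ψ} → Realized J F φ → Realized J G ψ → Realized J (F ∘ G) (λ β → φ (G β) + ψ β)
  realized-∘ {J} {F} {G} {φ} {ψ} (realized g rg ag) (realized h rh ah) =
    realized (g ++ h) (returns-++ {J} {g} {h} rg rh) (acts-++ {g} {h} {F} {G} {φ} {ψ} ag ah)

  realized-cong : ∀ {J F G φ ψ} → (∀ β → F β ≗ G β) → (∀ β → φ β ≡ ψ β) → Realized J F φ → Realized J G ψ
  realized-cong e f (realized g rg ag) = realized g rg λ x β → trans (ag x β)
    (cong₂ (λ s t → s ℚ.+ ι t) (pair-cong {x} (λ _ → refl) (e β)) (f β))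

  realized-wall : ∀ {J} (η : Root) c → Wall η c → Realized J refl[ co η , vec η ] (λ β → c * ⟨ co η , β ⟩)
  realized-wall {J} η c wall = realized (proj₁ reflection)
      (wall⇒returns {J} {η} {c} {proj₁ reflection} (proj₂ (proj₂ reflection)) wall) (proj₂ (proj₂ reflection))
    where
    reflection = affine-reflection-word {Subset.⊤} η c (λ _ _ → Subset.∈⊤)

  realized-simple : ∀ {J} j → Realized J (reflRoot C j) (λ _ → 0ℤ)
  realized-simple {J} j = realized-cong {J} {refl[ α j , α j ]} {reflRoot C j} (λ β k → sym (reflRoot≗refl j β k))
      (λ β → ℤ.*-zeroˡ ⟨ α j , β ⟩)
    (realized-wall (simpleRoot j) 0ℤ (simple-wall j))

  realized-id : ∀ {J} → Realized J (λ β → β) (λ _ → 0ℤ)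
  realized-id {J} = realized [] (λ w lies → [] , [] , subst (LiesIn C J) (sym (List.++-identityʳ w)) lies)
    λ x β → sym (ℚ.+-identityʳ (pair C x β))

  realized-W : ∀ {J} c → Realized J (actRoot C c) (λ _ → 0ℤ)
  realized-W {J} []      = realized-id
  realized-W {J} (j ∷ c) = realized-∘ {J} {actRoot C c} {reflRoot C j} (realized-W c) (realized-simple j)

  realized-reflection : ∀ {J} (η : Root) → Realized J refl[ co η , vec η ] (λ _ → 0ℤ)
  realized-reflection {J} η = realized-cong {J} {actRoot C (proj₁ reflects)} {refl[ co η , vec η ]} (proj₂
      (proj₂ reflects)) (λ _ → refl) (realized-W (proj₁ reflects))
    where
    reflects : Reflects (λ _ → ⊤) η
    reflects = reflection-word η (λ _ _ → tt)

  Translation : Subset n → V → Set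
  Translation J m = Realized J (λ β → β) (λ β → ⟨ m , β ⟩)

  translation-cong : ∀ {J m m′} → m ≗ m′ → Translation J m → Translation J m′
  translation-cong {J} e = realized-cong {J} {λ β → β} (λ _ _ → refl) (λ β → ⟨⟩-cong {β = β} e (λ _ → refl))

  translation-+ : ∀ {J m m′} → Translation J m → Translation J m′ → Translation J (λ k → m k + m′ k)
  translation-+ {J} {m} {m′} t t′ = realized-cong {J} {λ β → β} (λ _ _ → refl) (λ β → sym (⟨⟩-+ˡ m m′ β))
    (realized-∘ {J} {λ β → β} {λ β → β} t t′)

  -- Conjugation: s_η t_m s_η is the translation by the reflected vector.
  translation-reflect : ∀ {J m} (η : Root) → Translation J m → Translation J (shift m ⟨ m , vec η ⟩ (co η))
  translation-reflect {J} {m} η t = realized-cong {J} {s ∘ s} (refl-involutive η) φ≡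
      (realized-∘ {J} {s} {s} (realized-reflection η) (realized-∘ {J} {λ β → β} {s} t (realized-reflection η)))
    where
    s = refl[ co η , vec η ]
    alg : ∀ a b c → 0ℤ + (a - b * c + 0ℤ) ≡ a - c * b
    alg = solve-∀
    φ≡ : ∀ β → 0ℤ + (⟨ m , s β ⟩ + 0ℤ) ≡ ⟨ shift m ⟨ m , vec η ⟩ (co η) , β ⟩
    φ≡ β = trans (cong (λ t → 0ℤ + (t + 0ℤ)) (⟨⟩-shiftʳ m β ⟨ co η , β ⟩ (vec η)))
      (trans (alg ⟨ m , β ⟩ ⟨ co η , β ⟩ ⟨ m , vec η ⟩) (sym (⟨⟩-shiftˡ m ⟨ m , vec η ⟩ (co η) β)))

  translation-reflCo : ∀ {J m} j → Translation J m → Translation J (reflCo j m)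
  translation-reflCo {J} {m} j t = translation-cong (λ k → sym (reflCo-shift j m k)) (translation-reflect
      (simpleRoot j) t)

  reflCo-involutive : ∀ j m → reflCo j (reflCo j m) ≗ m
  reflCo-involutive j m k = begin
    reflCo j m k - ⟨ reflCo j m ,α j ⟩ * α j k
      ≡⟨ cong (λ t → reflCo j m k - t * α j k) (trans (sym (⟨⟩-αʳ (reflCo j m) j))
           (trans (⟨⟩-cong {β = α j} (reflCo-shift j m) (λ _ → refl)) (⟨⟩-shiftˡ m ⟨ m , α j ⟩ (α j) (α j)))) ⟩
    m k - ⟨ m ,α j ⟩ * α j k - (⟨ m , α j ⟩ - ⟨ m , α j ⟩ * ⟨ α j , α j ⟩) * α j k
      ≡⟨ cong₂ (λ s t → m k - ⟨ m ,α j ⟩ * α j k - (s - s * t) * α j k) (⟨⟩-αʳ m j) (⟨α,α⟩≡2 j) ⟩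
    m k - ⟨ m ,α j ⟩ * α j k - (⟨ m ,α j ⟩ - ⟨ m ,α j ⟩ * + 2) * α j k
      ≡⟨ alg (m k) ⟨ m ,α j ⟩ (α j k) ⟩
    m k ∎
    where
    alg : ∀ x c a → x - c * a - (c - c * + 2) * a ≡ x
    alg = solve-∀

  translation-unact : ∀ {J m} w → Translation J (actCo w m) → Translation J m
  translation-unact         []      t = t
  translation-unact {m = m} (j ∷ w) t = translation-cong (reflCo-involutive j m) (translation-reflCo j
      (translation-unact w t))

  -- Reflecting η^∨ in η itself gives -η^∨, which supplies inverse translations from closure under
  -- products alone.
  translation-negRoot : ∀ {J} (η : Root) → Translation J (co η) → Translation J (neg (co η))
  translation-negRoot η t = translation-cong (λ k → trans (cong (λ s → co η k - s * co η k) (two η)) (sym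
      (neg≗shift (co η) k)))
    (translation-reflect η t)

  -- `typ` is stored data and may differ between two records of one root; comparing the squared
  -- lengths shows that the two values of D agree.
  co-unique : (r r′ : Root) → vec r ≗ vec r′ → co r ≗ co r′
  co-unique r r′ e k = *-cancelˡ-0< (D-pos (typ r)) (begin
      D (typ r) * co r k       ≡⟨ trans (prop r k) (cong (D k *_) (e k)) ⟩
      D k * vec r′ k           ≡⟨ sym (prop r′ k) ⟩
      D (typ r′) * co r′ k     ≡⟨ cong (_* co r′ k) (sym D≡) ⟩
      D (typ r) * co r′ k      ∎)
    where
    D≡ : D (typ r) ≡ D (typ r′)
    D≡ = ℤ.*-cancelʳ-≡ _ _ (+ 2) (begin
      D (typ r) * + 2                      ≡⟨ cong (D (typ r) *_) (sym (trans (⟨⟩-cong {co r} (λ _ → refl)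
          (λ k → sym (e k))) (two r))) ⟩
      D (typ r) * ⟨ co r , vec r′ ⟩        ≡⟨ bform-reflection r r′ ⟩
      D (typ r′) * ⟨ co r′ , vec r ⟩       ≡⟨ cong (D (typ r′) *_) (trans (⟨⟩-cong {co r′} (λ _ → refl) e) (two r′)) ⟩
      D (typ r′) * + 2                     ∎)

  module _ (θ : Root) (θ-pos : Pos (vec θ)) (θ-dominant : Dominant (vec θ))
           (θ-long : ∀ (γ : Root) → D (typ γ) ≤ D (typ θ)) where

    open HighestRoot θ θ-pos θ-dominant θ-long

    data Small : ℤ → Set where
      zero : Small 0ℤ
      one  : Small 1ℤ
      big  : ∀ {q} → + 2 ≤ q → Small q

    small : ∀ {q} → 0ℤ ≤ q → Small q
    small {+ 0}           _ = zero
    small {+ 1}           _ = one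
    small {+ suc (suc q)} _ = big (+≤+ (ℕ.s≤s (ℕ.s≤s ℕ.z≤n)))

    ReflectsSmall : Root → Root → Set
    ReflectsSmall γ γ′ = (⟨ co θ , vec γ ⟩ ≡ 0ℤ × vec γ′ ≗ vec γ) ⊎ (⟨ co θ , vec γ ⟩ ≡ 1ℤ × Neg (vec γ′))

    -- A pairing of 0 leaves γ fixed. A pairing of 1 gives γ - θ, negative because θ is highest. A
    -- pairing of 2 or more leaves only γ = θ because θ is long.
    θ-wall-pos : ∀ γ γ′ → Pos (vec γ) → vec γ′ ≗ refl[ co θ , vec θ ] (vec γ) → (vec γ ≗ vec θ) ⊎ ReflectsSmall γ γ′
    θ-wall-pos γ γ′ p e = cases (small (dominant-pairing θ θ-dominant p)) refl
      where
      cases : ∀ {q} → Small q → q ≡ ⟨ co θ , vec γ ⟩ → (vec γ ≗ vec θ) ⊎ ReflectsSmall γ γ′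
      cases zero q≡ = inj₂ (inj₁ (sym q≡ , λ k → trans (e k) (trans (cong (λ t → vec γ k - t * vec θ k) (sym q≡))
        (alg (vec γ k) (vec θ k)))))
        where
        alg : ∀ x y → x - 0ℤ * y ≡ x
        alg = solve-∀
      cases one q≡ = inj₂ (inj₂ (sym q≡ , λ k → subst (_≤ 0ℤ) (sym (trans (e k) (trans (cong
          (λ t → vec γ k - t * vec θ k) (sym q≡))
        (cong (λ t → vec γ k - t) (ℤ.*-identityˡ (vec θ k)))))) (ℤ.i≤j⇒i-j≤0 (root≤θ γ k))))
      cases (big 2≤q) q≡ = inj₁ (long-pairing-≥2⇒equal θ γ (θ-long γ) (subst (+ 2 ≤_) q≡ 2≤q))

    θ-wall : Wall θ 1ℤ
    θ-wall γ γ′ e with root-sign γ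
    ... | inj₁ p with θ-wall-pos γ γ′ p e
    ...   | inj₁ eq = inj₁ eq
    ...   | inj₂ (inj₁ (q≡0 , same)) = inj₂ (inj₂ (trans (ν-pos γ′ (Pos-cong (λ k → sym (same k)) p))
              (cong (λ t → 0ℤ + 1ℤ * t) (sym q≡0))))
    ...   | inj₂ (inj₂ (q≡1 , q′)) = inj₂ (inj₂ (trans (ν-neg γ′ q′) (cong (λ t → 0ℤ + 1ℤ * t) (sym q≡1))))
    θ-wall γ γ′ e | inj₂ q
      with θ-wall-pos (negRoot γ) (negRoot γ′) (λ k → ℤ.neg-mono-≤ (q k))
             (λ k → trans (cong -_ (e k)) (trans (alg (vec γ k) ⟨ co θ , vec γ ⟩ (vec θ k))
               (cong (λ t → - vec γ k - t * vec θ k) (sym (⟨⟩-negʳ (co θ) (vec γ))))))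
      where
      alg : ∀ x c y → - (x - c * y) ≡ - x - (- c) * y
      alg = solve-∀
    ...   | inj₁ eq = inj₂ (inj₁ λ k → trans (sym (ℤ.neg-involutive (vec γ k))) (cong -_ (eq k)))
    ...   | inj₂ (inj₁ (q≡0 , same)) = inj₂ (inj₂ (trans (ν-neg γ′ (Neg-cong (λ k → sym (ℤ.neg-injective (same k))) q))
              (cong (λ t → 1ℤ + 1ℤ * t) (sym (ℤ.neg-injective {⟨ co θ , vec γ ⟩} {0ℤ} (trans (sym (⟨⟩-negʳ (co θ)
              (vec γ))) q≡0))))))
    ...   | inj₂ (inj₂ (q≡1 , q′)) = inj₂ (inj₂ (trans (ν-pos γ′ (Pos-neg (λ k → sym (ℤ.neg-involutive (vec γ′ k))) q′))
              (cong (λ t → 1ℤ + 1ℤ * t) (sym (ℤ.neg-injective {⟨ co θ , vec γ ⟩} { - 1ℤ} (trans (sym (⟨⟩-negʳ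
              (co θ) (vec γ))) q≡1))))))

    -- With s_0 = s_θ t_{θ^∨}, the product s_θ s_0 is the translation by θ^∨.
    translation-θ : ∀ {J} → Translation J (co θ)
    translation-θ {J} = realized-cong {J} {s ∘ s} (refl-involutive θ) (λ β → trans (ℤ.+-identityˡ _)
        (ℤ.*-identityˡ ⟨ co θ , β ⟩))
        (realized-∘ {J} {s} {s} (realized-reflection θ) (realized-wall θ 1ℤ θ-wall))
      where
      s = refl[ co θ , vec θ ]

    translation-α : ∀ {J} j → Translation J (α j)
    translation-α {J} j = translation-unact w (subst (Translation J) (co-actOn w (simpleRoot j)) translation-γ)
      where
      climbed = climb (simpleRoot j) (α-pos j)
      w = proj₁ climbed
      γ = actOn w (simpleRoot j)
      γ-pos : Pos (vec γ)
      γ-pos k = ℤ.≤-trans (α-pos j k) (proj₁ (proj₂ (proj₂ climbed)) k)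
      translation-γ : Translation J (co γ)
      translation-γ with dominant-cases γ γ-pos (proj₁ (proj₂ climbed))
      ... | inj₂ e   = translation-cong (co-unique θ γ (λ k → sym (e k))) translation-θ
      ... | inj₁ q≡1 = translation-cong (λ k → trans (cong (λ t → co θ k + (- co θ k - t * co γ k))
              (trans (⟨⟩-negˡ (co θ) (vec γ)) (cong -_ q≡1))) (alg (co θ k) (co γ k)))
            (translation-+ translation-θ (translation-reflect γ (translation-negRoot θ translation-θ)))
        where
        alg : ∀ x y → x + (- x - (- 1ℤ) * y) ≡ y
        alg = solve-∀

  translation-simple : ∀ {J} k → Translation J (α k)
  translation-simple k = let θ , θ-pos , θ-dominant , θ-long = long-dominant-root k in
    translation-α θ θ-pos θ-dominant θ-long k

  returns-acts : ∀ {J F φ g} → Acts g F φ → Realized J F φ → Returns J g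
  returns-acts {J} {F} {φ} {g} acts (realized h rh ah) = returns-cong {J} {h} {g}
    (λ x → pair-ext (λ β → trans (ah x β) (sym (acts x β)))) rh

  returns-gen : ∀ {J} g → Returns J (g ∷ [])
  returns-gen (refl-s j) = returns-acts {F = reflRoot C j} {λ _ → 0ℤ} {g = refl-s j ∷ []} (λ x β → trans
      (pair-refl-s j x β)
    (sym (ℚ.+-identityʳ (pair C x (reflRoot C j β))))) (realized-simple j)
  returns-gen (tr+ k) = returns-acts {F = λ β → β} {λ β → ⟨ α k , β ⟩} {g = tr+ k ∷ []} (pair-tr+ k)
      (translation-simple k)
  returns-gen {J} (tr- k) = returns-acts {J} {λ β → β} {λ β → - ⟨ α k , β ⟩} {tr- k ∷ []} (pair-tr- k)
    (realized-cong {J} {λ β → β} (λ _ _ → refl) (⟨⟩-negˡ (α k)) (translation-negRoot (simpleRoot k)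
    (translation-simple k)))

  returns : ∀ {J} w → Returns J w
  returns {J} []      = word-return (realized-id {J})
  returns {J} (g ∷ w) = returns-++ {J} {g ∷ []} {w} (returns-gen g) (returns w)

  -- The bullet map: existence, well-definedness, injectivity, surjectivity.

  liesIn-[] : ∀ {J} → LiesIn C J []
  liesIn-[] x x∈ = inRegion⁻ (λ r p _ → inA0 x∈ r p)

  translate≗act : ∀ {g m} → Translates g m → ∀ x → act C g x ≗ translate C m x
  translate≗act {g} {m} t x = pair-ext (λ β → trans (t x β) (sym (pair-translate m x β)))

  bullet-exists : ∀ J u m → ∃[ w ] IsBullet C J u m w
  bullet-exists J u m = (embed u ++ proj₁ t) ++ ([] ++ v) , proj₂ (proj₂ step) , v , proj₁ (proj₂ step) , λ x k →
      trans (cong (λ f → f k) (trans (act-++ (embed u ++ proj₁ t) v x) (cong (act C v) (trans (act-++ (embed u)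
          (proj₁ t) x)
        (cong (act C (proj₁ t)) (act-embed u x))))))
        (act-cong v (translate≗act {proj₁ t} {m} (proj₂ (proj₂ t)) (actW C u x)) k)
    where
    t = translation-word {Subset.⊤} {m} (λ _ _ → Subset.∈⊤)
    -- The element u t_α is multiplied onto the identity, whose alcove A₀ lies in 𝒜_J.
    step = returns {J} (embed u ++ proj₁ t) [] (liesIn-[] {J})
    v = proj₁ step

  pair-bullet : ∀ u m v x β → pair C (act C v (translate C m (actW C u x))) β ≡
    pair C (actW C u x) (actRoot C (reverse (linear v)) β) ℚ.+ ι (⟨ m , actRoot C (reverse
        (linear v)) β ⟩ + ⟨ translation v , β ⟩)
  pair-bullet u m v x β = begin
    pair C (act C v (translate C m y)) β
      ≡⟨ pair-act v (translate C m y) β ⟩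
    pair C (translate C m y) γ ℚ.+ ι ⟨ translation v , β ⟩
      ≡⟨ cong (ℚ._+ ι ⟨ translation v , β ⟩) (pair-translate m y γ) ⟩
    pair C y γ ℚ.+ ι ⟨ m , γ ⟩ ℚ.+ ι ⟨ translation v , β ⟩
      ≡⟨ trans (ℚ.+-assoc (pair C y γ) _ _) (cong (pair C y γ ℚ.+_) (sym (ι-+ ⟨ m , γ ⟩ ⟨ translation v , β ⟩))) ⟩
    pair C y γ ℚ.+ ι (⟨ m , γ ⟩ + ⟨ translation v , β ⟩) ∎
    where
    y = actW C u x
    γ = actRoot C (reverse (linear v)) β

  ⟨⟩-actRoot-adjoint : ∀ w m β → ⟨ m , actRoot C w β ⟩ ≡ ⟨ actCo (reverse w) m , β ⟩
  ⟨⟩-actRoot-adjoint w m β = trans (cong (λ t → ⟨ m , actRoot C t β ⟩) (sym (List.reverse-involutive w)))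
    (⟨⟩-actRoot-reverse (reverse w) m β)

  ⟨⟩-difference : ∀ m m′ β → ⟨ (λ k → m k - m′ k) , β ⟩ ≡ ⟨ m , β ⟩ - ⟨ m′ , β ⟩
  ⟨⟩-difference m m′ β = trans (⟨⟩-cong {β = β} (λ k → cong (λ t → m k - t) (sym (ℤ.*-identityˡ (m′ k)))) (λ _ → refl))
    (trans (⟨⟩-shiftˡ m 1ℤ m′ β) (cong (λ t → ⟨ m , β ⟩ - t) (ℤ.*-identityˡ ⟨ m′ , β ⟩)))

  -- w⁻¹ w′ = v⁻¹ t_{m′-m} v′ lies in W̃_J because m′ - m is in Q_J^∨, and it carries one alcove in
  -- 𝒜_J to another, so `alcove-free` makes it trivial.
  bullet-well-defined : ∀ J u u′ m m′ w w′ → _≈W_ C u u′ → _≡[_]_ C m J m′ →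
    IsBullet C J u m w → IsBullet C J u′ m′ w′ → _≈_ C w w′
  bullet-well-defined J u u′ m m′ w w′ u≈u′ m≡m′ (lies , v , v∈ , e) (lies′ , v′ , v′∈ , e′) x =
      pair-ext (λ β → sym (trans (difference x β) (trans (cong₂ (λ s t → s ℚ.+ ι t)
        (pair-cong {act C w x} (λ _ → refl) (proj₁ free β)) (⟨⟩-zeroˡ (proj₂ free) β)) (ℚ.+-identityʳ (pair C
        (act C w x) β)))))
    where
    v₀ = linear v
    v₀′ = linear v′
    t = translation v
    t′ = translation v′
    -- The transpose of the linear part of w⁻¹ w′, acting on roots; μ below is its translation part,
    -- (-t) v₀⁻¹ v₀′ + (m′ - m) v₀′ + t′.
    c = reverse v₀′ ++ v₀
    c∈ : InWJ C J c
    c∈ = All.++⁺ (reverse-InWJ (linear-InWJ v′∈)) (linear-InWJ v∈)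
    μ = shift (shift t′ 1ℤ (actCo (reverse c) t)) 1ℤ (actCo v₀′ (λ k → m k - m′ k))
    μ∈ : SupportedIn J μ
    μ∈ = supported-shift 1ℤ (supported-shift 1ℤ (translation-supported v′∈) (supported-actCo (reverse-InWJ c∈)
        (translation-supported v∈)))
           (supported-actCo (linear-InWJ v′∈) m≡m′)
    difference : ∀ x β → pair C (act C w′ x) β ≡ pair C (act C w x) (actRoot C c β) ℚ.+ ι ⟨ μ , β ⟩
    difference x β = begin
      pair C (act C w′ x) β
        ≡⟨ trans (pair-cong {β = β} (e′ x) (λ _ → refl)) (pair-bullet u′ m′ v′ x β) ⟩
      pair C (actW C u′ x) γ ℚ.+ ι (⟨ m′ , γ ⟩ + ⟨ t′ , β ⟩)
        ≡⟨ cong₂ (λ s z → s ℚ.+ ι z) (pair-cong {β = γ} (λ k → sym (u≈u′ x k)) (λ _ → refl))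
             (trans (alg ⟨ m′ , γ ⟩ ⟨ t′ , β ⟩ ⟨ m , γ ⟩ ⟨ t , cβ ⟩) (cong (λ z → ⟨ m , γ ⟩ + ⟨ t , cβ ⟩ + z)
             (sym ⟨μ,β⟩))) ⟩
      pair C (actW C u x) γ ℚ.+ ι (⟨ m , γ ⟩ + ⟨ t , cβ ⟩ + ⟨ μ , β ⟩)
        ≡⟨ trans (cong (pair C (actW C u x) γ ℚ.+_) (ι-+ (⟨ m , γ ⟩ + ⟨ t , cβ ⟩) ⟨ μ , β ⟩)) (sym (ℚ.+-assoc
            (pair C (actW C u x) γ) _ _)) ⟩
      pair C (actW C u x) γ ℚ.+ ι (⟨ m , γ ⟩ + ⟨ t , cβ ⟩) ℚ.+ ι ⟨ μ , β ⟩
        ≡⟨ cong (ℚ._+ ι ⟨ μ , β ⟩) (sym (trans (pair-cong {β = cβ} (e x) (λ _ → refl)) (trans (pair-bullet u m v x cβ)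
             (cong₂ (λ s z → s ℚ.+ ι (z + ⟨ t , cβ ⟩)) (pair-cong {actW C u x} (λ _ → refl) back) (⟨⟩-cong {m}
             (λ _ → refl) back))))) ⟩
      pair C (act C w x) cβ ℚ.+ ι ⟨ μ , β ⟩ ∎
      where
      γ = actRoot C (reverse v₀′) β
      cβ = actRoot C c β
      back : actRoot C (reverse v₀) cβ ≗ γ
      back k = trans (cong (λ f → actRoot C (reverse v₀) f k) (actRoot-++ (reverse v₀′) v₀ β)) (actRoot-reverse v₀ γ k)
      alg : ∀ m′ t′ m t → m′ + t′ ≡ m + t + (t′ - 1ℤ * t - 1ℤ * (m - m′))
      alg = solve-∀
      ⟨μ,β⟩ : ⟨ μ , β ⟩ ≡ ⟨ t′ , β ⟩ - 1ℤ * ⟨ t , cβ ⟩ - 1ℤ * (⟨ m , γ ⟩ - ⟨ m′ , γ ⟩)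
      ⟨μ,β⟩ = trans (⟨⟩-shiftˡ (shift t′ 1ℤ (actCo (reverse c) t)) 1ℤ (actCo v₀′ (λ k → m k - m′ k)) β)
        (cong₂ (λ s z → s - 1ℤ * z)
          (trans (⟨⟩-shiftˡ t′ 1ℤ (actCo (reverse c) t) β) (cong (λ z → ⟨ t′ , β ⟩ - 1ℤ * z) (sym
          (⟨⟩-actRoot-adjoint c t β))))
          (trans (sym (⟨⟩-actRoot-reverse v₀′ (λ k → m k - m′ k) β)) (⟨⟩-difference m m′ γ)))
    free : (∀ β → actRoot C c β ≗ β) × (∀ k → μ k ≡ 0ℤ)
    free = alcove-free {J} {act C w p₀} {act C w′ p₀} {c} {μ} (lies p₀ p₀∈A₀) (lies′ p₀ p₀∈A₀) c∈ μ∈ (difference p₀)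

  -- Comparing linear parts gives u v₀ = u′ v₀′, so u and u′ share a coset and coincide by
  -- uniqueness of the positive element. Then v₀ = v₀′, and comparing translations leaves m - m′ in
  -- Q_J^∨.
  bullet-injective : ∀ J u u′ m m′ w w′ → IsMinRep C J u → IsMinRep C J u′ →
    IsBullet C J u m w → IsBullet C J u′ m′ w′ → _≈_ C w w′ → _≈W_ C u u′ × _≡[_]_ C m J m′
  bullet-injective J u u′ m m′ w w′ min min′ (lies , v , v∈ , e) (lies′ , v′ , v′∈ , e′) w≈w′ =
      (λ x k → trans (sym (trivial (actW C u x) k)) (sym (u′≗ x k))) , supported-cong (λ k → sym (m-m′≗σ k)) σ∈
    where
    v₀ = linear v
    v₀′ = linear v′
    t = translation v
    t′ = translation v′
    A A′ : V → ℤ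
    A β = ⟨ m , actRoot C (reverse v₀) β ⟩ + ⟨ t , β ⟩
    A′ β = ⟨ m′ , actRoot C (reverse v₀′) β ⟩ + ⟨ t′ , β ⟩
    agree : ∀ x β → pair C (actW C u x) (actRoot C (reverse v₀) β) ℚ.+ ι (A β)
                  ≡ pair C (actW C u′ x) (actRoot C (reverse v₀′) β) ℚ.+ ι (A′ β)
    agree x β = trans (sym (pair-bullet u m v x β)) (trans (pair-cong {β = β} (λ k → trans (sym (e x k)) (trans
        (w≈w′ x k) (e′ x k))) (λ _ → refl))
      (pair-bullet u′ m′ v′ x β))
    pair-origin : ∀ u β → pair C (actW C u (λ _ → 0ℚ)) β ≡ 0ℚ
    pair-origin u β = trans (pair-actW u (λ _ → 0ℚ) β) (Σℚ.∑-zero {n} (λ i → ℚ.*-zeroʳ (ι (actRoot C (reverse u) β i))))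
    -- At the origin the linear parts contribute nothing, which separates the translation parts.
    A≡A′ : ∀ β → A β ≡ A′ β
    A≡A′ β = ι-injective (trans (sym (at-origin u (actRoot C (reverse v₀) β) (A β)))
        (trans (agree (λ _ → 0ℚ) β) (at-origin u′ (actRoot C (reverse v₀′) β) (A′ β))))
      where
      at-origin : ∀ u γ a → pair C (actW C u (λ _ → 0ℚ)) γ ℚ.+ ι a ≡ ι a
      at-origin u γ a = trans (cong (ℚ._+ ι a) (pair-origin u γ)) (ℚ.+-identityˡ (ι a))
    linear-agree : ∀ x β → pair C (actW C u x) (actRoot C (reverse v₀) β) ≡ pair C (actW C u′ x) (actRoot C
        (reverse v₀′) β)
    linear-agree x β = trans (alg _ (ι (A β))) (trans (cong₂ ℚ._-_ (agree x β) (cong ι (A≡A′ β))) (sym (alg _ (ι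
        (A′ β)))))
      where
      alg : ∀ p a → p ≡ p ℚ.+ a ℚ.- a
      alg = solve-∀-in ringℚ
    c = v₀ ++ reverse v₀′
    c∈ : InWJ C J c
    c∈ = All.++⁺ (linear-InWJ v∈) (reverse-InWJ (linear-InWJ v′∈))
    pair-c : ∀ y β → pair C (actW C c y) β ≡ pair C y (actRoot C (reverse v₀) (actRoot C v₀′ β))
    pair-c y β = trans (cong (λ z → pair C z β) (actW-++ v₀ (reverse v₀′) y))
      (trans (pair-actW-reverse v₀′ (actW C v₀ y) β) (pair-actW v₀ y (actRoot C v₀′ β)))
    u′≗ : ∀ x → actW C u′ x ≗ actW C c (actW C u x)
    u′≗ x = pair-ext (λ β → sym (trans (pair-c (actW C u x) β) (trans (linear-agree x (actRoot C v₀′ β))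
      (pair-cong {actW C u′ x} (λ _ → refl) (actRoot-reverse v₀′ β)))))
    trivial : ∀ y → actW C c y ≗ y
    trivial = positive-unique {J} {u} {u′} {c} (minRep⇒positive {J} {u} min) (minRep⇒positive {J} {u′} min′) c∈ u′≗
    v₀≗v₀′ : ∀ β → actRoot C (reverse v₀) β ≗ actRoot C (reverse v₀′) β
    v₀≗v₀′ β k = trans (actRoot-cong (reverse v₀) (λ l → sym (actRoot-reverse′ v₀′ β l)) k)
      (pair-determines {actRoot C (reverse v₀) (actRoot C v₀′ (actRoot C (reverse v₀′) β))} {actRoot C
      (reverse v₀′) β} (λ x → trans (sym (pair-c x (actRoot C (reverse v₀′) β))) (pair-cong {β = actRoot C
      (reverse v₀′) β} (trivial x) (λ _ → refl))) k)
    -- Solving m v₀ + t = m′ v₀ + t′ gives m - m′ = (t′ - t) v₀⁻¹.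
    σ = actCo (reverse v₀) (shift t′ 1ℤ t)
    σ∈ : SupportedIn J σ
    σ∈ = supported-actCo (reverse-InWJ (linear-InWJ v∈)) (supported-shift 1ℤ (translation-supported v′∈)
        (translation-supported v∈))
    ⟨m-m′⟩ : ∀ γ → ⟨ (λ k → m k - m′ k) , γ ⟩ ≡ ⟨ σ , γ ⟩
    ⟨m-m′⟩ γ = begin
      ⟨ (λ k → m k - m′ k) , γ ⟩
        ≡⟨ trans (⟨⟩-difference m m′ γ) (alg₁ ⟨ m , γ ⟩ ⟨ m′ , γ ⟩ ⟨ t , β ⟩) ⟩
      (⟨ m , γ ⟩ + ⟨ t , β ⟩) - ⟨ m′ , γ ⟩ - ⟨ t , β ⟩
        ≡⟨ cong (λ z → z - ⟨ m′ , γ ⟩ - ⟨ t , β ⟩) (trans (cong (_+ ⟨ t , β ⟩) (⟨⟩-cong {m} (λ _ → refl)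
            (λ k → sym (actRoot-reverse v₀ γ k))))
             (trans (A≡A′ β) (cong (_+ ⟨ t′ , β ⟩) (⟨⟩-cong {m′} (λ _ → refl) (λ k → trans (sym (v₀≗v₀′ β k))
             (actRoot-reverse v₀ γ k)))))) ⟩
      (⟨ m′ , γ ⟩ + ⟨ t′ , β ⟩) - ⟨ m′ , γ ⟩ - ⟨ t , β ⟩
        ≡⟨ alg₂ ⟨ m′ , γ ⟩ ⟨ t′ , β ⟩ ⟨ t , β ⟩ ⟩
      ⟨ t′ , β ⟩ - 1ℤ * ⟨ t , β ⟩
        ≡⟨ sym (⟨⟩-shiftˡ t′ 1ℤ t β) ⟩
      ⟨ shift t′ 1ℤ t , β ⟩
        ≡⟨ ⟨⟩-actRoot-adjoint v₀ (shift t′ 1ℤ t) γ ⟩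
      ⟨ σ , γ ⟩ ∎
      where
      β = actRoot C v₀ γ
      alg₁ : ∀ a b t → a - b ≡ (a + t) - b - t
      alg₁ = solve-∀
      alg₂ : ∀ b s t → (b + s) - b - t ≡ s - 1ℤ * t
      alg₂ = solve-∀
    m-m′≗σ : (λ k → m k - m′ k) ≗ σ
    m-m′≗σ k = trans (ℤ.i-j≡0⇒i≡j _ _ (⟨⟩-nondegenerate {shift (λ k → m k - m′ k) 1ℤ σ} zero-pairing k))
        (ℤ.*-identityˡ (σ k))
      where
      alg : ∀ x → x - 1ℤ * x ≡ 0ℤ
      alg = solve-∀
      zero-pairing : ∀ l → ⟨ shift (λ k → m k - m′ k) 1ℤ σ ,α l ⟩ ≡ 0ℤ
      zero-pairing l = trans (sym (⟨⟩-αʳ (shift (λ k → m k - m′ k) 1ℤ σ) l)) (trans (⟨⟩-shiftˡ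
          (λ k → m k - m′ k) 1ℤ σ (α l))
        (trans (cong (λ z → z - 1ℤ * ⟨ σ , α l ⟩) (⟨m-m′⟩ (α l))) (alg ⟨ σ , α l ⟩)))

  -- Write w = w₀ t_μ and let u = w₀ c, with c in W_J, be the minimal element of its coset. Then w =
  -- u c⁻¹ t_μ = u t_{μc} c⁻¹, which gives the lattice vector (μ)c and the correction v = c⁻¹.
  bullet-surjective : ∀ J w → LiesIn C J w → ∃[ u ] ∃[ m ] (IsMinRep C J u × IsBullet C J u m w)
  bullet-surjective J w lies with coset-minimum J (suc (length (linear w))) (linear w) ℕ.≤-refl
  ... | u , c , red , pos , _ , c∈ , e =
        u , actCo c μ , reduced∧positive⇒minRep red pos , lies , embed (reverse c) , embed-All (reverse-InWJ c∈) , λ x →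
        pair-ext λ β → begin
          pair C (act C w x) β
            ≡⟨ pair-act w x β ⟩
          pair C x (actRoot C (reverse w₀) β) ℚ.+ ι ⟨ μ , β ⟩
            ≡⟨ cong₂ (λ s t → s ℚ.+ ι t) (trans (sym (pair-actW w₀ x β)) (pair-cong {actW C w₀ x} (λ _ → refl)
                (λ k → sym (actRoot-reverse c β k))))
                 (sym (⟨⟩-actRoot c μ β)) ⟩
          pair C (actW C w₀ x) (actRoot C (reverse c) (actRoot C c β)) ℚ.+ ι ⟨ actCo c μ , actRoot C c β ⟩
            ≡⟨ cong (ℚ._+ ι ⟨ actCo c μ , actRoot C c β ⟩) (trans (sym (pair-actW c (actW C w₀ x) (actRoot C c β)))
                 (pair-cong {β = actRoot C c β} (λ k → sym (e x k)) (λ _ → refl))) ⟩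
          pair C (actW C u x) (actRoot C c β) ℚ.+ ι ⟨ actCo c μ , actRoot C c β ⟩
            ≡⟨ sym (pair-translate (actCo c μ) (actW C u x) (actRoot C c β)) ⟩
          pair C (translate C (actCo c μ) (actW C u x)) (actRoot C c β)
            ≡⟨ sym (trans (cong (λ y → pair C y β) (act-embed (reverse c) (translate C (actCo c μ) (actW C u x))))
                 (pair-actW-reverse c (translate C (actCo c μ) (actW C u x)) β)) ⟩
          pair C (act C (embed (reverse c)) (translate C (actCo c μ) (actW C u x))) β ∎
    where
    w₀ = linear w
    μ = translation w

theorem4p10 : ∀ (n : ℕ) (C : CartanMatrix n) → IsFiniteIrreducibleCartan C →
    ∀ (J : Subset n) →
    (∀ u m → IsMinRep C J u → ∃[ w ] IsBullet C J u m w)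
    × (∀ u u' m m' w w' → IsMinRep C J u → IsMinRep C J u' →
    _≈W_ C u u' → _≡[_]_ C m J m' →
    IsBullet C J u m w → IsBullet C J u' m' w' → _≈_ C w w')
    × (∀ u u' m m' w w' → IsMinRep C J u → IsMinRep C J u' →
    IsBullet C J u m w → IsBullet C J u' m' w' → _≈_ C w w' →
    _≈W_ C u u' × _≡[_]_ C m J m')
    × (∀ w → LiesIn C J w →
    ∃[ u ] ∃[ m ] (IsMinRep C J u × IsBullet C J u m w))
theorem4p10 n C ifc J =
    (λ u m _ → bullet-exists J u m)
  , (λ u u′ m m′ w w′ _ _ → bullet-well-defined J u u′ m m′ w w′)
  , bullet-injective J
  , bullet-surjective J
  where open Bullet C (integralCartan ifc)
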